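{- Let $\ell$ be an odd prime, let $a\in\mathbb{Z}_\ell^\times$, and let $\gamma\in\{\alpha,\alpha'\}$, where $\alpha=\alpha(a,u)$ and $\alpha'=\alpha'(a,u)$ are the two families of voltage assignments on the complete graphs $K_u$ defined in the context. For integers $\mu\geq 0$ and $\lambda$ and real $x>0$, let $\mathcal{T}_{\le x}(\mu,\lambda,\gamma,\ell)$ be the set of integers $u$ with $3\le u\le x$ such that $\mu_{u,\gamma}=\mu$ and $\lambda_{u,\gamma}=\lambda$, and let $\mathcal{A}_{\le x}$ be the set of non-negative integers $u\le x$. Then $$\lim_{x\to\infty}\frac{\#\mathcal{T}_{\le x}(\mu,\lambda,\gamma,\ell)}{\#\mathcal{A}_{\le x}}=\begin{cases}\frac{\ell-2}{\ell}&\text{if }\mu=0\text{ and }\lambda=1,\\ \frac{\ell-1}{\ell^{\mu+1}}&\text{if }\mu>0\text{ and }\lambda=1,\\ 0&\text{if }\lambda\ne1.\end{cases}$$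
   Context: For $b\in\mathbb{Z}_\ell$ put $\binom{b}{n}=\frac{b(b-1)\cdots(b-n+1)}{n!}\in\mathbb{Z}_\ell$ and $(1+T)^b=\sum_{n\ge0}\binom{b}{n}T^n\in\mathbb{Z}_\ell[[T]]$. Let $K_u$ be the complete graph with vertices $v_1,\dots,v_u$ (one undirected edge between each pair of distinct vertices, no loops), with each edge oriented from $v_i$ to $v_j$ for $i<j$. A $\mathbb{Z}_\ell$-valued voltage assignment on $K_u$ is a family $(a_{i,j})_{1\le i<j\le u}$ of elements of $\mathbb{Z}_\ell$. Its characteristic series is $f(T)=\det(m_{i,j}(T))_{1\le i,j\le u}\in\mathbb{Z}_\ell[[T]]$, where $m_{i,i}=u-1$, $m_{i,j}=-(1+T)^{a_{i,j}}$ if $i<j$, and $m_{i,j}=-(1+T)^{ -a_{j,i}}$ if $j<i$. Its constant term is $0$. When $f\ne0$ (which holds for the assignments below when $u\ge3$), by Weierstrass preparation write $f(T)=\ell^{\mu}g(T)U(T)$ with $\mu\in\mathbb{Z}_{\geq 0}$, $g$ a distinguished polynomial (monic, all non-leading coefficients divisible by $\ell$) and $U\in\mathbb{Z}_\ell[[T]]^\times$; the invariants of the assignment are $\mu$ and $\lambda:=\deg g-1$ (note the shift by $-1$). For $a\in\mathbb{Z}_\ell^\times$ and $u\ge3$: $\alpha(a,u)$ is the single voltage assignment with $a_{1,2}=a$ and all other $a_{i,j}=0$; $\alpha'(a,u)$ is the assignment with $a_{1,j}=a$ for all $2\le j\le u-1$ and all other $a_{i,j}=0$. Write $\mu_{u,\gamma},\lambda_{u,\gamma}$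 for the invariants of $K_u$ with the assignment $\gamma(a,u)$, $\gamma\in\{\alpha,\alpha'\}$. -}

module Defs where

open import Algebra.Bundles using (CommutativeRing; RawRing)
import Algebra.Definitions.RawSemiring as RawSemiringDefs
open import Algebra.Structures using (IsCommutativeRing)
open import Data.Bool.Base using (if_then_else_; _∧_)
open import Data.Fin.Base as Fin using (Fin; toℕ; punchIn)
import Data.Fin.Properties as Fin
open import Data.Integer.Base as ℤ using (ℤ; +_; 0ℤ; 1ℤ)
open import Data.Integer.Divisibility.Signed using
  (_∣_; divides; quotient; ∣ᵤ⇒∣; ∣⇒∣ᵤ; ∣m∣n⇒∣m+n; ∣m⇒∣-m; ∣n⇒∣m*n; ∣m⇒∣m*n;
   ∣-trans)
import Data.Integer.Properties as ℤ
open import Data.Integer.Tactic.RingSolver using (solve-∀)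
open import Data.List.Base using (List; length)
open import Data.List.Membership.Propositional using (_∈_)
open import Data.List.Relation.Unary.Unique.Propositional using (Unique)
open import Data.Nat.Base as ℕ using (ℕ; zero; suc; _∸_; _!; NonZero)
import Data.Nat.Divisibility as ℕ
open import Data.Nat.Induction using (<-rec)
open import Data.Nat.Primality using (Prime; prime⇒nonZero; prime⇒nonTrivial; euclidsLemma)
import Data.Nat.Properties as ℕ
open import Data.Product.Base using (∃-syntax; _×_; _,_)
open import Data.Rational.Base as ℚ using (ℚ; 0ℚ)
open import Data.Sum.Base using (inj₁; inj₂)
open import Function.Bundles using (_⇔_)
open import Level using (0ℓ)
open import Relation.Binary.Definitions using (tri<; tri≈; tri>)
open import Relation.Binary.PropositionalEquality
  using (_≡_; refl; sym; trans; cong; cong₂; subst)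
open import Relation.Nullary.Decidable using (yes; no; does)
open import Relation.Nullary.Negation using (contradiction)
open import Relation.Unary using (Pred)

module Adic (ℓ : ℕ) where

  infix 4 _≡_[mod-ℓ^_]
  record _≡_[mod-ℓ^_] (x y : ℤ) (n : ℕ) : Set where
    constructor mod
    field difference : + (ℓ ℕ.^ n) ∣ x ℤ.- y
  open _≡_[mod-ℓ^_] public

  -- `residue n` represents the image in ℤ/ℓⁿ.
  record ℤₗ : Set where
    field
      residue  : ℕ → ℤ
      coherent : ∀ n → residue (suc n) ≡ residue n [mod-ℓ^ n ]
  open ℤₗ public

  infix 4 _≈_
  record _≈_ (x y : ℤₗ) : Set where
    constructor residuewise
    field congruent : ∀ n → residue x n ≡ residue y n [mod-ℓ^ n ]
  open _≈_ public

  ≡⇒mod : ∀ {x y} n → x ≡ y → x ≡ y [mod-ℓ^ n ]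
  ≡⇒mod {x} n refl = mod (divides 0ℤ (ℤ.+-inverseʳ x))

  mod-sym : ∀ {x y} n → x ≡ y [mod-ℓ^ n ] → y ≡ x [mod-ℓ^ n ]
  mod-sym {x} {y} n (mod p) = mod (subst (_ ∣_) (lem x y) (∣m⇒∣-m p))
    where lem : ∀ x y → ℤ.- (x ℤ.- y) ≡ y ℤ.- x
          lem = solve-∀

  mod-trans : ∀ {x y z} n → x ≡ y [mod-ℓ^ n ] → y ≡ z [mod-ℓ^ n ] → x ≡ z [mod-ℓ^ n ]
  mod-trans {x} {y} {z} n (mod p) (mod q) = mod (subst (_ ∣_) (lem x y z) (∣m∣n⇒∣m+n p q))
    where lem : ∀ x y z → (x ℤ.- y) ℤ.+ (y ℤ.- z) ≡ x ℤ.- z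
          lem = solve-∀

  mod-+ : ∀ {x x′ y y′} n → x ≡ x′ [mod-ℓ^ n ] → y ≡ y′ [mod-ℓ^ n ] →
          x ℤ.+ y ≡ x′ ℤ.+ y′ [mod-ℓ^ n ]
  mod-+ {x} {x′} {y} {y′} n (mod p) (mod q) = mod (subst (_ ∣_) (lem x x′ y y′) (∣m∣n⇒∣m+n p q))
    where lem : ∀ x x′ y y′ → (x ℤ.- x′) ℤ.+ (y ℤ.- y′) ≡ (x ℤ.+ y) ℤ.- (x′ ℤ.+ y′)
          lem = solve-∀

  mod-* : ∀ {x x′ y y′} n → x ≡ x′ [mod-ℓ^ n ] → y ≡ y′ [mod-ℓ^ n ] →
          x ℤ.* y ≡ x′ ℤ.* y′ [mod-ℓ^ n ]
  mod-* {x} {x′} {y} {y′} n (mod p) (mod q) =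
    mod (subst (_ ∣_) (lem x x′ y y′) (∣m∣n⇒∣m+n (∣m⇒∣m*n y p) (∣n⇒∣m*n x′ q)))
    where lem : ∀ x x′ y y′ →
                (x ℤ.- x′) ℤ.* y ℤ.+ x′ ℤ.* (y ℤ.- y′) ≡ x ℤ.* y ℤ.- x′ ℤ.* y′
          lem = solve-∀

  mod-neg : ∀ {x y} n → x ≡ y [mod-ℓ^ n ] → ℤ.- x ≡ ℤ.- y [mod-ℓ^ n ]
  mod-neg {x} {y} n (mod p) = mod (subst (_ ∣_) (lem x y) (∣m⇒∣-m p))
    where lem : ∀ x y → ℤ.- (x ℤ.- y) ≡ (ℤ.- x) ℤ.- (ℤ.- y)
          lem = solve-∀

  mod-step : ∀ {x y} n → x ≡ y [mod-ℓ^ suc n ] → x ≡ y [mod-ℓ^ n ]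
  mod-step n (mod p) = mod (∣-trans (divides (+ ℓ) (ℤ.pos-* ℓ (ℓ ℕ.^ n))) p)

  ι : ℤ → ℤₗ
  ι z = record { residue = λ _ → z ; coherent = λ n → ≡⇒mod n refl }

  infixl 7 _*_
  infixl 6 _+_
  infix  8 -_

  _+_ _*_ : ℤₗ → ℤₗ → ℤₗ
  x + y = record
    { residue  = λ n → residue x n ℤ.+ residue y n
    ; coherent = λ n → mod-+ n (coherent x n) (coherent y n)
    }
  x * y = record
    { residue  = λ n → residue x n ℤ.* residue y n
    ; coherent = λ n → mod-* n (coherent x n) (coherent y n)
    }

  -_ : ℤₗ → ℤₗ
  - x = record
    { residue  = λ n → ℤ.- residue x n
    ; coherent = λ n → mod-neg n (coherent x n)
    }

  ℤₗ-isCommutativeRing : IsCommutativeRing _≈_ _+_ _*_ -_ (ι 0ℤ) (ι 1ℤ)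
  ℤₗ-isCommutativeRing = record
    { isRing = record
      { +-isAbelianGroup = record
        { isGroup = record
          { isMonoid = record
            { isSemigroup = record
              { isMagma = record
                { isEquivalence = record
                  { refl  = residuewise λ n → ≡⇒mod n refl
                  ; sym   = λ p → residuewise λ n → mod-sym n (congruent p n)
                  ; trans = λ p q → residuewise λ n → mod-trans n (congruent p n) (congruent q n)
                  }
                ; ∙-cong = λ p q → residuewise λ n → mod-+ n (congruent p n) (congruent q n)
                }
              ; assoc = λ x y z → residuewise λ n → ≡⇒mod n (ℤ.+-assoc (residue x n) _ _)
              }
            ; identity = (λ x → residuewise λ n → ≡⇒mod n (ℤ.+-identityˡ (residue x n)))
                       , (λ x → residuewise λ n → ≡⇒mod n (ℤ.+-identityʳ (residue x n)))
            }
          ; inverse = (λ x → residuewise λ n → ≡⇒mod n (ℤ.+-inverseˡ (residue x n)))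
                    , (λ x → residuewise λ n → ≡⇒mod n (ℤ.+-inverseʳ (residue x n)))
          ; ⁻¹-cong = λ p → residuewise λ n → mod-neg n (congruent p n)
          }
        ; comm = λ x y → residuewise λ n → ≡⇒mod n (ℤ.+-comm (residue x n) _)
        }
      ; *-cong = λ p q → residuewise λ n → mod-* n (congruent p n) (congruent q n)
      ; *-assoc = λ x y z → residuewise λ n → ≡⇒mod n (ℤ.*-assoc (residue x n) _ _)
      ; *-identity = (λ x → residuewise λ n → ≡⇒mod n (ℤ.*-identityˡ (residue x n)))
                   , (λ x → residuewise λ n → ≡⇒mod n (ℤ.*-identityʳ (residue x n)))
      ; distrib = (λ x y z → residuewise λ n → ≡⇒mod n (ℤ.*-distribˡ-+ (residue x n) _ _))
                , (λ x y z → residuewise λ n → ≡⇒mod n (ℤ.*-distribʳ-+ (residue x n) (residue y n) _))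
      }
    ; *-comm = λ x y → residuewise λ n → ≡⇒mod n (ℤ.*-comm (residue x n) _)
    }

  ℤₗ-commutativeRing : CommutativeRing 0ℓ 0ℓ
  ℤₗ-commutativeRing = record { isCommutativeRing = ℤₗ-isCommutativeRing }

  ℤₗ-rawRing : RawRing 0ℓ 0ℓ
  ℤₗ-rawRing = CommutativeRing.rawRing ℤₗ-commutativeRing

  falling : ℤₗ → ℕ → ℤₗ
  falling b zero    = ι 1ℤ
  falling b (suc n) = falling b n * (b + - ι (+ n))

  coherent-+ : ∀ (x : ℤₗ) k m → residue x (m ℕ.+ k) ≡ residue x k [mod-ℓ^ k ]
  coherent-+ x k zero    = ≡⇒mod k refl
  coherent-+ x k (suc m) = mod-trans k (down m (coherent x (m ℕ.+ k))) (coherent-+ x k m)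
    where
    down : ∀ {x y} m → x ≡ y [mod-ℓ^ m ℕ.+ k ] → x ≡ y [mod-ℓ^ k ]
    down zero    p = p
    down (suc m) p = down m (mod-step (m ℕ.+ k) p)

fallingℤ : ℤ → ℕ → ℤ
fallingℤ x zero    = 1ℤ
fallingℤ x (suc n) = fallingℤ x n ℤ.* (x ℤ.- + n)

falling-shift : ∀ x n → fallingℤ (1ℤ ℤ.+ x) (suc n) ≡ (1ℤ ℤ.+ x) ℤ.* fallingℤ x n
falling-shift x zero    = lem x
  where lem : ∀ x → 1ℤ ℤ.* (1ℤ ℤ.+ x ℤ.- 0ℤ) ≡ (1ℤ ℤ.+ x) ℤ.* 1ℤ
        lem = solve-∀
falling-shift x (suc n) =
  trans (cong (ℤ._* (1ℤ ℤ.+ x ℤ.- + suc n)) (falling-shift x n))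
        (lem x (fallingℤ x n) (+ n))
  where lem : ∀ x f m → (1ℤ ℤ.+ x) ℤ.* f ℤ.* (1ℤ ℤ.+ x ℤ.- (1ℤ ℤ.+ m))
                      ≡ (1ℤ ℤ.+ x) ℤ.* (f ℤ.* (x ℤ.- m))
        lem = solve-∀

falling-step : ∀ x n → fallingℤ (1ℤ ℤ.+ x) (suc n)
                     ≡ fallingℤ x (suc n) ℤ.+ (+ suc n) ℤ.* fallingℤ x n
falling-step x n = trans (falling-shift x n) (lem x (fallingℤ x n) (+ n))
  where lem : ∀ x f m → (1ℤ ℤ.+ x) ℤ.* f ≡ f ℤ.* (x ℤ.- m) ℤ.+ (1ℤ ℤ.+ m) ℤ.* f
        lem = solve-∀

falling-0 : ∀ n → fallingℤ 0ℤ (suc n) ≡ 0ℤ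
falling-0 zero    = refl
falling-0 (suc n) = cong (ℤ._* (0ℤ ℤ.- + suc n)) (falling-0 n)

n!∣fallingℤ : ∀ n x → + (n !) ∣ fallingℤ x n
n!∣fallingℤ zero    x = divides 1ℤ refl
n!∣fallingℤ (suc n) = go
  where
  P : ℤ → Set
  P x = + (suc n !) ∣ fallingℤ x (suc n)

  term : ∀ x → + (suc n !) ∣ (+ suc n) ℤ.* fallingℤ x n
  term x with divides q eq ← n!∣fallingℤ n x = divides q
    (trans (cong ((+ suc n) ℤ.*_) eq)
      (trans (lem (+ suc n) q (+ (n !))) (cong (q ℤ.*_) (sym (ℤ.pos-* (suc n) (n !))))))
    where lem : ∀ a b c → a ℤ.* (b ℤ.* c) ≡ b ℤ.* (a ℤ.* c)
          lem = solve-∀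

  up : ∀ x → P x → P (1ℤ ℤ.+ x)
  up x p = subst (_ ∣_) (sym (falling-step x n)) (∣m∣n⇒∣m+n p (term x))

  down : ∀ x → P (1ℤ ℤ.+ x) → P x
  down x p = subst (_ ∣_)
    (trans (cong (ℤ._+ ℤ.- ((+ suc n) ℤ.* fallingℤ x n)) (falling-step x n))
           (lem (fallingℤ x (suc n)) ((+ suc n) ℤ.* fallingℤ x n)))
    (∣m∣n⇒∣m+n p (∣m⇒∣-m (term x)))
    where lem : ∀ a b → a ℤ.+ b ℤ.+ ℤ.- b ≡ a
          lem = solve-∀

  base : P 0ℤ
  base = divides 0ℤ (falling-0 n)

  go : ∀ x → P x
  go (+ zero)         = base
  go (+ suc m)        = up (+ m) (go (+ m))
  go ℤ.-[1+ zero ]    = down ℤ.-1ℤ base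
  go ℤ.-[1+ suc m ]   = down ℤ.-[1+ suc m ] (go ℤ.-[1+ m ])

module Binomial (ℓ : ℕ) (ℓ-prime : Prime ℓ) where

  open Adic ℓ

  residue-falling : ∀ b n k → residue (falling b n) k ≡ fallingℤ (residue b k) n
  residue-falling b zero    k = refl
  residue-falling b (suc n) k =
    cong (ℤ._* (residue b k ℤ.- + n)) (residue-falling b n k)

  n!∣falling : ∀ b n k → + (n !) ∣ residue (falling b n) k
  n!∣falling b n k =
    subst (+ (n !) ∣_) (sym (residue-falling b n k)) (n!∣fallingℤ n (residue b k))

  private instance
    _ = prime⇒nonZero ℓ-prime
    _ = prime⇒nonTrivial ℓ-prime

  ^-mono-∣ : ∀ {i j} → i ℕ.≤ j → ℓ ℕ.^ i ℕ.∣ ℓ ℕ.^ j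
  ^-mono-∣ {i} {j} i≤j = ℕ.divides (ℓ ℕ.^ (j ∸ i))
    (trans (cong (ℓ ℕ.^_) (sym (ℕ.m∸n+n≡m i≤j))) (ℕ.^-distribˡ-+-* ℓ (j ∸ i) i))

  cancel-unit : ∀ {m} → ℓ ℕ.∤ m → ∀ k y → ℓ ℕ.^ k ℕ.∣ m ℕ.* y → ℓ ℕ.^ k ℕ.∣ y
  cancel-unit {m} ℓ∤m zero    y p = ℕ.1∣ y
  cancel-unit {m} ℓ∤m (suc k) y p
    with euclidsLemma m y ℓ-prime (ℕ.∣-trans (ℕ.m∣m*n (ℓ ℕ.^ k)) p)
  ... | inj₁ ℓ∣m = contradiction ℓ∣m ℓ∤m
  ... | inj₂ (ℕ.divides-refl y′) =
    subst (ℓ ℕ.^ suc k ℕ.∣_) (ℕ.*-comm ℓ y′)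
      (ℕ.*-monoʳ-∣ ℓ (cancel-unit ℓ∤m k y′
        (ℕ.*-cancelˡ-∣ ℓ (subst (ℓ ℕ.^ suc k ℕ.∣_) eq p))))
    where eq : m ℕ.* (y′ ℕ.* ℓ) ≡ ℓ ℕ.* (m ℕ.* y′)
          eq = trans (sym (ℕ.*-assoc m y′ ℓ)) (ℕ.*-comm (m ℕ.* y′) ℓ)

  Cancel : ℕ → Set
  Cancel m = .{{NonZero m}} → ∀ k y → ℓ ℕ.^ (m ℕ.+ k) ℕ.∣ m ℕ.* y → ℓ ℕ.^ k ℕ.∣ y

  cancel : ∀ m → Cancel m
  cancel = <-rec Cancel step
    where
    step : ∀ m → (∀ {i} → i ℕ.< m → Cancel i) → Cancel m
    step m rec k y p with ℓ ℕ.∣? m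
    ... | no ℓ∤m = cancel-unit ℓ∤m k y (ℕ.∣-trans (^-mono-∣ (ℕ.m≤n+m k m)) p)
    ... | yes (ℕ.divides-refl q) =
      rec q<qℓ {{q≢0}} k y (ℕ.*-cancelˡ-∣ ℓ (subst (ℓ ℕ.^ suc (q ℕ.+ k) ℕ.∣_) eq
        (ℕ.∣-trans (^-mono-∣ (ℕ.+-monoˡ-≤ k q<qℓ)) p)))
      where
      q≢0 : NonZero q
      q≢0 = ℕ.m*n≢0⇒m≢0 q {ℓ}
      q<qℓ : q ℕ.< q ℕ.* ℓ
      q<qℓ = ℕ.m<m*n q ℓ {{q≢0}} (ℕ.nonTrivial⇒n>1 ℓ)
      eq : q ℕ.* ℓ ℕ.* y ≡ ℓ ℕ.* (q ℕ.* y)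
      eq = trans (cong (ℕ._* y) (ℕ.*-comm q ℓ)) (ℕ.*-assoc ℓ q y)

  cancelℤ : ∀ n k {y} → + (ℓ ℕ.^ (n ! ℕ.+ k)) ∣ y ℤ.* + (n !) → + (ℓ ℕ.^ k) ∣ y
  cancelℤ n k {y} p = ∣ᵤ⇒∣ (cancel (n !) {{ℕ._!≢0 n}} k ℤ.∣ y ∣
    (subst (ℓ ℕ.^ (n ! ℕ.+ k) ℕ.∣_)
      (trans (ℤ.abs-* y (+ (n !))) (ℕ.*-comm ℤ.∣ y ∣ (n !))) (∣⇒∣ᵤ p)))

  choose : ℤₗ → ℕ → ℕ → ℤ
  choose b n k = quotient (n!∣falling b n (n ! ℕ.+ k))

  choose-* : ∀ b n k → residue (falling b n) (n ! ℕ.+ k) ≡ choose b n k ℤ.* + (n !)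
  choose-* b n k = _∣_.equality (n!∣falling b n (n ! ℕ.+ k))

  choose-coherent : ∀ b n k → choose b n (suc k) ≡ choose b n k [mod-ℓ^ k ]
  choose-coherent b n k = mod (cancelℤ n k (subst (+ (ℓ ℕ.^ (n ! ℕ.+ k)) ∣_) eq
    (difference (subst (λ j → residue (falling b n) j ≡ residue (falling b n) (n ! ℕ.+ k) [mod-ℓ^ n ! ℕ.+ k ])
      (sym (ℕ.+-suc (n !) k)) (coherent (falling b n) (n ! ℕ.+ k))))))
    where
    lem : ∀ x y z → x ℤ.* z ℤ.- y ℤ.* z ≡ (x ℤ.- y) ℤ.* z
    lem = solve-∀
    eq : residue (falling b n) (n ! ℕ.+ suc k) ℤ.- residue (falling b n) (n ! ℕ.+ k)
       ≡ (choose b n (suc k) ℤ.- choose b n k) ℤ.* + (n !)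
    eq = trans (cong₂ ℤ._-_ (choose-* b n (suc k)) (choose-* b n k))
               (lem (choose b n (suc k)) (choose b n k) (+ (n !)))

  -- The division by n! costs at most n! (crudely) digits of precision, so the
  -- k-th residue of the quotient is read off from level n! + k of the numerator.
  -- `binom-spec` characterises the result.
  binom : ℤₗ → ℕ → ℤₗ
  binom b n = record { residue = choose b n ; coherent = choose-coherent b n }

  binom-spec : ∀ b n → binom b n * ι (+ (n !)) ≈ falling b n
  binom-spec b n = residuewise λ k → subst (_≡ residue (falling b n) k [mod-ℓ^ k ])
    (choose-* b n k) (coherent-+ (falling b n) k (n !))

module PowerSeries {c e} (R : RawRing c e) where

  open RawRing R
  open RawSemiringDefs rawSemiring using (sum)

  constant : Carrier → ℕ → Carrier
  constant x zero    = x
  constant x (suc _) = 0#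

  powerSeries : RawRing c e
  powerSeries = record
    { Carrier = ℕ → Carrier
    ; _≈_     = λ f g → ∀ n → f n ≈ g n
    ; _+_     = λ f g n → f n + g n
    ; _*_     = λ f g n → sum {suc n} λ i → f (toℕ i) * g (n ∸ toℕ i)
    ; -_      = λ f n → - f n
    ; 0#      = λ _ → 0#
    ; 1#      = constant 1#
    }

module Determinant {c e} (R : RawRing c e) where

  open RawRing R
  open RawSemiringDefs rawSemiring using (sum; _^_)

  Matrix : ℕ → Set c
  Matrix n = Fin n → Fin n → Carrier

  -- Cofactor expansion along the first row.
  det : ∀ {n} → Matrix n → Carrier
  det {zero}  M = 1#
  det {suc n} M =
    sum λ j → (- 1#) ^ toℕ j * (M Fin.zero j * det λ r s → M (Fin.suc r) (punchIn j s))

data Family : Set where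
  α α′ : Family

module Voltage (ℓ : ℕ) (ℓ-prime : Prime ℓ) where

  open Adic ℓ public using (ℤₗ; ι)
  open Binomial ℓ ℓ-prime public using (binom)

  private
    module Z  = RawRing (Adic.ℤₗ-rawRing ℓ)
    module Z∣ = RawSemiringDefs Z.rawSemiring

  open PowerSeries (Adic.ℤₗ-rawRing ℓ) public using (powerSeries; constant)

  private
    module S  = RawRing powerSeries
    module S∣ = RawSemiringDefs S.rawSemiring

  open Determinant powerSeries public using (Matrix; det)

  ℤₗ⟦T⟧ : Set
  ℤₗ⟦T⟧ = S.Carrier

  IsUnit : ℤₗ → Set
  IsUnit x = x Z∣.∣ Z.1#

  IsUnitSeries : ℤₗ⟦T⟧ → Set
  IsUnitSeries U = U S∣.∣ S.1#

  [1+T]^_ : ℤₗ → ℤₗ⟦T⟧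
  [1+T]^ b = binom b

  -- The vertices v₁, …, v_u are indexed from 0.
  VoltageAssignment : ℕ → Set
  VoltageAssignment u = (i j : Fin u) → .(i Fin.< j) → ℤₗ

  voltageLaplacian : ∀ {u} → VoltageAssignment u → Matrix u
  voltageLaplacian {u} a i j with Fin.<-cmp i j
  ... | tri≈ _ _ _   = constant (ι (+ u ℤ.- 1ℤ))
  ... | tri< i<j _ _ = S.- ([1+T]^ a i j i<j)
  ... | tri> _ _ j<i = S.- ([1+T]^ (Z.- a j i j<i))

  characteristicSeries : ∀ {u} → VoltageAssignment u → ℤₗ⟦T⟧
  characteristicSeries a = det (voltageLaplacian a)

  -- g is a distinguished polynomial of degree d, viewed as a power series.
  record IsDistinguished (g : ℤₗ⟦T⟧) (d : ℕ) : Set where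
    field
      monic    : g d Z.≈ Z.1#
      degree   : ∀ n → d ℕ.< n → g n Z.≈ Z.0#
      ℓ∣coeffs : ∀ n → n ℕ.< d → ι (+ ℓ) Z∣.∣ g n

  -- Relational since μ and λ are defined only for f ≠ 0; by uniqueness in
  -- Weierstrass preparation at most one pair (μ , λ) is related to f.
  record HasInvariants (f : ℤₗ⟦T⟧) (μ : ℕ) (λ′ : ℤ) : Set where
    field
      g U           : ℤₗ⟦T⟧
      deg-g         : ℕ
      distinguished : IsDistinguished g deg-g
      unit          : IsUnitSeries U
      factorisation : f S.≈ constant (ι (+ ℓ)) S∣.^ μ S.* g S.* U
      λ≡deg-1       : λ′ ≡ + deg-g ℤ.- 1ℤ

  voltage : Family → ℤₗ → ∀ u → VoltageAssignment u
  voltage α  a u i j _ =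
    if does (toℕ i ℕ.≟ 0) ∧ does (toℕ j ℕ.≟ 1) then a else Z.0#
  voltage α′ a u i j _ =
    if does (toℕ i ℕ.≟ 0) ∧ does (suc (toℕ j) ℕ.≤? u ∸ 1) then a else Z.0#

-- A regular Cauchy sequence: `approx n` is within 1/(n+1) of the real number.
record ℝ : Set where
  field
    approx  : ℕ → ℚ
    regular : ∀ m n → ℚ.∣ approx m ℚ.- approx n ∣ ℚ.≤ (+ 1 ℚ./ suc m) ℚ.+ (+ 1 ℚ./ suc n)
open ℝ public

infix 4 _≤ʳ_
_≤ʳ_ : ℕ → ℝ → Set
u ≤ʳ x = ∀ n → + u ℚ./ 1 ℚ.≤ approx x n ℚ.+ (+ 1 ℚ./ suc n)

HasCard : Pred ℕ 0ℓ → ℕ → Set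
HasCard P n = ∃[ us ] Unique us × (∀ u → u ∈ us ⇔ P u) × length us ≡ n

-- #T(x) / #A(x) → L as x → ∞.  Constructively the integer part of a real number
-- need not be computable, so the cardinality m of A(x), which exists classically
-- whenever A(x) is bounded, is quantified over; that of T(x) has to be produced.
HasRelativeDensity : (T A : ℝ → Pred ℕ 0ℓ) → ℚ → Set
HasRelativeDensity T A L =
  ∀ ε → 0ℚ ℚ.< ε →
  ∃[ N ] ∀ x → N ≤ʳ x → ∀ m .{{_ : NonZero m}} → HasCard (A x) m →
  ∃[ n ] HasCard (T x) n × ℚ.∣ (+ n ℚ./ m) ℚ.- L ∣ ℚ.< ε

𝒜≤ : ℝ → Pred ℕ 0ℓ
𝒜≤ x u = u ≤ʳ x

module Counting (ℓ : ℕ) (ℓ-prime : Prime ℓ) where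

  open Voltage ℓ ℓ-prime public

  𝒯≤ : (μ : ℕ) (λ′ : ℤ) → Family → ℤₗ → ℝ → Pred ℕ 0ℓ
  𝒯≤ μ λ′ γ a x u =
    3 ℕ.≤ u × u ≤ʳ x × HasInvariants (characteristicSeries (voltage γ a u)) μ λ′

  private instance
    _ = prime⇒nonZero ℓ-prime

  density : ℕ → ℤ → ℚ
  density zero    (+ 1) = (+ ℓ ℤ.- + 2) ℚ./ ℓ
  density (suc μ) (+ 1) = ((+ ℓ ℤ.- + 1) ℚ./ (ℓ ℕ.^ suc (suc μ))) {{ℕ.m^n≢0 ℓ (suc (suc μ))}}
  density _       _     = 0ℚ

{-# OPTIONS --safe #-}

-- Put p = (1+T)^a and q = (1+T)^(-a), so that p q = 1.  The Laplacian of K_u with voltages at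
-- one vertex is a border around u I - J, whose determinant and kernel relations are explicit,
-- and for both families Cramer elimination of the first column gives
--   f = u^(u-3) (u-2) (2 - p - q) = - u^(u-3) (u-2) q (p - 1)².
-- Since p - 1 is T times a unit, f is u^(u-3) (u-2) T² times a unit.  Comparing coefficients,
-- the only possible invariants are λ = 1 and μ = v(u^(u-3) (u-2)), where v is the ℓ-adic
-- valuation.  For u ≥ μ + 4 this is the given μ iff ℓ ∤ u and v(u-2) = μ, a condition periodic
-- in u modulo ℓ^(μ+1); ℓ ≠ 2 enters because then u and u - 2 are not both divisible by ℓ.

module Submission where

open import Defs
open import Algebra.Bundles using (CommutativeRing; RawRing; module RawRing; module Semiring)
import Algebra.Definitions.RawMagma as RawMagma
import Algebra.Definitions.RawSemiring as RawSemiringDefs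
open import Data.Bool.Base using (if_then_else_)
open import Data.Fin.Base as Fin using (Fin; toℕ; fromℕ<; punchIn; pinch)
import Data.Fin.Properties as Fin
open import Data.Integer.Base as ℤ using (ℤ; +_; -[1+_]; 0ℤ; 1ℤ; _⊖_)
open import Data.Integer.Divisibility.Signed using
  (_∣_; divides; ∣⇒∣ᵤ; ∣ᵤ⇒∣; ∣m⇒∣-m; ∣n⇒∣m*n; ∣m⇒∣m*n; ∣m∣n⇒∣m+n)
import Data.Integer.Properties as ℤ
open import Data.Integer.Tactic.RingSolver using (solve-∀)
open import Data.List.Base using (List; []; _∷_; length; lookup; filter; downFrom)
open import Data.List.Membership.Propositional using (_∈_)
open import Data.List.Membership.Propositional.Properties
  using (∈-lookup; ∈-filter⁺; ∈-filter⁻; ∈-downFrom⁺; ∈-downFrom⁻)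
open import Data.List.Relation.Unary.All as All using (All)
open import Data.List.Relation.Unary.AllPairs.Core using ([]; _∷_)
open import Data.List.Relation.Unary.Any using (index)
open import Data.List.Relation.Unary.Any.Properties using (lookup-index)
open import Data.List.Relation.Unary.Unique.Propositional using (Unique)
open import Data.List.Relation.Unary.Unique.Propositional.Properties using (filter⁺; downFrom⁺)
open import Data.Maybe.Base as Maybe using (Maybe)
open import Data.Nat.Base as ℕ using (ℕ; zero; suc; _∸_; z≤n; s≤s; _!; NonZero)
open import Data.Nat.Coprimality using (Coprime; coprime-Bézout)
import Data.Nat.Divisibility as ℕ
open import Data.Nat.GCD using (module Bézout)
open import Data.Nat.Induction using (<-rec)
open import Data.Nat.Primality using
  (Prime; prime⇒nonZero; prime⇒nonTrivial; prime⇒irreducible; euclidsLemma)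
import Data.Nat.Properties as ℕ
import Data.Nat.Tactic.RingSolver as ℕ-Solver
open import Data.List.Membership.DecPropositional ℕ._≟_ using (_∈?_)
open import Data.Product.Base using (_,_; _×_; ∃-syntax; proj₁; proj₂)
open import Data.Rational.Base as ℚ using (ℚ; 0ℚ; mkℚ)
import Data.Rational.Properties as ℚ
open import Data.Rational.Unnormalised.Base as ℚᵘ using (ℚᵘ; mkℚᵘ)
import Data.Rational.Unnormalised.Properties as ℚᵘ
open import Data.Sum.Base using (_⊎_; inj₁; inj₂)
open import Data.Vec.Functional using (foldr)
open import Function.Base using (_∘_)
open import Function.Bundles using (_⇔_; mk⇔; Equivalence)
open import Level using (0ℓ; _⊔_)
open import Relation.Binary.Consequences using (dec⇒weaklyDec)
open import Relation.Binary.Definitions using (tri<; tri≈; tri>)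
open import Relation.Binary.PropositionalEquality as ≡
  using (_≡_; _≢_; cong; cong₂; subst; subst₂; module ≡-Reasoning)
open import Relation.Nullary.Decidable using (Dec; yes; no; dec-true; dec-false; _×-dec_; ¬?)
open import Relation.Nullary.Negation using (¬_; contradiction)
open import Relation.Unary using (Pred; Decidable)

-- Both families are one case. At v₁ a single edge carries a voltage b and all other edges carry c:
-- α is (a, 0), and α′ is (0, a) with the edge to v_u as the exception. The determinant depends only
-- on b - c up to sign, so the two agree. Division is the obstacle. The inverse of u I - J has
-- denominators divisible by ℓ when ℓ divides u. Determinants are therefore computed up to a
-- positive integer factor, which torsion-freeness of the power series ring then cancels. The same
-- device gives p q = 1: the product solves the differential equation of the binomial series with
-- exponent 0, and cancelling n + 1 in each coefficient forces it to be 1. The integer part of a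
-- real x cannot be computed, so counting is done in terms of m, the cardinality of A(x). That set
-- is downward closed, hence equal to the numbers below m. Periodicity then keeps the discrepancy
-- between the count times the period and m times the count per period below a constant independent
-- of m.

-- Polynomial identities with integer coefficients in a commutative ring

module IntegerSolver {c e} (R : CommutativeRing c e) where

  open CommutativeRing R
  open import Algebra.Properties.Ring ring
  open import Algebra.Properties.AbelianGroup +-abelianGroup using (⁻¹-∙-comm)
  open import Algebra.Properties.Semiring.Mult.TCOptimised semiring renaming (_×_ to _·_)
  open import Relation.Binary.Reasoning.Setoid setoid
  open import Algebra.Solver.Ring.AlmostCommutativeRing
    using (fromCommutativeRing; _-Raw-AlmostCommutative⟶_)

  -- The coefficients of the solver must have decidable equality, which ℓ-adic integers and power
  -- series do not provide; so they are integers, mapped into `R` by the canonical homomorphism.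
  fromℤ : ℤ → Carrier
  fromℤ (+ n)      = n · 1#
  fromℤ (-[1+ n ]) = - (suc n · 1#)

  fromℤ-⊖ : ∀ m n → fromℤ (m ℤ.⊖ n) ≈ m · 1# - n · 1#
  fromℤ-⊖ m       zero    = sym (trans (+-congˡ -0#≈0#) (+-identityʳ _))
  fromℤ-⊖ zero    (suc n) = sym (+-identityˡ _)
  fromℤ-⊖ (suc m) (suc n) = begin
    fromℤ (suc m ℤ.⊖ suc n)               ≡⟨ ≡.cong fromℤ (ℤ.[1+m]⊖[1+n]≡m⊖n m n) ⟩
    fromℤ (m ℤ.⊖ n)                       ≈⟨ fromℤ-⊖ m n ⟩
    m · 1# - n · 1#                       ≈⟨ +-congʳ (+-identityʳ _) ⟨
    (m · 1# + 0#) - n · 1#                ≈⟨ +-congʳ (+-congˡ (-‿inverseʳ 1#)) ⟨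
    (m · 1# + (1# - 1#)) - n · 1#         ≈⟨ +-congʳ (+-assoc _ _ _) ⟨
    (m · 1# + 1# - 1#) - n · 1#           ≈⟨ +-assoc _ _ _ ⟩
    (m · 1# + 1#) + (- 1# - n · 1#)       ≈⟨ +-cong (trans (+-comm _ _) (sym (1+× m 1#))) (trans (⁻¹-∙-comm _ _) (-‿cong (sym (1+× n 1#)))) ⟩
    suc m · 1# - suc n · 1#               ∎

  fromℤ-neg : ∀ z → fromℤ (ℤ.- z) ≈ - fromℤ z
  fromℤ-neg (+ zero)   = sym -0#≈0#
  fromℤ-neg (+ suc n)  = refl
  fromℤ-neg (-[1+ n ]) = sym (-‿involutive _)

  fromℤ-+ : ∀ y z → fromℤ (y ℤ.+ z) ≈ fromℤ y + fromℤ z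
  fromℤ-+ (+ m)      (+ n)      = ×-homo-+ 1# m n
  fromℤ-+ (+ m)      (-[1+ n ]) = fromℤ-⊖ m (suc n)
  fromℤ-+ (-[1+ m ]) (+ n)      = trans (fromℤ-⊖ n (suc m)) (+-comm _ _)
  fromℤ-+ (-[1+ m ]) (-[1+ n ]) = begin
    - (suc (suc (m ℕ.+ n)) · 1#)        ≡⟨ ≡.cong (λ k → - (suc k · 1#)) (≡.sym (ℕ.+-suc m n)) ⟩
    - ((suc m ℕ.+ suc n) · 1#)          ≈⟨ -‿cong (×-homo-+ 1# (suc m) (suc n)) ⟩
    - (suc m · 1# + suc n · 1#)         ≈⟨ ⁻¹-∙-comm _ _ ⟨
    - (suc m · 1#) - suc n · 1#         ∎

  fromℤ-pos-* : ∀ m z → fromℤ (+ m ℤ.* z) ≈ m · 1# * fromℤ z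
  fromℤ-pos-* m (+ n) = begin
    fromℤ (+ m ℤ.* + n) ≡⟨ ≡.cong fromℤ (ℤ.pos-* m n) ⟨
    (m ℕ.* n) · 1#      ≈⟨ ×1-homo-* m n ⟩
    m · 1# * n · 1#     ∎
  fromℤ-pos-* m (-[1+ n ]) = begin
    fromℤ (+ m ℤ.* -[1+ n ])         ≡⟨ ≡.cong fromℤ (ℤ.neg-distribʳ-* (+ m) (+ suc n)) ⟨
    fromℤ (ℤ.- (+ m ℤ.* + suc n))    ≈⟨ fromℤ-neg (+ m ℤ.* + suc n) ⟩
    - fromℤ (+ m ℤ.* + suc n)        ≈⟨ -‿cong (fromℤ-pos-* m (+ suc n)) ⟩
    - (m · 1# * suc n · 1#)          ≈⟨ -‿distribʳ-* _ _ ⟩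
    m · 1# * - (suc n · 1#)          ∎

  fromℤ-* : ∀ y z → fromℤ (y ℤ.* z) ≈ fromℤ y * fromℤ z
  fromℤ-* (+ m)      z = fromℤ-pos-* m z
  fromℤ-* (-[1+ m ]) z = begin
    fromℤ (-[1+ m ] ℤ.* z)           ≡⟨ ≡.cong fromℤ (ℤ.neg-distribˡ-* (+ suc m) z) ⟨
    fromℤ (ℤ.- (+ suc m ℤ.* z))      ≈⟨ fromℤ-neg (+ suc m ℤ.* z) ⟩
    - fromℤ (+ suc m ℤ.* z)          ≈⟨ -‿cong (fromℤ-pos-* (suc m) z) ⟩
    - (suc m · 1# * fromℤ z)         ≈⟨ -‿distribˡ-* _ _ ⟩
    - (suc m · 1#) * fromℤ z         ∎

  private
    morphism : ℤ.+-*-rawRing -Raw-AlmostCommutative⟶ fromCommutativeRing R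
    morphism = record
      { ⟦_⟧    = fromℤ
      ; +-homo = fromℤ-+
      ; *-homo = fromℤ-*
      ; -‿homo = fromℤ-neg
      ; 0-homo = refl
      ; 1-homo = refl
      }

    dec : ∀ y z → Maybe (fromℤ y ≈ fromℤ z)
    dec y z = Maybe.map (λ { ≡.refl → refl }) (dec⇒weaklyDec ℤ._≟_ y z)

  open import Algebra.Solver.Ring ℤ.+-*-rawRing (fromCommutativeRing R) morphism dec public
    using (solve; con; _:+_; _:*_; _:-_; :-_; _:=_; _:^_)

-- Power series

module PowerSeriesRing {c e} (R : CommutativeRing c e) where

  open CommutativeRing R
  open PowerSeries rawRing public
  open IntegerSolver R
  open import Relation.Binary.Reasoning.Setoid setoid

  Series : Set c
  Series = ℕ → Carrier

  private module S = RawRing powerSeries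

  -- Coefficient `suc n` of a product unfolds definitionally to `f 0 * g (suc n)` plus coefficient
  -- `n` of `shift f` times `g`. The ring laws below are inductions along this unfolding, with the
  -- series generalised.
  shift : Series → Series
  shift f n = f (suc n)

  scale : Carrier → Series → Series
  scale x f n = x * f n

  *-cong-series : ∀ {f f′ g g′} → f S.≈ f′ → g S.≈ g′ → f S.* g S.≈ f′ S.* g′
  *-cong-series p q zero    = +-congʳ (*-cong (p 0) (q 0))
  *-cong-series p q (suc n) =
    +-cong (*-cong (p 0) (q (suc n))) (*-cong-series (p ∘ suc) q n)

  *-distribʳ-series : ∀ f g h → (g S.+ h) S.* f S.≈ g S.* f S.+ h S.* f
  *-distribʳ-series f g h zero =
    solve 3 (λ f g h → (g :+ h) :* f :+ con ℤ.0ℤ := g :* f :+ con ℤ.0ℤ :+ (h :* f :+ con ℤ.0ℤ)) refl (f 0) (g 0) (h 0)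
  *-distribʳ-series f g h (suc n) = begin
    (g 0 + h 0) * f (suc n) + ((shift g S.+ shift h) S.* f) n
      ≈⟨ +-congˡ (*-distribʳ-series f (shift g) (shift h) n) ⟩
    (g 0 + h 0) * f (suc n) + ((shift g S.* f) n + (shift h S.* f) n)
      ≈⟨ solve 5 (λ f g h x y → (g :+ h) :* f :+ (x :+ y) := g :* f :+ x :+ (h :* f :+ y))
           refl (f (suc n)) (g 0) (h 0) _ _ ⟩
    (g S.* f S.+ h S.* f) (suc n) ∎

  scale-* : ∀ x f g → scale x f S.* g S.≈ scale x (f S.* g)
  scale-* x f g zero    = solve 3 (λ x f g → x :* f :* g :+ con ℤ.0ℤ := x :* (f :* g :+ con ℤ.0ℤ)) refl x (f 0) (g 0)
  scale-* x f g (suc n) = begin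
    x * f 0 * g (suc n) + (scale x (shift f) S.* g) n
      ≈⟨ +-congˡ (scale-* x (shift f) g n) ⟩
    x * f 0 * g (suc n) + x * (shift f S.* g) n
      ≈⟨ solve 4 (λ x f g h → x :* f :* g :+ x :* h := x :* (f :* g :+ h)) refl x (f 0) (g (suc n)) _ ⟩
    scale x (f S.* g) (suc n) ∎

  *-assoc-series : ∀ f g h → (f S.* g) S.* h S.≈ f S.* (g S.* h)
  *-assoc-series f g h zero    =
    solve 3 (λ f g h → (f :* g :+ con ℤ.0ℤ) :* h :+ con ℤ.0ℤ := f :* (g :* h :+ con ℤ.0ℤ) :+ con ℤ.0ℤ) refl (f 0) (g 0) (h 0)
  *-assoc-series f g h (suc n) = begin
    -- Dropping the constant term of f g leaves `f 0` times `shift g` plus `shift f` times g;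
    -- distributivity then separates the two parts.
    (f 0 * g 0 + 0#) * h (suc n) + ((scale (f 0) (shift g) S.+ shift f S.* g) S.* h) n
      ≈⟨ +-congˡ (*-distribʳ-series h (scale (f 0) (shift g)) (shift f S.* g) n) ⟩
    (f 0 * g 0 + 0#) * h (suc n) + ((scale (f 0) (shift g) S.* h) n + ((shift f S.* g) S.* h) n)
      ≈⟨ +-congˡ (+-cong (scale-* (f 0) (shift g) h n) (*-assoc-series (shift f) g h n)) ⟩
    (f 0 * g 0 + 0#) * h (suc n) + (f 0 * (shift g S.* h) n + (shift f S.* (g S.* h)) n)
      ≈⟨ solve 5 (λ f g h x y → (f :* g :+ con ℤ.0ℤ) :* h :+ (f :* x :+ y) := f :* (g :* h :+ x) :+ y)
           refl (f 0) (g 0) (h (suc n)) _ _ ⟩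
    (f S.* (g S.* h)) (suc n) ∎

  -- The definitional unfolding peels the constant term off the left factor. Peeling it off the
  -- right factor is what makes commutativity an induction.
  *-unfoldʳ : ∀ f g n → (f S.* g) (suc n) ≈ f (suc n) * g 0 + (f S.* shift g) n
  *-unfoldʳ f g zero    =
    solve 2 (λ x y → x :+ (y :+ con ℤ.0ℤ) := y :+ (x :+ con ℤ.0ℤ)) refl (f 0 * g 1) (f 1 * g 0)
  *-unfoldʳ f g (suc n) = begin
    f 0 * g (2 ℕ.+ n) + (shift f S.* g) (suc n)
      ≈⟨ +-congˡ (*-unfoldʳ (shift f) g n) ⟩
    f 0 * g (2 ℕ.+ n) + (f (2 ℕ.+ n) * g 0 + (shift f S.* shift g) n)
      ≈⟨ solve 3 (λ x y z → x :+ (y :+ z) := y :+ (x :+ z)) refl _ _ _ ⟩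
    f (2 ℕ.+ n) * g 0 + (f 0 * g (2 ℕ.+ n) + (shift f S.* shift g) n) ∎

  *-comm-series : ∀ f g → f S.* g S.≈ g S.* f
  *-comm-series f g zero    = +-congʳ (*-comm _ _)
  *-comm-series f g (suc n) = trans (*-unfoldʳ f g n)
    (+-cong (*-comm _ _) (*-comm-series f (shift g) n))

  zero*-series : ∀ g → S.0# S.* g S.≈ S.0#
  zero*-series g zero    = trans (+-identityʳ _) (zeroˡ _)
  zero*-series g (suc n) = trans (+-cong (zeroˡ _) (zero*-series g n)) (+-identityʳ _)

  constant-* : ∀ x g → constant x S.* g S.≈ scale x g
  constant-* x g zero    = +-identityʳ _
  constant-* x g (suc n) = trans (+-congˡ (zero*-series g n)) (+-identityʳ _)

  *-identityˡ-series : ∀ g → S.1# S.* g S.≈ g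
  *-identityˡ-series g n = trans (constant-* 1# g n) (*-identityˡ _)

  powerSeries-commutativeRing : CommutativeRing c e
  powerSeries-commutativeRing = record
    { Carrier = S.Carrier ; _≈_ = S._≈_ ; _+_ = S._+_ ; _*_ = S._*_
    ; -_ = S.-_ ; 0# = S.0# ; 1# = S.1#
    ; isCommutativeRing = record
      { isRing = record
        { +-isAbelianGroup = record
          { isGroup = record
            { isMonoid = record
              { isSemigroup = record
                { isMagma = record
                  { isEquivalence = record
                    { refl  = λ _ → refl
                    ; sym   = λ p n → sym (p n)
                    ; trans = λ p q n → trans (p n) (q n)
                    }
                  ; ∙-cong = λ p q n → +-cong (p n) (q n)
                  }
                ; assoc = λ f g h n → +-assoc (f n) (g n) (h n)
                }
              ; identity = (λ f n → +-identityˡ (f n)) , (λ f n → +-identityʳ (f n))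
              }
            ; inverse = (λ f n → -‿inverseˡ (f n)) , (λ f n → -‿inverseʳ (f n))
            ; ⁻¹-cong = λ p n → -‿cong (p n)
            }
          ; comm = λ f g n → +-comm (f n) (g n)
          }
        ; *-cong = *-cong-series
        ; *-assoc = *-assoc-series
        ; *-identity = *-identityˡ-series
                     , (λ f n → trans (*-comm-series f S.1# n) (*-identityˡ-series f n))
        ; distrib = (λ f g h n → trans (*-comm-series f (g S.+ h) n)
                      (trans (*-distribʳ-series f g h n)
                        (+-cong (*-comm-series g f n) (*-comm-series h f n))))
                  , *-distribʳ-series
        }
      ; *-comm = *-comm-series
      }
    }

-- Determinants

-- Once column `punchIn k s` is deleted, the old column `k` stands at position `pinch s k`.
punchIn-pinch : ∀ {n} (k : Fin (suc (suc n))) s → punchIn (punchIn k s) (pinch s k) ≡ k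
punchIn-pinch         Fin.zero    s           = ≡.refl
punchIn-pinch         (Fin.suc k) Fin.zero    = ≡.refl
punchIn-pinch {suc n} (Fin.suc k) (Fin.suc s) = ≡.cong Fin.suc (punchIn-pinch k s)

-- Both sides skip the columns `k` and `punchIn k s` and list the others in increasing order; only
-- the order of the two deletions differs.
punchIn-punchIn : ∀ {n} (k : Fin (suc (suc n))) s t →
  punchIn (punchIn k s) (punchIn (pinch s k) t) ≡ punchIn k (punchIn s t)
punchIn-punchIn Fin.zero    s           t           = ≡.refl
punchIn-punchIn (Fin.suc k) Fin.zero    t           = ≡.refl
punchIn-punchIn (Fin.suc k) (Fin.suc s) Fin.zero    = ≡.refl
punchIn-punchIn (Fin.suc k) (Fin.suc s) (Fin.suc t) = ≡.cong Fin.suc (punchIn-punchIn k s t)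

module DeterminantProperties {c e} (R : CommutativeRing c e) where

  open CommutativeRing R
  open import Algebra.Properties.Semiring.Sum semiring
  open import Algebra.Definitions.RawSemiring (Semiring.rawSemiring semiring) using (_^_)
  open import Relation.Binary.Reasoning.Setoid setoid
  open Determinant rawRing public
  open IntegerSolver R

  private variable n : ℕ

  sign : Fin n → Carrier
  sign j = (- 1#) ^ toℕ j

  minor : Matrix (suc n) → Fin (suc n) → Matrix n
  minor M j r s = M (Fin.suc r) (punchIn j s)

  det-cong : {M M′ : Matrix n} → (∀ i j → M i j ≈ M′ i j) → det M ≈ det M′
  det-cong {zero}  p = refl
  det-cong {suc n} p = sum-cong-≋ λ j → *-congˡ {x = sign j}
    (*-cong (p Fin.zero j) (det-cong λ r s → p (Fin.suc r) (punchIn j s)))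

  toFront : Fin (suc n) → Matrix (suc n) → Matrix (suc n)
  toFront k M i Fin.zero    = M i k
  toFront k M i (Fin.suc s) = M i (punchIn k s)

  sign² : (k : Fin n) → sign k * sign k ≈ 1#
  sign² Fin.zero    = *-identityˡ 1#
  sign² (Fin.suc k) = trans
    (solve 1 (λ x → con ℤ.-1ℤ :* x :* (con ℤ.-1ℤ :* x) := x :* x) refl (sign k)) (sign² k)

  -- The exponents have equal sums: (s + 1) + (k - 1) and k + s if s is below k, otherwise (s + 1) +
  -- k and k + (s + 1).
  sign-punchIn : (k : Fin (suc (suc n))) (s : Fin (suc n)) →
    sign (Fin.suc s) * sign (pinch s k) ≈ sign k * sign (punchIn k s)
  sign-punchIn Fin.zero s = *-comm _ _
  sign-punchIn (Fin.suc k) Fin.zero =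
    solve 1 (λ x → con ℤ.-1ℤ :* con ℤ.1ℤ :* x := con ℤ.-1ℤ :* x :* con ℤ.1ℤ) refl (sign k)
  sign-punchIn {suc n} (Fin.suc k) (Fin.suc s) = begin
    (- 1# * (- 1# * sign s)) * (- 1# * sign (pinch s k))
      ≈⟨ solve 2 (λ x y → con ℤ.-1ℤ :* (con ℤ.-1ℤ :* x) :* (con ℤ.-1ℤ :* y) := con ℤ.-1ℤ :* x :* y)
           refl (sign s) (sign (pinch s k)) ⟩
    (- 1# * sign s) * sign (pinch s k)
      ≈⟨ sign-punchIn k s ⟩
    sign k * sign (punchIn k s)
      ≈⟨ solve 2 (λ x y → x :* y := con ℤ.-1ℤ :* x :* (con ℤ.-1ℤ :* y)) refl _ _ ⟩
    (- 1# * sign k) * (- 1# * sign (punchIn k s)) ∎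

  -- Moving column `k` to the front is a cycle of `k` transpositions. In the expansion, deleting
  -- another column leaves column `k` at position `pinch s k` of the minor, from where the induction
  -- moves it to the front; `sign-punchIn` compares the signs.
  det-toFront : ∀ k (M : Matrix (suc n)) → det (toFront k M) ≈ sign k * det M
  det-toFront {n} k M = begin
    det (toFront k M)
      ≈⟨ +-cong head (sum-cong-≋ (tail n k M)) ⟩
    sign k * term k + sum (λ s → sign k * term (punchIn k s))
      ≈⟨ +-congˡ (*-distribˡ-sum (sign k) (λ s → term (punchIn k s))) ⟨
    sign k * term k + sign k * sum (λ s → term (punchIn k s))
      ≈⟨ distribˡ _ _ _ ⟨
    sign k * (term k + sum (λ s → term (punchIn k s)))
      ≈⟨ *-congˡ (sum-remove {i = k} term) ⟨
    sign k * det M ∎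
    where
    term : Fin (suc n) → Carrier
    term j = sign j * (M Fin.zero j * det (minor M j))

    head : 1# * (M Fin.zero k * det (minor M k)) ≈ sign k * term k
    head = begin
      1# * (M Fin.zero k * det (minor M k))                  ≈⟨ *-congʳ (sign² k) ⟨
      sign k * sign k * (M Fin.zero k * det (minor M k))     ≈⟨ *-assoc _ _ _ ⟩
      sign k * term k ∎

    tail : ∀ n k (M : Matrix (suc n)) (s : Fin n) →
      sign (Fin.suc s) * (M Fin.zero (punchIn k s) * det (minor (toFront k M) (Fin.suc s)))
      ≈ sign k * (sign (punchIn k s) * (M Fin.zero (punchIn k s) * det (minor M (punchIn k s))))
    tail (suc n) k M s = begin
      sign (Fin.suc s) * (x * det (minor (toFront k M) (Fin.suc s)))
        ≈⟨ *-congˡ (*-congˡ (det-cong commute)) ⟩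
      sign (Fin.suc s) * (x * det (toFront (pinch s k) (minor M (punchIn k s))))
        ≈⟨ *-congˡ (*-congˡ (det-toFront (pinch s k) (minor M (punchIn k s)))) ⟩
      sign (Fin.suc s) * (x * (sign (pinch s k) * y))
        ≈⟨ solve 4 (λ a b c d → a :* (b :* (c :* d)) := a :* c :* (b :* d)) refl _ _ _ _ ⟩
      sign (Fin.suc s) * sign (pinch s k) * (x * y)
        ≈⟨ *-congʳ (sign-punchIn k s) ⟩
      sign k * sign (punchIn k s) * (x * y)
        ≈⟨ *-assoc _ _ _ ⟩
      sign k * (sign (punchIn k s) * (x * y)) ∎
      where
      x y : Carrier
      x = M Fin.zero (punchIn k s)
      y = det (minor M (punchIn k s))
      commute : ∀ r t → minor (toFront k M) (Fin.suc s) r t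
                      ≈ toFront (pinch s k) (minor M (punchIn k s)) r t
      commute r Fin.zero    = reflexive (≡.cong (M (Fin.suc r)) (≡.sym (punchIn-pinch k s)))
      commute r (Fin.suc t) = reflexive (≡.cong (M (Fin.suc r)) (≡.sym (punchIn-punchIn k s t)))

  -- The minor that omits column `suc j` is, by the equality of the two columns, the minor that
  -- omits column 0 with its column `j` moved to the front. The resulting sign makes these two terms
  -- cancel, and every other minor still contains both equal columns.
  det-repeated : (M : Matrix (suc n)) (j : Fin n) →
    (∀ i → M i Fin.zero ≈ M i (Fin.suc j)) → det M ≈ 0#
  det-repeated {suc n} M j eq = begin
    det M
      ≈⟨ +-congˡ (sum-remove {i = j} (λ s → term (Fin.suc s))) ⟩
    term Fin.zero + (term (Fin.suc j) + sum (λ t → term (Fin.suc (punchIn j t))))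
      ≈⟨ +-congˡ (+-cong atJ (trans (sum-cong-≋ (others n M j eq)) (sum-replicate-zero n))) ⟩
    1# * (x * y) + (- 1# * sign j * (x * (sign j * y)) + 0#)
      ≈⟨ solve 3 (λ x y z → con ℤ.1ℤ :* (x :* y) :+ (con ℤ.-1ℤ :* z :* (x :* (z :* y)) :+ con ℤ.0ℤ)
                          := (con ℤ.1ℤ :- z :* z) :* (x :* y)) refl x y (sign j) ⟩
    (1# - sign j * sign j) * (x * y)
      ≈⟨ *-congʳ (trans (+-congˡ (-‿cong (sign² j))) (-‿inverseʳ 1#)) ⟩
    0# * (x * y) ≈⟨ zeroˡ _ ⟩
    0# ∎
    where
    x y : Carrier
    x = M Fin.zero Fin.zero
    y = det (minor M Fin.zero)
    term : Fin (suc (suc n)) → Carrier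
    term j = sign j * (M Fin.zero j * det (minor M j))

    front : ∀ r t → minor M (Fin.suc j) r t ≈ toFront j (minor M Fin.zero) r t
    front r Fin.zero    = eq (Fin.suc r)
    front r (Fin.suc t) = refl

    atJ : term (Fin.suc j) ≈ - 1# * sign j * (x * (sign j * y))
    atJ = *-congˡ (*-cong (sym (eq Fin.zero))
      (trans (det-cong front) (det-toFront j (minor M Fin.zero))))

    others : ∀ n (M : Matrix (suc (suc n))) (j : Fin (suc n)) →
      (∀ i → M i Fin.zero ≈ M i (Fin.suc j)) → (t : Fin n) →
      sign (Fin.suc (punchIn j t)) *
        (M Fin.zero (Fin.suc (punchIn j t)) * det (minor M (Fin.suc (punchIn j t)))) ≈ 0#
    others (suc n) M j eq t = trans
      (*-congˡ {x = sign (Fin.suc (punchIn j t))} (trans (*-congˡ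
        (det-repeated (minor M (Fin.suc (punchIn j t))) (pinch t j) λ r →
          trans (eq (Fin.suc r))
            (reflexive (≡.cong (λ k → M (Fin.suc r) (Fin.suc k)) (≡.sym (punchIn-pinch j t))))))
        (zeroʳ _)))
      (zeroʳ _)

  infix 5 [_∣_]
  -- Separating the first column makes the determinant a function of that column, so that linearity
  -- in it can be expressed.
  [_∣_] : (Fin (suc n) → Carrier) → (Fin (suc n) → Fin n → Carrier) → Matrix (suc n)
  [ v ∣ A ] i Fin.zero    = v i
  [ v ∣ A ] i (Fin.suc j) = A i j

  dropFirst : (Fin (suc n) → Fin n → Carrier) → Matrix n
  dropFirst A r s = A (Fin.suc r) s

  private
    remove : (Fin (suc (suc n)) → Fin (suc n) → Carrier) → Fin (suc n) →
             Fin (suc n) → Fin n → Carrier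
    remove A s r t = A (Fin.suc r) (punchIn s t)

    minor-cons : ∀ (v : Fin (suc (suc n)) → Carrier) A s r t →
      minor [ v ∣ A ] (Fin.suc s) r t ≈ [ v ∘ Fin.suc ∣ remove A s ] r t
    minor-cons v A s r Fin.zero    = refl
    minor-cons v A s r (Fin.suc t) = refl

  det-cong-column : ∀ {v w : Fin (suc n) → Carrier} A → (∀ i → v i ≈ w i) →
                    det [ v ∣ A ] ≈ det [ w ∣ A ]
  det-cong-column {v = v} {w} A eq = det-cong {M = [ v ∣ A ]} {[ w ∣ A ]} λ { i Fin.zero → eq i ; i (Fin.suc j) → refl }

  det-linear : ∀ x (v w : Fin (suc n) → Carrier) A →
    det [ (λ i → x * v i + w i) ∣ A ] ≈ x * det [ v ∣ A ] + det [ w ∣ A ]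
  det-linear {n} x v w A = begin
    1# * ((x * v Fin.zero + w Fin.zero) * D) + sum (term (λ i → x * v i + w i))
      ≈⟨ +-congˡ (sum-cong-≋ (linear-term n v w A)) ⟩
    1# * ((x * v Fin.zero + w Fin.zero) * D) + sum (λ s → x * term v s + term w s)
      ≈⟨ +-congˡ (trans (∑-distrib-+ (λ s → x * term v s) (term w))
                   (+-congʳ (sym (*-distribˡ-sum x (term v))))) ⟩
    1# * ((x * v Fin.zero + w Fin.zero) * D) + (x * sum (term v) + sum (term w))
      ≈⟨ solve 6 (λ x v w D s t → con ℤ.1ℤ :* ((x :* v :+ w) :* D) :+ (x :* s :+ t)
             := x :* (con ℤ.1ℤ :* (v :* D) :+ s) :+ (con ℤ.1ℤ :* (w :* D) :+ t))
           refl x (v Fin.zero) (w Fin.zero) D (sum (term v)) (sum (term w)) ⟩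
    x * det [ v ∣ A ] + det [ w ∣ A ] ∎
    where
    D : Carrier
    D = det (dropFirst A)
    term : (Fin (suc n) → Carrier) → Fin n → Carrier
    term v s = sign (Fin.suc s) * (A Fin.zero s * det (minor [ v ∣ A ] (Fin.suc s)))
    linear-term : ∀ n (v w : Fin (suc n) → Carrier) (A : Fin (suc n) → Fin n → Carrier) (s : Fin n) →
      sign (Fin.suc s) * (A Fin.zero s * det (minor [ (λ i → x * v i + w i) ∣ A ] (Fin.suc s)))
      ≈ x * (sign (Fin.suc s) * (A Fin.zero s * det (minor [ v ∣ A ] (Fin.suc s))))
        + sign (Fin.suc s) * (A Fin.zero s * det (minor [ w ∣ A ] (Fin.suc s)))
    linear-term (suc n) v w A s = begin
      a * (b * det (minor [ (λ i → x * v i + w i) ∣ A ] (Fin.suc s)))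
        ≈⟨ *-congˡ (*-congˡ (trans (det-cong (minor-cons _ A s))
             (trans (det-linear x (v ∘ Fin.suc) (w ∘ Fin.suc) (remove A s))
               (sym (+-cong (*-congˡ (det-cong (minor-cons v A s)))
                            (det-cong (minor-cons w A s))))))) ⟩
      a * (b * (x * det (minor [ v ∣ A ] (Fin.suc s)) + det (minor [ w ∣ A ] (Fin.suc s))))
        ≈⟨ solve 5 (λ a b x y z → a :* (b :* (x :* y :+ z)) := x :* (a :* (b :* y)) :+ a :* (b :* z))
             refl a b x _ _ ⟩
      x * (a * (b * det (minor [ v ∣ A ] (Fin.suc s)))) + a * (b * det (minor [ w ∣ A ] (Fin.suc s))) ∎
      where
      a b : Carrier
      a = sign (Fin.suc s)
      b = A Fin.zero s

  -- Linearity with scalar -1, applied to 0 = -1 · 0 + 0, gives D = -D + D.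
  det-zero-column : (A : Fin (suc n) → Fin n → Carrier) → det [ (λ _ → 0#) ∣ A ] ≈ 0#
  det-zero-column A = begin
    det [ (λ _ → 0#) ∣ A ]
      ≈⟨ det-cong-column A (λ _ → solve 0 (con ℤ.0ℤ := con ℤ.-1ℤ :* con ℤ.0ℤ :+ con ℤ.0ℤ) refl) ⟩
    det [ (λ _ → - 1# * 0# + 0#) ∣ A ]
      ≈⟨ det-linear (- 1#) (λ _ → 0#) (λ _ → 0#) A ⟩
    - 1# * det [ (λ _ → 0#) ∣ A ] + det [ (λ _ → 0#) ∣ A ]
      ≈⟨ solve 1 (λ x → con ℤ.-1ℤ :* x :+ x := con ℤ.0ℤ) refl _ ⟩
    0# ∎

  -- The map `g` decouples the number of summands from the size of the matrix, so induction can peel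
  -- off one summand at a time with `A` fixed; each summand repeats a column.
  det-dependent-column : ∀ {k} (x : Fin k → Carrier) (g : Fin k → Fin n) A →
    det [ (λ i → sum λ j → x j * A i (g j)) ∣ A ] ≈ 0#
  det-dependent-column {k = zero}  x g A = det-zero-column A
  det-dependent-column {k = suc k} x g A = begin
    det [ (λ i → x Fin.zero * A i (g Fin.zero) + sum λ j → x (Fin.suc j) * A i (g (Fin.suc j))) ∣ A ]
      ≈⟨ det-linear _ (λ i → A i (g Fin.zero)) _ A ⟩
    x Fin.zero * det [ (λ i → A i (g Fin.zero)) ∣ A ]
      + det [ (λ i → sum λ j → x (Fin.suc j) * A i (g (Fin.suc j))) ∣ A ]
      ≈⟨ +-cong (*-congˡ (det-repeated [ (λ i → A i (g Fin.zero)) ∣ A ] (g Fin.zero) λ _ → refl))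
                (det-dependent-column (x ∘ Fin.suc) (g ∘ Fin.suc) A) ⟩
    x Fin.zero * 0# + 0# ≈⟨ trans (+-identityʳ _) (zeroʳ _) ⟩
    0# ∎

  -- The expansion runs along the first row while the zeros are in the first column: every minor
  -- other than the first inherits a zero column.
  det-first-entry : ∀ (v : Fin (suc n) → Carrier) A → (∀ i → v (Fin.suc i) ≈ 0#) →
    det [ v ∣ A ] ≈ v Fin.zero * det (dropFirst A)
  det-first-entry {n} v A v≈0 = trans
    (+-cong (*-identityˡ _) (trans (sum-cong-≋ (vanish n v A v≈0)) (sum-replicate-zero n)))
    (+-identityʳ _)
    where
    vanish : ∀ n (v : Fin (suc n) → Carrier) (A : Fin (suc n) → Fin n → Carrier) →
      (∀ i → v (Fin.suc i) ≈ 0#) → (s : Fin n) →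
      sign (Fin.suc s) * (A Fin.zero s * det (minor [ v ∣ A ] (Fin.suc s))) ≈ 0#
    vanish (suc n) v A v≈0 s = trans (*-congˡ {x = sign (Fin.suc s)} (trans (*-congˡ (begin
      det (minor [ v ∣ A ] (Fin.suc s))      ≈⟨ det-cong (minor-cons v A s) ⟩
      det [ v ∘ Fin.suc ∣ remove A s ]       ≈⟨ det-cong-column (remove A s) v≈0 ⟩
      det [ (λ _ → 0#) ∣ remove A s ]        ≈⟨ det-zero-column (remove A s) ⟩
      0#                                     ∎)) (zeroʳ _))) (zeroʳ _)

  -- Cramer elimination without division: scaling the first column by `x₀` multiplies the
  -- determinant by `x₀`, adding multiples of the other columns does not change it, and the
  -- hypothesis says that the new column vanishes below the corner.
  det-eliminate : ∀ (M : Matrix (suc n)) x₀ (x : Fin n → Carrier) →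
    (∀ i → x₀ * M (Fin.suc i) Fin.zero + sum (λ j → x j * M (Fin.suc i) (Fin.suc j)) ≈ 0#) →
    x₀ * det M ≈ (x₀ * M Fin.zero Fin.zero + sum (λ j → x j * M Fin.zero (Fin.suc j)))
                 * det (minor M Fin.zero)
  det-eliminate M x₀ x rest≈0 = begin
    x₀ * det M
      ≈⟨ *-congˡ (det-cong {M = M} {[ v ∣ A ]} λ { i Fin.zero → refl ; i (Fin.suc j) → refl }) ⟩
    x₀ * det [ v ∣ A ]
      ≈⟨ +-identityʳ _ ⟨
    x₀ * det [ v ∣ A ] + 0#
      ≈⟨ +-congˡ (det-dependent-column x (λ j → j) A) ⟨
    x₀ * det [ v ∣ A ] + det [ (λ i → sum λ j → x j * A i j) ∣ A ]
      ≈⟨ det-linear x₀ v _ A ⟨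
    det [ (λ i → x₀ * v i + sum λ j → x j * A i j) ∣ A ]
      ≈⟨ det-first-entry _ A rest≈0 ⟩
    (x₀ * v Fin.zero + sum (λ j → x j * A Fin.zero j)) * det (minor M Fin.zero) ∎
    where
    v = λ i → M i Fin.zero
    A = λ i j → M i (Fin.suc j)

-- Determinants of Laplacians of complete graphs

module CompleteGraphDeterminant {o e} (R : CommutativeRing o e) where

  open CommutativeRing R
  open import Algebra.Properties.Ring ring
  open import Algebra.Properties.Semiring.Sum semiring
  open import Algebra.Properties.Monoid.Mult +-monoid using (×-homo-+)
  open import Algebra.Definitions.RawSemiring (Semiring.rawSemiring semiring)
    using (_^_) renaming (_×_ to _·_)
  open import Relation.Binary.Reasoning.Setoid setoid
  open DeterminantProperties R
  open IntegerSolver R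

  private variable n : ℕ

  fromℕ : ℕ → Carrier
  fromℕ n = n · 1#

  IsTorsionFree : Set _
  IsTorsionFree = ∀ n {x y} → fromℕ (suc n) * x ≈ fromℕ (suc n) * y → x ≈ y

  -- The matrix (d + 1) I - J. Its size is independent of `d` because passing to a principal minor
  -- shrinks the matrix and keeps the diagonal.
  record IsCompleteLaplacian (d : Carrier) (M : Matrix n) : Set e where
    field
      diagonal    : ∀ i → M i i ≈ d
      offDiagonal : ∀ i j → i ≢ j → M i j ≈ - 1#
  open IsCompleteLaplacian

  minor-isCompleteLaplacian : ∀ {d} {M : Matrix (suc n)} → IsCompleteLaplacian d M →
                              IsCompleteLaplacian d (minor M Fin.zero)
  minor-isCompleteLaplacian L = record
    { diagonal    = λ i → diagonal L (Fin.suc i)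
    ; offDiagonal = λ i j i≢j → offDiagonal L (Fin.suc i) (Fin.suc j) (i≢j ∘ Fin.suc-injective)
    }

  sum-neg : (f : Fin n → Carrier) → sum (λ j → - f j) ≈ - sum f
  sum-neg f = begin
    sum (λ j → - f j)       ≈⟨ sum-cong-≋ (λ j → sym (-1*x≈-x (f j))) ⟩
    sum (λ j → - 1# * f j)  ≈⟨ *-distribˡ-sum (- 1#) f ⟨
    - 1# * sum f            ≈⟨ -1*x≈-x _ ⟩
    - sum f                 ∎

  sum-const : ∀ n x → sum {n} (λ _ → x) ≈ fromℕ n * x
  sum-const zero    x = sym (zeroˡ x)
  sum-const (suc n) x = begin
    x + sum {n} (λ _ → x)  ≈⟨ +-congˡ (sum-const n x) ⟩
    x + fromℕ n * x        ≈⟨ solve 2 (λ x y → x :+ y :* x := (con ℤ.1ℤ :+ y) :* x) refl x (fromℕ n) ⟩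
    (1# + fromℕ n) * x     ∎

  laplacian-apply : ∀ {d} {M : Matrix n} → IsCompleteLaplacian d M → ∀ x i →
    sum (λ j → x j * M i j) ≈ (1# + d) * x i - sum x
  laplacian-apply {suc n} {d} {M} L x i = begin
    sum (λ j → x j * M i j)
      ≈⟨ sum-remove {i = i} (λ j → x j * M i j) ⟩
    x i * M i i + sum (λ t → x (punchIn i t) * M i (punchIn i t))
      ≈⟨ +-cong (*-congˡ (diagonal L i)) (sum-cong-≋ λ t →
           trans (*-congˡ (offDiagonal L i (punchIn i t) (Fin.punchInᵢ≢i i t ∘ ≡.sym)))
                 (trans (*-comm _ _) (-1*x≈-x _))) ⟩
    x i * d + sum (λ t → - x (punchIn i t))
      ≈⟨ +-congˡ (sum-neg (x ∘ punchIn i)) ⟩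
    x i * d - sum (x ∘ punchIn i)
      ≈⟨ solve 3 (λ x d s → x :* d :- s := (con ℤ.1ℤ :+ d) :* x :- (x :+ s)) refl (x i) d _ ⟩
    (1# + d) * x i - (x i + sum (x ∘ punchIn i))
      ≈⟨ +-congˡ (-‿cong (sum-remove {i = i} x)) ⟨
    (1# + d) * x i - sum x ∎

  module _ (torsionFree : IsTorsionFree) where

    -- With u = N + 1, the matrix u I - J of size n has eigenvalue u with multiplicity n - 1 and
    -- eigenvalue u - n = j, so its determinant is u^(n-1) j; the extra factor u avoids the exponent
    -- n - 1. In the induction, weight j + 1 on the first column and 1 on the others annihilates all
    -- lower rows, and j + 1 is cancelled at the end.
    det-completeLaplacian : ∀ N n j → suc N ≡ n ℕ.+ j → (M : Matrix n) →
      IsCompleteLaplacian (fromℕ N) M →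
      fromℕ (suc N) * det M ≈ fromℕ (suc N) ^ n * fromℕ j
    det-completeLaplacian N zero    j eq M L =
      trans (*-comm _ _) (*-congˡ (reflexive (≡.cong fromℕ eq)))
    det-completeLaplacian N (suc n) j eq M L = torsionFree j (begin
      fromℕ (suc j) * (u * det M)
        ≈⟨ solve 3 (λ x y z → x :* (y :* z) := y :* (x :* z)) refl (fromℕ (suc j)) u (det M) ⟩
      u * (fromℕ (suc j) * det M)
        ≈⟨ *-congˡ (det-eliminate M (fromℕ (suc j)) (λ _ → 1#) rest≈0) ⟩
      u * ((fromℕ (suc j) * M Fin.zero Fin.zero + sum (λ s → 1# * M Fin.zero (Fin.suc s))) * D)
        ≈⟨ *-congˡ (*-congʳ (+-cong (*-congˡ (diagonal L Fin.zero)) (sum-cong-≋ {n = n} λ s →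
             trans (*-identityˡ _) (offDiagonal L Fin.zero (Fin.suc s) λ ())))) ⟩
      u * ((fromℕ (suc j) * d + sum {n} (λ s → - 1#)) * D)
        ≈⟨ *-congˡ (*-congʳ (+-congˡ (sum-const n (- 1#)))) ⟩
      u * ((fromℕ (suc j) * d + fromℕ n * - 1#) * D)
        ≈⟨ *-congˡ (*-congʳ (+-congˡ (*-congʳ n≈))) ⟩
      u * ((fromℕ (suc j) * d + (d - fromℕ j) * - 1#) * D)
        ≈⟨ solve 3 (λ d j D → (con ℤ.1ℤ :+ d) :* (((con ℤ.1ℤ :+ j) :* d :+ (d :- j) :* con ℤ.-1ℤ) :* D)
             := (con ℤ.1ℤ :+ d) :* j :* ((con ℤ.1ℤ :+ d) :* D)) refl d (fromℕ j) D ⟩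
      u * fromℕ j * (u * D)
        ≈⟨ *-congˡ (det-completeLaplacian N n (suc j) eq′ (minor M Fin.zero) (minor-isCompleteLaplacian L)) ⟩
      u * fromℕ j * (u ^ n * fromℕ (suc j))
        ≈⟨ solve 4 (λ u j p k → u :* j :* (p :* k) := k :* (u :* p :* j)) refl u (fromℕ j) (u ^ n) (fromℕ (suc j)) ⟩
      fromℕ (suc j) * (u ^ suc n * fromℕ j) ∎)
      where
      d u D : Carrier
      d = fromℕ N
      u = fromℕ (suc N)
      D = det (minor M Fin.zero)
      eq′ : suc N ≡ n ℕ.+ suc j
      eq′ = ≡.trans eq (≡.sym (ℕ.+-suc n j))
      n≈ : fromℕ n ≈ d - fromℕ j
      n≈ = begin
        fromℕ n                        ≈⟨ solve 2 (λ n j → n := n :+ j :- j) refl (fromℕ n) (fromℕ j) ⟩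
        fromℕ n + fromℕ j - fromℕ j    ≈⟨ +-congʳ (×-homo-+ 1# n j) ⟨
        fromℕ (n ℕ.+ j) - fromℕ j      ≡⟨ ≡.cong (λ k → fromℕ k - fromℕ j) (ℕ.suc-injective eq) ⟨
        d - fromℕ j                    ∎
      rest≈0 : ∀ i → fromℕ (suc j) * M (Fin.suc i) Fin.zero + sum (λ s → 1# * M (Fin.suc i) (Fin.suc s)) ≈ 0#
      rest≈0 i = begin
        fromℕ (suc j) * M (Fin.suc i) Fin.zero + sum (λ s → 1# * M (Fin.suc i) (Fin.suc s))
          ≈⟨ +-cong (*-congˡ (offDiagonal L (Fin.suc i) Fin.zero λ ()))
                    (laplacian-apply (minor-isCompleteLaplacian L) (λ _ → 1#) i) ⟩
        fromℕ (suc j) * - 1# + (u * 1# - sum {n} (λ _ → 1#))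
          ≈⟨ +-congˡ (+-congˡ (-‿cong (trans (sum-const n 1#) (*-congʳ n≈)))) ⟩
        fromℕ (suc j) * - 1# + (u * 1# - (d - fromℕ j) * 1#)
          ≈⟨ solve 2 (λ d j → (con ℤ.1ℤ :+ j) :* con ℤ.-1ℤ :+ ((con ℤ.1ℤ :+ d) :* con ℤ.1ℤ :- (d :- j) :* con ℤ.1ℤ)
               := con ℤ.0ℤ) refl d (fromℕ j) ⟩
        0# ∎

    -- M is the Laplacian of K_{n+1} with voltages only on the edges at the first vertex.
    det-bordered : ∀ n (M : Matrix (suc n)) → M Fin.zero Fin.zero ≈ fromℕ n →
      IsCompleteLaplacian (fromℕ n) (minor M Fin.zero) →
      let r = λ j → M Fin.zero (Fin.suc j) ; c = λ j → M (Fin.suc j) Fin.zero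
          u = fromℕ (suc n) in
      u * u * det M ≈ u ^ n * (u * fromℕ n - sum (λ j → c j * r j) - sum c * sum r)
    det-bordered n M corner L = begin
      u * u * det M
        ≈⟨ *-assoc _ _ _ ⟩
      u * (u * det M)
        ≈⟨ *-congˡ (det-eliminate M u x rest≈0) ⟩
      u * ((u * M Fin.zero Fin.zero + sum (λ j → x j * r j)) * D)
        ≈⟨ *-congˡ (*-congʳ (+-cong (*-congˡ corner) xr)) ⟩
      u * ((u * fromℕ n + - (sum (λ j → c j * r j) + sum c * sum r)) * D)
        ≈⟨ solve 5 (λ u n a b D → u :* ((u :* n :+ :- (a :+ b)) :* D) := (u :* D) :* (u :* n :- a :- b))
             refl u (fromℕ n) (sum (λ j → c j * r j)) (sum c * sum r) D ⟩
      (u * D) * δ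
        -- The minor has size n = u - 1, so its small eigenvalue is 1.
        ≈⟨ *-congʳ (det-completeLaplacian n n 1 (ℕ.+-comm 1 n) (minor M Fin.zero) L) ⟩
      u ^ n * fromℕ 1 * δ
        ≈⟨ solve 2 (λ p δ → p :* (con ℤ.1ℤ :+ con ℤ.0ℤ) :* δ := p :* δ) refl (u ^ n) δ ⟩
      u ^ n * δ ∎
      where
      r c x : Fin n → Carrier
      r j = M Fin.zero (Fin.suc j)
      c j = M (Fin.suc j) Fin.zero
      -- In size n = u - 1 one has (u I - J)(I + J) = u I. Hence x = -(I + J) c cancels u c in every
      -- lower row.
      x j = - (c j + sum c)
      u D δ : Carrier
      u = fromℕ (suc n)
      D = det (minor M Fin.zero)
      δ = u * fromℕ n - sum (λ j → c j * r j) - sum c * sum r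
      sum-x : sum x ≈ - (u * sum c)
      sum-x = begin
        sum x                                  ≈⟨ sum-neg (λ j → c j + sum c) ⟩
        - sum (λ j → c j + sum c)              ≈⟨ -‿cong (∑-distrib-+ c (λ _ → sum c)) ⟩
        - (sum c + sum {n} (λ _ → sum c))      ≈⟨ -‿cong (+-congˡ (sum-const n (sum c))) ⟩
        - (sum c + fromℕ n * sum c)
          ≈⟨ solve 2 (λ s n → :- (s :+ n :* s) := :- ((con ℤ.1ℤ :+ n) :* s)) refl (sum c) (fromℕ n) ⟩
        - (u * sum c)                          ∎
      rest≈0 : ∀ i → u * c i + sum (λ j → x j * M (Fin.suc i) (Fin.suc j)) ≈ 0#
      rest≈0 i = begin
        u * c i + sum (λ j → x j * M (Fin.suc i) (Fin.suc j))
          ≈⟨ +-congˡ (laplacian-apply L x i) ⟩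
        u * c i + (u * x i - sum x)
          ≈⟨ +-congˡ (+-congˡ (-‿cong sum-x)) ⟩
        u * c i + (u * x i - - (u * sum c))
          ≈⟨ solve 3 (λ u c s → u :* c :+ (u :* (:- (c :+ s)) :- :- (u :* s)) := con ℤ.0ℤ)
               refl u (c i) (sum c) ⟩
        0# ∎
      xr : sum (λ j → x j * r j) ≈ - (sum (λ j → c j * r j) + sum c * sum r)
      xr = begin
        sum (λ j → x j * r j)
          ≈⟨ sum-cong-≋ (λ j → solve 3 (λ c s r → (:- (c :+ s)) :* r := :- (c :* r :+ s :* r))
                                 refl (c j) (sum c) (r j)) ⟩
        sum (λ j → - (c j * r j + sum c * r j))
          ≈⟨ sum-neg (λ j → c j * r j + sum c * r j) ⟩
        - sum (λ j → c j * r j + sum c * r j)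
          ≈⟨ -‿cong (∑-distrib-+ (λ j → c j * r j) (λ j → sum c * r j)) ⟩
        - (sum (λ j → c j * r j) + sum (λ j → sum c * r j))
          ≈⟨ -‿cong (+-congˡ (*-distribˡ-sum (sum c) r)) ⟨
        - (sum (λ j → c j * r j) + sum c * sum r) ∎

    sum-two-values : ∀ {x y} (t : Fin (suc n)) (f : Fin (suc n) → Carrier) →
      f t ≈ x → (∀ j → f (punchIn t j) ≈ y) → sum f ≈ x + fromℕ n * y
    sum-two-values {n} {y = y} t f fₜ f′ = trans (sum-remove {i = t} f)
      (+-cong fₜ (trans (sum-cong-≋ f′) (sum-const n y)))

    -- One edge at the first vertex carries p and the k = m + 1 others carry q. The bracket of
    -- `det-bordered` collapses because (1 + k)² - 1 - k² = 2 k, which leaves k (2 - s); the two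
    -- factors u on the left are then cancelled.
    det-twisted : ∀ m (M : Matrix (3 ℕ.+ m)) (t : Fin (2 ℕ.+ m)) {p p⁻¹ q q⁻¹} →
      p * p⁻¹ ≈ 1# → q * q⁻¹ ≈ 1# →
      M Fin.zero Fin.zero ≈ fromℕ (2 ℕ.+ m) →
      M Fin.zero (Fin.suc t) ≈ - p → M (Fin.suc t) Fin.zero ≈ - p⁻¹ →
      (∀ j → M Fin.zero (Fin.suc (punchIn t j)) ≈ - q) →
      (∀ j → M (Fin.suc (punchIn t j)) Fin.zero ≈ - q⁻¹) →
      IsCompleteLaplacian (fromℕ (2 ℕ.+ m)) (minor M Fin.zero) →
      det M ≈ fromℕ (3 ℕ.+ m) ^ m * fromℕ (suc m) * (1# + 1# - (p⁻¹ * q + p * q⁻¹))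
    det-twisted m M t {p} {p⁻¹} {q} {q⁻¹} pp⁻¹ qq⁻¹ corner Mₜ Mₜ′ Mⱼ Mⱼ′ L =
      torsionFree (2 ℕ.+ m) (torsionFree (2 ℕ.+ m) (begin
        u * (u * det M)
          ≈⟨ *-assoc _ _ _ ⟨
        u * u * det M
          ≈⟨ det-bordered (2 ℕ.+ m) M corner L ⟩
        u ^ (2 ℕ.+ m) * (u * fromℕ (2 ℕ.+ m) - sum (λ j → c j * r j) - sum c * sum r)
          ≈⟨ *-congˡ (+-cong (+-congˡ (-‿cong sum-cr)) (-‿cong (*-cong
               (sum-two-values t c Mₜ′ Mⱼ′) (sum-two-values t r Mₜ Mⱼ)))) ⟩
        u ^ (2 ℕ.+ m) * (u * fromℕ (2 ℕ.+ m) - (1# + k * 1#) - (- p⁻¹ + k * - q⁻¹) * (- p + k * - q))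
          ≈⟨ *-congˡ (solve 5 (λ k p p⁻¹ q q⁻¹ →
               (con ℤ.1ℤ :+ (con ℤ.1ℤ :+ k)) :* (con ℤ.1ℤ :+ k) :- (con ℤ.1ℤ :+ k :* con ℤ.1ℤ)
                 :- (:- p⁻¹ :+ k :* (:- q⁻¹)) :* (:- p :+ k :* (:- q))
               := (con ℤ.1ℤ :+ k) :* (con ℤ.1ℤ :+ k) :- p :* p⁻¹ :- k :* k :* (q :* q⁻¹)
                 :- k :* (p⁻¹ :* q :+ p :* q⁻¹)) refl k p p⁻¹ q q⁻¹) ⟩
        u ^ (2 ℕ.+ m) * ((1# + k) * (1# + k) - p * p⁻¹ - k * k * (q * q⁻¹) - k * s)
          ≈⟨ *-congˡ (+-congʳ (+-cong (+-congˡ (-‿cong pp⁻¹)) (-‿cong (*-congˡ qq⁻¹)))) ⟩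
        u ^ (2 ℕ.+ m) * ((1# + k) * (1# + k) - 1# - k * k * 1# - k * s)
          ≈⟨ solve 4 (λ u v k s → u :* (u :* v) :* ((con ℤ.1ℤ :+ k) :* (con ℤ.1ℤ :+ k) :- con ℤ.1ℤ :- k :* k :* con ℤ.1ℤ :- k :* s)
               := u :* (u :* (v :* k :* (con ℤ.1ℤ :+ con ℤ.1ℤ :- s)))) refl u (u ^ m) k s ⟩
        u * (u * (u ^ m * k * (1# + 1# - s))) ∎))
      where
      r c : Fin (2 ℕ.+ m) → Carrier
      r j = M Fin.zero (Fin.suc j)
      c j = M (Fin.suc j) Fin.zero
      u k s : Carrier
      u = fromℕ (3 ℕ.+ m)
      k = fromℕ (suc m)
      s = p⁻¹ * q + p * q⁻¹
      cancel-neg : ∀ {x y} a b → x ≈ - b → y ≈ - a → a * b ≈ 1# → x * y ≈ 1#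
      cancel-neg a b x≈ y≈ ab = trans (*-cong x≈ y≈)
        (trans (solve 2 (λ a b → (:- b) :* (:- a) := a :* b) refl a b) ab)
      sum-cr : sum (λ j → c j * r j) ≈ 1# + k * 1#
      sum-cr = sum-two-values t (λ j → c j * r j) (cancel-neg p p⁻¹ Mₜ′ Mₜ pp⁻¹)
        (λ j → cancel-neg q q⁻¹ (Mⱼ′ j) (Mⱼ j) qq⁻¹)

-- Units and binomial series

module PowerSeriesProperties {c e} (R : CommutativeRing c e) where

  open CommutativeRing R hiding (zero)
  open import Relation.Binary.Reasoning.Setoid setoid
  open PowerSeriesRing R
  open CompleteGraphDeterminant R using (fromℕ; IsTorsionFree)
  open IntegerSolver R
  private
    module S = CommutativeRing powerSeries-commutativeRing
    module SN = CompleteGraphDeterminant powerSeries-commutativeRing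

  *-cong-below : ∀ f {g h : Series} n → (∀ i → i ℕ.≤ n → g i ≈ h i) → (f S.* g) n ≈ (f S.* h) n
  *-cong-below f zero    eq = +-congʳ (*-congˡ (eq 0 z≤n))
  *-cong-below f (suc n) eq = +-cong (*-congˡ (eq (suc n) ℕ.≤-refl))
    (*-cong-below (shift f) n λ i i≤n → eq i (ℕ.m≤n⇒m≤1+n i≤n))

  module Inverse (f : Series) {y} (f₀y≈1 : f 0 * y ≈ 1#) where

    -- A coefficient of the inverse depends on all earlier ones. The first argument is fuel that
    -- makes this recursion structural: `approximation (suc k)` is correct up to coefficient `k`.
    approximation : ℕ → Series
    approximation zero    n       = 0#
    approximation (suc k) zero    = y
    approximation (suc k) (suc n) = - (y * (shift f S.* approximation k) n)

    approximation-stable : ∀ j k i → i ℕ.≤ j → i ℕ.≤ k →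
      approximation (suc j) i ≈ approximation (suc k) i
    approximation-stable j       k       zero    _         _         = refl
    approximation-stable (suc j) (suc k) (suc i) (s≤s i≤j) (s≤s i≤k) =
      -‿cong (*-congˡ (*-cong-below (shift f) i λ i′ i′≤i →
        approximation-stable j k i′ (ℕ.≤-trans i′≤i i≤j) (ℕ.≤-trans i′≤i i≤k)))

    inverse : Series
    inverse n = approximation (suc n) n

    *-inverseʳ : f S.* inverse S.≈ S.1#
    *-inverseʳ zero    = trans (+-identityʳ _) f₀y≈1
    *-inverseʳ (suc n) = begin
      f 0 * - (y * x) + (shift f S.* inverse) n
        ≈⟨ +-congˡ (*-cong-below (shift f) n λ i i≤n →
             approximation-stable i n i ℕ.≤-refl i≤n) ⟩
      f 0 * - (y * x) + x
        ≈⟨ solve 3 (λ f y x → f :* (:- (y :* x)) :+ x := (con ℤ.1ℤ :- f :* y) :* x) refl (f 0) y x ⟩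
      (1# - f 0 * y) * x
        ≈⟨ *-congʳ (trans (+-congˡ (-‿cong f₀y≈1)) (-‿inverseʳ 1#)) ⟩
      0# * x ≈⟨ zeroˡ x ⟩
      0# ∎
      where
      x : Carrier
      x = (shift f S.* approximation (suc n)) n

  X : Series
  X zero          = 0#
  X (suc zero)    = 1#
  X (suc (suc _)) = 0#

  X* : ∀ f n → (X S.* f) (suc n) ≈ f n
  X* f n = begin
    0# * f (suc n) + (shift X S.* f) n  ≈⟨ +-congʳ (zeroˡ _) ⟩
    0# + (shift X S.* f) n              ≈⟨ +-identityˡ _ ⟩
    (shift X S.* f) n                   ≈⟨ *-cong-series {g = f} shift-X (λ _ → refl) n ⟩
    (S.1# S.* f) n                      ≈⟨ *-identityˡ-series f n ⟩
    f n                                 ∎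
    where
    shift-X : ∀ n → shift X n ≈ S.1# n
    shift-X zero    = refl
    shift-X (suc _) = refl

  X*-zero : ∀ f → (X S.* f) 0 ≈ 0#
  X*-zero f = trans (+-identityʳ _) (zeroˡ _)

  -- The Euler operator T d/dT, a derivation that shifts no coefficients.
  θ : Series → Series
  θ f n = fromℕ n * f n

  θ-* : ∀ f g n → θ (f S.* g) n ≈ (θ f S.* g) n + (f S.* θ g) n
  θ-* f g zero =
    solve 2 (λ f g → con ℤ.0ℤ :* (f :* g :+ con ℤ.0ℤ)
                  := con ℤ.0ℤ :* f :* g :+ con ℤ.0ℤ :+ (f :* (con ℤ.0ℤ :* g) :+ con ℤ.0ℤ)) refl (f 0) (g 0)
  θ-* f g (suc n) = begin
    (1# + fromℕ n) * (f 0 * g (suc n) + fg)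
      ≈⟨ solve 4 (λ n a b x → (con ℤ.1ℤ :+ n) :* (a :* b :+ x)
           := con ℤ.0ℤ :* a :* b :+ x :+ (a :* ((con ℤ.1ℤ :+ n) :* b) :+ n :* x))
           refl (fromℕ n) (f 0) (g (suc n)) fg ⟩
    0# * f 0 * g (suc n) + fg + (f 0 * (fromℕ (suc n) * g (suc n)) + fromℕ n * fg)
      ≈⟨ +-congˡ (+-congˡ (θ-* (shift f) g n)) ⟩
    0# * f 0 * g (suc n) + fg + (f 0 * (fromℕ (suc n) * g (suc n)) +
      ((θ (shift f) S.* g) n + (shift f S.* θ g) n))
      ≈⟨ solve 5 (λ a b c d e → a :+ b :+ (c :+ (d :+ e)) := a :+ (b :+ d) :+ (c :+ e)) refl _ fg _ _ _ ⟩
    0# * f 0 * g (suc n) + (fg + (θ (shift f) S.* g) n) +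
      (f 0 * (fromℕ (suc n) * g (suc n)) + (shift f S.* θ g) n)
      ≈⟨ +-congʳ (+-congˡ (begin
           fg + (θ (shift f) S.* g) n             ≈⟨ *-distribʳ-series g (shift f) (θ (shift f)) n ⟨
           ((shift f S.+ θ (shift f)) S.* g) n    ≈⟨ *-cong-series {g = g} shift-θ (λ _ → refl) n ⟩
           (shift (θ f) S.* g) n                  ∎)) ⟩
    (θ f S.* g) (suc n) + (f S.* θ g) (suc n) ∎
    where
    fg : Carrier
    fg = (shift f S.* g) n
    shift-θ : ∀ n → shift f n + θ (shift f) n ≈ shift (θ f) n
    shift-θ n = solve 2 (λ x n → x :+ n :* x := (con ℤ.1ℤ :+ n) :* x) refl (f (suc n)) (fromℕ n)

  -- The differential equation (1 + T) f′ = b f of the binomial series, multiplied by T.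
  IsBinomial : Carrier → Series → Set e
  IsBinomial b f = (S.1# S.+ X) S.* θ f S.≈ X S.* scale b f

  isBinomial : ∀ b f → (∀ n → fromℕ (suc n) * f (suc n) ≈ (b - fromℕ n) * f n) → IsBinomial b f
  isBinomial b f rec zero    = begin
    (1# + 0#) * (0# * f 0) + 0#
      ≈⟨ solve 2 (λ f b → (con ℤ.1ℤ :+ con ℤ.0ℤ) :* (con ℤ.0ℤ :* f) :+ con ℤ.0ℤ
           := con ℤ.0ℤ :* (b :* f) :+ con ℤ.0ℤ) refl (f 0) b ⟩
    0# * (b * f 0) + 0# ∎
  isBinomial b f rec (suc n) = begin
    ((S.1# S.+ X) S.* θ f) (suc n)
      ≈⟨ *-distribʳ-series (θ f) S.1# X (suc n) ⟩
    (S.1# S.* θ f) (suc n) + (X S.* θ f) (suc n)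
      ≈⟨ +-cong (*-identityˡ-series (θ f) (suc n)) (X* (θ f) n) ⟩
    fromℕ (suc n) * f (suc n) + fromℕ n * f n
      ≈⟨ +-congʳ (rec n) ⟩
    (b - fromℕ n) * f n + fromℕ n * f n
      ≈⟨ solve 3 (λ b n f → (b :- n) :* f :+ n :* f := b :* f) refl b (fromℕ n) (f n) ⟩
    b * f n
      ≈⟨ X* (scale b f) n ⟨
    (X S.* scale b f) (suc n) ∎

  -- The Leibniz rule turns the equations of the factors into that of the product. This is the law
  -- (1+T)^b (1+T)^c = (1+T)^(b+c) at the level of differential equations, in place of Vandermonde's
  -- identity for the coefficients.
  isBinomial-* : ∀ {b c f g} → IsBinomial b f → IsBinomial c g → IsBinomial (b + c) (f S.* g)
  isBinomial-* {b} {c} {f} {g} bf cg =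
    S.trans (S.*-congˡ {x = E} (θ-* f g))
    (S.trans (SS.solve 5 (λ E f g f′ g′ → E SS.:* (f′ SS.:* g SS.:+ f SS.:* g′)
        SS.:= (E SS.:* f′) SS.:* g SS.:+ f SS.:* (E SS.:* g′)) S.refl E f g (θ f) (θ g))
    (S.trans (S.+-cong (S.*-congʳ {x = g} bf) (S.*-congˡ {x = f} cg))
    (S.trans (SS.solve 5 (λ X f g f′ g′ → (X SS.:* f′) SS.:* g SS.:+ f SS.:* (X SS.:* g′)
        SS.:= X SS.:* (f′ SS.:* g SS.:+ g′ SS.:* f)) S.refl X f g (scale b f) (scale c g))
    (S.*-congˡ {x = X} merge))))
    where
    module SS = IntegerSolver powerSeries-commutativeRing
    E : Series
    E = S.1# S.+ X
    merge : scale b f S.* g S.+ scale c g S.* f S.≈ scale (b + c) (f S.* g)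
    merge n = begin
      (scale b f S.* g) n + (scale c g S.* f) n
        ≈⟨ +-cong (scale-* b f g n) (trans (scale-* c g f n) (*-congˡ (*-comm-series g f n))) ⟩
      b * (f S.* g) n + c * (f S.* g) n
        ≈⟨ distribʳ _ b c ⟨
      (b + c) * (f S.* g) n ∎

  module _ (torsionFree : IsTorsionFree) where

    torsionFree₀ : ∀ n {x} → fromℕ (suc n) * x ≈ 0# → x ≈ 0#
    torsionFree₀ n eq = torsionFree n (trans eq (sym (zeroʳ _)))

    -- For b = 0 the equation says (n + 1) f (n + 1) + n f n = 0, so torsion-freeness kills the
    -- coefficients after the constant one in turn.
    isBinomial-0 : ∀ {b f} → b ≈ 0# → IsBinomial b f → f 0 ≈ 1# → f S.≈ S.1#
    isBinomial-0         b≈0 bf f₀≈1 zero    = f₀≈1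
    isBinomial-0 {b} {f} b≈0 bf f₀≈1 (suc n) = torsionFree₀ n (begin
      fromℕ (suc n) * f (suc n)
        ≈⟨ +-identityʳ _ ⟨
      fromℕ (suc n) * f (suc n) + 0#
        ≈⟨ +-congˡ (θ≈0 n) ⟨
      fromℕ (suc n) * f (suc n) + fromℕ n * f n
        ≈⟨ +-cong (*-identityˡ-series (θ f) (suc n)) (X* (θ f) n) ⟨
      (S.1# S.* θ f) (suc n) + (X S.* θ f) (suc n)
        ≈⟨ *-distribʳ-series (θ f) S.1# X (suc n) ⟨
      ((S.1# S.+ X) S.* θ f) (suc n)
        ≈⟨ bf (suc n) ⟩
      (X S.* scale b f) (suc n)
        ≈⟨ X* (scale b f) n ⟩
      b * f n
        ≈⟨ trans (*-congʳ b≈0) (zeroˡ _) ⟩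
      0# ∎)
      where
      θ≈0 : ∀ n → fromℕ n * f n ≈ 0#
      θ≈0 zero    = zeroˡ _
      θ≈0 (suc n) = trans (*-congˡ (isBinomial-0 b≈0 bf f₀≈1 (suc n))) (zeroʳ _)

  fromℕ-constant : ∀ n → SN.fromℕ n S.≈ constant (fromℕ n)
  fromℕ-constant zero    zero    = refl
  fromℕ-constant zero    (suc k) = refl
  fromℕ-constant (suc n) zero    = +-congˡ (fromℕ-constant n zero)
  fromℕ-constant (suc n) (suc k) = trans (+-identityˡ _) (fromℕ-constant n (suc k))

  fromℕ-scale : ∀ n f → SN.fromℕ n S.* f S.≈ scale (fromℕ n) f
  fromℕ-scale n f = S.trans (S.*-congʳ {x = f} (fromℕ-constant n)) (constant-* (fromℕ n) f)

  powerSeries-torsionFree : IsTorsionFree → SN.IsTorsionFree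
  powerSeries-torsionFree torsionFree n {f} {g} eq k = torsionFree n
    (trans (sym (fromℕ-scale (suc n) f k)) (trans (eq k) (fromℕ-scale (suc n) g k)))

open ≡ using (refl; sym; trans)

module BinomialSeries {o e} (R : CommutativeRing o e) where

  open CommutativeRing R hiding (zero; refl; sym; trans)
  private module R = CommutativeRing R
  open import Relation.Binary.Reasoning.Setoid setoid
  open import Algebra.Properties.Ring ring using (-‿distribʳ-*)
  open import Algebra.Properties.AbelianGroup +-abelianGroup using (x∙y⁻¹≈ε⇒x≈y)
  open import Algebra.Properties.Semiring.Mult semiring using (×1-homo-*)
  open CompleteGraphDeterminant R using (fromℕ; IsTorsionFree)
  open PowerSeriesProperties R
  open PowerSeriesRing R
  open IntegerSolver R
  private module S = CommutativeRing powerSeries-commutativeRing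

  isTorsionFree : (∀ n {x} → fromℕ (suc n) * x ≈ 0# → x ≈ 0#) → IsTorsionFree
  isTorsionFree cancel₀ n {x} {y} eq = x∙y⁻¹≈ε⇒x≈y x y (cancel₀ n (begin
    fromℕ (suc n) * (x - y)                   ≈⟨ distribˡ _ _ _ ⟩
    fromℕ (suc n) * x + fromℕ (suc n) * - y   ≈⟨ +-cong eq (R.sym (-‿distribʳ-* _ _)) ⟩
    fromℕ (suc n) * y - fromℕ (suc n) * y     ≈⟨ -‿inverseʳ _ ⟩
    0#                                        ∎))

  -- Binomial coefficients are characterised by their product with n!. In a torsion-free ring this
  -- determines them, however the division was carried out.
  record IsBinomialFamily (binom falling : Carrier → ℕ → Carrier) : Set (o ⊔ e) where
    field
      falling-zero : ∀ b → falling b 0 ≈ 1#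
      falling-suc  : ∀ b n → falling b (suc n) ≈ falling b n * (b - fromℕ n)
      binom-!      : ∀ b n → binom b n * fromℕ (n !) ≈ falling b n

  module _ (torsionFree : IsTorsionFree) where

    fromℕ-cancel : ∀ n → .{{NonZero n}} → ∀ {x y} → fromℕ n * x ≈ fromℕ n * y → x ≈ y
    fromℕ-cancel (suc n) = torsionFree n

    module _ {binom falling} (isQuotient : IsBinomialFamily binom falling) where

      open IsBinomialFamily isQuotient

      binom-zero : ∀ b → binom b 0 ≈ 1#
      binom-zero b = begin
        binom b 0               ≈⟨ *-identityʳ _ ⟨
        binom b 0 * 1#          ≈⟨ *-congˡ (+-identityʳ 1#) ⟨
        binom b 0 * (1# + 0#)   ≈⟨ binom-! b 0 ⟩
        falling b 0             ≈⟨ falling-zero b ⟩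
        1#                      ∎

      binom-suc : ∀ b n → fromℕ (suc n) * binom b (suc n) ≈ (b - fromℕ n) * binom b n
      binom-suc b n = fromℕ-cancel (n !) {{n ℕ.!≢0}} (begin
        fromℕ (n !) * (fromℕ (suc n) * binom b (suc n))
          ≈⟨ solve 3 (λ x y z → x :* (y :* z) := z :* (y :* x)) R.refl _ _ (binom b (suc n)) ⟩
        binom b (suc n) * (fromℕ (suc n) * fromℕ (n !))
          ≈⟨ *-congˡ (×1-homo-* (suc n) (n !)) ⟨
        binom b (suc n) * fromℕ (suc n !)
          ≈⟨ binom-! b (suc n) ⟩
        falling b (suc n)
          ≈⟨ falling-suc b n ⟩
        falling b n * (b - fromℕ n)
          ≈⟨ *-congʳ (binom-! b n) ⟨
        binom b n * fromℕ (n !) * (b - fromℕ n)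
          ≈⟨ solve 3 (λ x y z → x :* y :* z := y :* (z :* x)) R.refl (binom b n) _ _ ⟩
        fromℕ (n !) * ((b - fromℕ n) * binom b n) ∎)

      binom-one : ∀ b → binom b 1 ≈ b
      binom-one b = begin
        binom b 1                 ≈⟨ *-identityˡ _ ⟨
        1# * binom b 1            ≈⟨ *-congʳ (+-identityʳ 1#) ⟨
        (1# + 0#) * binom b 1     ≈⟨ binom-suc b 0 ⟩
        (b - 0#) * binom b 0      ≈⟨ *-congˡ (binom-zero b) ⟩
        (b - 0#) * 1#             ≈⟨ solve 1 (λ b → (b :- con 0ℤ) :* con 1ℤ := b) R.refl b ⟩
        b                         ∎

      binom-isBinomial : ∀ b → IsBinomial b (binom b)
      binom-isBinomial b = isBinomial b (binom b) (binom-suc b)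

      binom-trivial : ∀ {b} → b ≈ 0# → binom b S.≈ S.1#
      binom-trivial {b} b≈0 = isBinomial-0 torsionFree b≈0 (binom-isBinomial b) (binom-zero b)

      binom-inverse : ∀ b → binom b S.* binom (- b) S.≈ S.1#
      binom-inverse b = isBinomial-0 torsionFree (-‿inverseʳ b)
        (isBinomial-* {f = binom b} {g = binom (- b)} (binom-isBinomial b) (binom-isBinomial (- b)))
        (R.trans (+-identityʳ _) (R.trans (*-cong (binom-zero b) (binom-zero (- b))) (*-identityʳ 1#)))

-- Twisted complete graphs

module RingIdentities {o e} (R : CommutativeRing o e) where

  open CommutativeRing R hiding (zero; refl; sym; trans)
  private module R = CommutativeRing R
  open import Algebra.Properties.Semiring.Mult semiring using (×1-homo-*) public
  open import Algebra.Definitions.RawSemiring (Semiring.rawSemiring semiring) using (_^_)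
  open CompleteGraphDeterminant R using (fromℕ)
  open IntegerSolver R
  open import Relation.Binary.Reasoning.Setoid setoid

  fromℕ-^ : ∀ m n → fromℕ (m ℕ.^ n) ≈ fromℕ m ^ n
  fromℕ-^ m zero    = +-identityʳ 1#
  fromℕ-^ m (suc n) = R.trans (×1-homo-* m (m ℕ.^ n)) (*-congˡ (fromℕ-^ m n))

  fromℕ-^-* : ∀ m n k → fromℕ (m ℕ.^ n ℕ.* k) ≈ fromℕ m ^ n * fromℕ k
  fromℕ-^-* m n k = R.trans (×1-homo-* (m ℕ.^ n) k) (*-congʳ (fromℕ-^ m n))

  -- Here `I` and `I⁻¹` are the series of zero voltage. They stand in the place of c for α, treated
  -- here, and in that of b for α′, treated by `twist-left`.
  twist-right : ∀ {P Q I I⁻¹} → I ≈ 1# → I⁻¹ ≈ 1# → 1# + 1# - (Q * I + P * I⁻¹) ≈ 1# + 1# - (Q + P)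
  twist-right I≈1 I⁻¹≈1 = +-congˡ (-‿cong (+-cong
    (R.trans (*-congˡ I≈1) (*-identityʳ _)) (R.trans (*-congˡ I⁻¹≈1) (*-identityʳ _))))

  twist-left : ∀ {P Q I I⁻¹} → I ≈ 1# → I⁻¹ ≈ 1# → 1# + 1# - (I⁻¹ * P + I * Q) ≈ 1# + 1# - (Q + P)
  twist-left I≈1 I⁻¹≈1 = +-congˡ (-‿cong (R.trans (+-cong
    (R.trans (*-congʳ I⁻¹≈1) (*-identityˡ _)) (R.trans (*-congʳ I≈1) (*-identityˡ _))) (+-comm _ _)))

  unit-* : ∀ {V V⁻¹ U U⁻¹} → V * V⁻¹ ≈ 1# → U⁻¹ * U ≈ 1# → (V * U⁻¹) * (V⁻¹ * U) ≈ 1#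
  unit-* {V} {V⁻¹} {U} {U⁻¹} VV⁻¹≈1 U⁻¹U≈1 = begin
    (V * U⁻¹) * (V⁻¹ * U)
      ≈⟨ solve 4 (λ V V′ U U′ → (V :* U′) :* (V′ :* U) := (V :* V′) :* (U′ :* U)) R.refl V V⁻¹ U U⁻¹ ⟩
    (V * V⁻¹) * (U⁻¹ * U)  ≈⟨ *-cong VV⁻¹≈1 U⁻¹U≈1 ⟩
    1# * 1#                ≈⟨ *-identityˡ 1# ⟩
    1#                     ∎

  -- Moves the unit of a Weierstrass factorisation to the other side, so that ℓ^μ g can be compared
  -- coefficientwise with N T² times a unit.
  divide : ∀ {L G U U⁻¹ N X V} → U⁻¹ * U ≈ 1# → L * G * U ≈ N * (X * (X * V)) →
           L * G ≈ N * (X * (X * (V * U⁻¹)))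
  divide {L} {G} {U} {U⁻¹} {N} {X} {V} U⁻¹U≈1 eq = begin
    L * G                            ≈⟨ *-identityʳ _ ⟨
    L * G * 1#                       ≈⟨ *-congˡ U⁻¹U≈1 ⟨
    L * G * (U⁻¹ * U)
      ≈⟨ solve 3 (λ L U U′ → L :* (U′ :* U) := L :* U :* U′) R.refl (L * G) U U⁻¹ ⟩
    L * G * U * U⁻¹                  ≈⟨ *-congʳ eq ⟩
    N * (X * (X * V)) * U⁻¹
      ≈⟨ solve 4 (λ N X V U′ → N :* (X :* (X :* V)) :* U′ := N :* (X :* (X :* (V :* U′)))) R.refl N X V U⁻¹ ⟩
    N * (X * (X * (V * U⁻¹)))        ∎

  regroup : ∀ {N q L L′ X V} → N ≈ q * L → L′ ≈ L →
            N * (X * (X * V)) ≈ L′ * (X * (X * 1#)) * (q * V)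
  regroup {N} {q} {L} {L′} {X} {V} N≈qL L′≈L = begin
    N * (X * (X * V))        ≈⟨ *-congʳ (R.trans N≈qL (*-congˡ (R.sym L′≈L))) ⟩
    q * L′ * (X * (X * V))
      ≈⟨ solve 4 (λ q L X V → q :* L :* (X :* (X :* V)) := L :* (X :* (X :* con 1ℤ)) :* (q :* V)) R.refl q L′ X V ⟩
    L′ * (X * (X * 1#)) * (q * V) ∎

  module _ {P Q X W W⁻¹} (PQ≈1 : P * Q ≈ 1#) (P≈1+XW : P ≈ 1# + X * W) (WW⁻¹≈1 : W * W⁻¹ ≈ 1#) where

    square-unit : - (Q * (W * W)) * - (P * (W⁻¹ * W⁻¹)) ≈ 1#
    square-unit = begin
      - (Q * (W * W)) * - (P * (W⁻¹ * W⁻¹))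
        ≈⟨ solve 4 (λ P Q W W′ → (:- (Q :* (W :* W))) :* (:- (P :* (W′ :* W′)))
             := (P :* Q) :* ((W :* W′) :* (W :* W′))) R.refl P Q W W⁻¹ ⟩
      (P * Q) * ((W * W⁻¹) * (W * W⁻¹))
        ≈⟨ *-cong PQ≈1 (*-cong WW⁻¹≈1 WW⁻¹≈1) ⟩
      1# * (1# * 1#)
        ≈⟨ R.trans (*-identityˡ _) (*-identityˡ _) ⟩
      1# ∎

    square-factor : 1# + 1# - (Q + P) ≈ X * (X * - (Q * (W * W)))
    square-factor = begin
      1# + 1# - (Q + P)
        ≈⟨ solve 2 (λ P Q → con 1ℤ :+ con 1ℤ :- (Q :+ P)
             := con 1ℤ :* (con 1ℤ :+ con 1ℤ) :- (Q :+ P :* con 1ℤ)) R.refl P Q ⟩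
      1# * (1# + 1#) - (Q + P * 1#)
        -- Replacing 1 by P Q makes Q a common factor; the cofactor is -(P - 1)².
        ≈⟨ +-cong (*-congʳ (R.sym PQ≈1)) (-‿cong (+-congˡ (*-congˡ (R.sym PQ≈1)))) ⟩
      (P * Q) * (1# + 1#) - (Q + P * (P * Q))
        ≈⟨ solve 2 (λ P Q → (P :* Q) :* (con 1ℤ :+ con 1ℤ) :- (Q :+ P :* (P :* Q))
             := :- (Q :* ((P :- con 1ℤ) :* (P :- con 1ℤ)))) R.refl P Q ⟩
      - (Q * ((P - 1#) * (P - 1#)))
        ≈⟨ -‿cong (*-congˡ (*-cong P-1≈XW P-1≈XW)) ⟩
      - (Q * ((X * W) * (X * W)))
        ≈⟨ solve 3 (λ X Q W → :- (Q :* ((X :* W) :* (X :* W))) := X :* (X :* (:- (Q :* (W :* W)))))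
             R.refl X Q W ⟩
      X * (X * - (Q * (W * W))) ∎
      where
      P-1≈XW : P - 1# ≈ X * W
      P-1≈XW = R.trans (+-congʳ P≈1+XW)
        (solve 1 (λ y → con 1ℤ :+ y :- con 1ℤ := y) R.refl (X * W))

module SquareFactor {o e} (R : CommutativeRing o e) where

  open CommutativeRing R hiding (zero; refl; sym; trans)
  private module R = CommutativeRing R
  open PowerSeriesProperties R
  open PowerSeriesRing R
  private
    module S = CommutativeRing powerSeries-commutativeRing
    module SI = RingIdentities powerSeries-commutativeRing

  -- With P = 1 + T W and P Q = 1, 2 - P - Q = - Q (P - 1)² = - Q T² W².
  two-minus : ∀ P Q {a⁻¹} → P S.* Q S.≈ S.1# → P 0 ≈ 1# → P 1 * a⁻¹ ≈ 1# →
    ∃[ V ] (∃[ V⁻¹ ] V S.* V⁻¹ S.≈ S.1#) ×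
           (S.1# S.+ S.1# S.- (Q S.+ P) S.≈ X S.* (X S.* V))
  two-minus P Q PQ≈1 P₀≈1 P₁-unit =
    _ , (_ , SI.square-unit {P} {Q} {X} {W} {W⁻¹} PQ≈1 P≈1+XW WW⁻¹≈1)
      , SI.square-factor {P} {Q} {X} {W} {W⁻¹} PQ≈1 P≈1+XW WW⁻¹≈1
    where
    W W⁻¹ : Series
    W = shift P
    -- The constant term of `W` is the coefficient of T in `P`. For (1+T)^a it is a, and this is
    -- where the voltage has to be a unit.
    W⁻¹ = Inverse.inverse W P₁-unit
    WW⁻¹≈1 : W S.* W⁻¹ S.≈ S.1#
    WW⁻¹≈1 = Inverse.*-inverseʳ W P₁-unit
    P≈1+XW : P S.≈ S.1# S.+ X S.* W
    P≈1+XW zero    = R.trans P₀≈1 (R.trans (R.sym (+-identityʳ _)) (+-congˡ (R.sym (X*-zero W))))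
    P≈1+XW (suc n) = R.sym (R.trans (+-identityˡ _) (X* W n))

module TwistedCompleteGraph {o e} (R : CommutativeRing o e) where

  open CommutativeRing R hiding (zero; refl; sym; trans)
  private module R = CommutativeRing R
  open import Algebra.Properties.Ring ring using (-0#≈0#)
  open PowerSeriesRing R
  open PowerSeriesProperties R using (X; fromℕ-constant; powerSeries-torsionFree)
  open CompleteGraphDeterminant R using (fromℕ; IsTorsionFree)
  open BinomialSeries R
  private
    module S = CommutativeRing powerSeries-commutativeRing
    module SN = CompleteGraphDeterminant powerSeries-commutativeRing
    module SI = RingIdentities powerSeries-commutativeRing
  open DeterminantProperties powerSeries-commutativeRing using (Matrix; det; minor)

  record IsSquareMultiple (N : ℕ) (f : Series) : Set (o ⊔ e) where
    field
      V V⁻¹   : Series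
      inverse : V S.* V⁻¹ S.≈ S.1#
      factor  : f S.≈ SN.fromℕ N S.* (X S.* (X S.* V))

  record DetIsSquareMultiple (N : ℕ) {n} (M : Matrix n) : Set (o ⊔ e) where
    field isSquareMultiple : IsSquareMultiple N (det M)

  -- Records, not equations: instantiated at ℤₗ, equations between entries would be compared
  -- by unfolding all ring operations down to their coherence proofs.
  record IsConstantEntry (n : ℕ) (f : Series) : Set e where
    field entry : ∀ k → f k ≈ constant (fromℕ n) k

  record IsForwardEntry (binom : Carrier → Series) (b : Carrier) (f : Series) : Set e where
    field entry : ∀ n → f n ≈ - binom b n

  record IsBackwardEntry (binom : Carrier → Series) (b : Carrier) (f : Series) : Set e where
    field entry : ∀ n → f n ≈ - binom (- b) n

  record IsTrivialEntry (binom : Carrier → Series) (f : Series) : Set (o ⊔ e) where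
    field
      b     : Carrier
      b≈0   : b ≈ 0#
      entry : ∀ n → f n ≈ - binom b n

  -- The Laplacian of K_{3+m} with voltages only at the first vertex: b on the edge to
  -- vertex t and c on the others.
  record IsTwistedLaplacian (binom : Carrier → Series) {m} (t : Fin (2 ℕ.+ m)) (b c : Carrier)
                            (M : Matrix (3 ℕ.+ m)) : Set (o ⊔ e) where
    field
      diagonal    : ∀ i → IsConstantEntry (2 ℕ.+ m) (M i i)
      row-t       : IsForwardEntry binom b (M Fin.zero (Fin.suc t))
      column-t    : IsBackwardEntry binom b (M (Fin.suc t) Fin.zero)
      row         : ∀ j → IsForwardEntry binom c (M Fin.zero (Fin.suc (punchIn t j)))
      column      : ∀ j → IsBackwardEntry binom c (M (Fin.suc (punchIn t j)) Fin.zero)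
      offDiagonal : ∀ i j → i ≢ j → IsTrivialEntry binom (M (Fin.suc i) (Fin.suc j))

  module _ (torsionFree : IsTorsionFree) {binom falling} (family : IsBinomialFamily binom falling) where

    det-twistedLaplacian : ∀ {m t b c} {M : Matrix (3 ℕ.+ m)} → IsTwistedLaplacian binom t b c M →
      det M S.≈ SN.fromℕ ((3 ℕ.+ m) ℕ.^ m ℕ.* suc m)
                S.* (S.1# S.+ S.1# S.- (binom (- b) S.* binom c S.+ binom b S.* binom (- c)))
    det-twistedLaplacian {m} {t} {b} {c} {M} T = S.trans
      (SN.det-twisted (powerSeries-torsionFree torsionFree) m M t
        {binom b} {binom (- b)} {binom c} {binom (- c)}
        (binom-inverse torsionFree family b) (binom-inverse torsionFree family c)
        (diag Fin.zero) (IsForwardEntry.entry row-t) (IsBackwardEntry.entry column-t)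
        (λ j → IsForwardEntry.entry (row j)) (λ j → IsBackwardEntry.entry (column j))
        record { diagonal = λ i → diag (Fin.suc i) ; offDiagonal = off })
      (S.*-congʳ {x = S.1# S.+ S.1# S.- (binom (- b) S.* binom c S.+ binom b S.* binom (- c))}
        (S.sym (SI.fromℕ-^-* (3 ℕ.+ m) m (suc m))))
      where
      open IsTwistedLaplacian T
      diag : ∀ i → M i i S.≈ SN.fromℕ (2 ℕ.+ m)
      diag i n = R.trans (IsConstantEntry.entry (diagonal i) n) (R.sym (fromℕ-constant (2 ℕ.+ m) n))
      off : ∀ i j → i ≢ j → minor M Fin.zero i j S.≈ S.- S.1#
      off i j i≢j n = R.trans (entry n) (-‿cong (binom-trivial torsionFree family b≈0 n))
        where open IsTrivialEntry (offDiagonal i j i≢j)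

    det-isSquareMultiple : ∀ {m t a a⁻¹} {M : Matrix (3 ℕ.+ m)} → a * a⁻¹ ≈ 1# →
      IsTwistedLaplacian binom t a 0# M ⊎ IsTwistedLaplacian binom t 0# a M →
      DetIsSquareMultiple ((3 ℕ.+ m) ℕ.^ m ℕ.* suc m) M
    det-isSquareMultiple {m} {t} {a} {a⁻¹} {M} aa⁻¹≈1 T = build (SquareFactor.two-minus R P Q
        (binom-inverse torsionFree family a) (binom-zero torsionFree family a)
        (R.trans (*-congʳ (binom-one torsionFree family a)) aa⁻¹≈1))
      where
      N = (3 ℕ.+ m) ℕ.^ m ℕ.* suc m
      P Q : Series
      P = binom a
      Q = binom (- a)
      1≈ : binom 0# S.≈ S.1#
      1≈ = binom-trivial torsionFree family R.refl
      1≈′ : binom (- 0#) S.≈ S.1#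
      1≈′ = binom-trivial torsionFree family -0#≈0#
      det≈ : IsTwistedLaplacian binom t a 0# M ⊎ IsTwistedLaplacian binom t 0# a M →
        det M S.≈ SN.fromℕ N S.* (S.1# S.+ S.1# S.- (Q S.+ P))
      det≈ (inj₁ T) = S.trans (det-twistedLaplacian T)
        (S.*-congˡ {x = SN.fromℕ N} (SI.twist-right {P} {Q} 1≈ 1≈′))
      det≈ (inj₂ T) = S.trans (det-twistedLaplacian T)
        (S.*-congˡ {x = SN.fromℕ N} (SI.twist-left {P} {Q} 1≈ 1≈′))
      build : ∃[ V ] (∃[ V⁻¹ ] V S.* V⁻¹ S.≈ S.1#) ×
              (S.1# S.+ S.1# S.- (Q S.+ P) S.≈ X S.* (X S.* V)) →
              DetIsSquareMultiple N M
      build (V , (V⁻¹ , inverse) , eq) = record { isSquareMultiple = record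
        { V = V ; V⁻¹ = V⁻¹ ; inverse = inverse
        ; factor = S.trans (det≈ T) (S.*-congˡ {x = SN.fromℕ N} eq)
        } }

-- Weierstrass factorisations of N T² times a unit

module Weierstrass {o e} (R : CommutativeRing o e) (ℓ : ℕ) .{{ℓ≢0 : NonZero ℓ}} where

  open CommutativeRing R hiding (zero; refl; sym; trans)
  private module R = CommutativeRing R
  open PowerSeriesRing R
  open PowerSeriesProperties R
  open CompleteGraphDeterminant R using (fromℕ; IsTorsionFree)
  open BinomialSeries R using (fromℕ-cancel)
  open TwistedCompleteGraph R using (IsSquareMultiple)
  open import Algebra.Properties.Semiring.Mult semiring using (×1-homo-*)
  open import Relation.Binary.Reasoning.Setoid setoid
  open IntegerSolver R
  private
    module S = CommutativeRing powerSeries-commutativeRing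
    module SN = CompleteGraphDeterminant powerSeries-commutativeRing
    module SI = RingIdentities powerSeries-commutativeRing
  open import Algebra.Definitions.RawSemiring (Semiring.rawSemiring S.semiring) using (_^_)

  -- The properties of the ℓ-adic integers behind the comparison: `divides-back` says that an
  -- integer in the ideal of ℓ^k is divisible by ℓ^k in the integers, so valuations can be read off
  -- from natural numbers, and `invertible` makes the part of N prime to ℓ a unit.
  record IsAdicLike : Set (o ⊔ e) where
    field
      torsionFree  : IsTorsionFree
      divides-back : ∀ k N x → fromℕ (ℓ ℕ.^ k) * x ≈ fromℕ N → ℓ ℕ.^ k ℕ.∣ N
      invertible   : ∀ m → ℓ ℕ.∤ m → ∃[ y ] fromℕ m * y ≈ 1#

  record IsProduct (f A g U : Series) : Set e where
    field product : f S.≈ A S.* g S.* U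

  record Factorisation (ℓ̂ : Carrier) (f : Series) (μ d : ℕ) : Set (o ⊔ e) where
    field
      g U U⁻¹       : Series
      monic         : g d ≈ 1#
      degree        : ∀ n → d ℕ.< n → g n ≈ 0#
      ℓ∣coeffs      : ∀ n → n ℕ.< d → ∃[ q ] q * ℓ̂ ≈ g n
      inverse       : U⁻¹ S.* U S.≈ S.1#
      factorisation : IsProduct f (constant ℓ̂ ^ μ) g U

  private
    power : ∀ {ℓ̂} → ℓ̂ ≈ fromℕ ℓ → ∀ μ → constant ℓ̂ ^ μ S.≈ SN.fromℕ (ℓ ℕ.^ μ)
    power {ℓ̂} ℓ̂≈ zero    n = R.sym (+-identityʳ _)
    power {ℓ̂} ℓ̂≈ (suc μ) = S.trans
      (S.*-cong (S.trans constant≈ (S.sym (fromℕ-constant ℓ))) (power ℓ̂≈ μ))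
      (S.sym (SI.×1-homo-* ℓ (ℓ ℕ.^ μ)))
      where
      constant≈ : constant ℓ̂ S.≈ constant (fromℕ ℓ)
      constant≈ zero    = ℓ̂≈
      constant≈ (suc _) = R.refl

    X*X* : ∀ f n → (X S.* (X S.* f)) (2 ℕ.+ n) ≈ f n
    X*X* f n = R.trans (X* (X S.* f) (suc n)) (X* f n)

    X*X*-low : ∀ f n → n ℕ.< 2 → (X S.* (X S.* f)) n ≈ 0#
    X*X*-low f zero          _ = X*-zero (X S.* f)
    X*X*-low f (suc zero)    _ = R.trans (X* (X S.* f) 0) (X*-zero f)
    X*X*-low f (suc (suc n)) (s≤s (s≤s ()))

  module _ (adic : IsAdicLike) {ℓ̂} (ℓ̂≈ : ℓ̂ ≈ fromℕ ℓ) where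
    open IsAdicLike adic
    open IsSquareMultiple renaming (inverse to V-inverse)
    open Factorisation

    private
      divisible : ∀ {n x} → fromℕ ℓ * x ≈ fromℕ n → ℓ ℕ.∣ n
      divisible {n} {x} eq = subst (ℕ._∣ n) (ℕ.*-identityʳ ℓ)
        (divides-back 1 n x (R.trans (*-congʳ (reflexive (cong fromℕ (ℕ.*-identityʳ ℓ)))) eq))

    -- With W = V U⁻¹ the two factorisations give ℓ^μ g = N T² W. The coefficient of T² shows that
    -- ℓ^μ divides N = q ℓ^μ, and cancelling leaves g = q T² W. Since g is monic, ℓ does not divide
    -- q. Degree below 2 contradicts the vanishing of the low coefficients, and degree above 2 would
    -- make ℓ divide the coefficient of T², which is q times a unit.
    factorisation-unique : ℓ ℕ.∤ 1 → ∀ {N f μ d} → IsSquareMultiple N f → Factorisation ℓ̂ f μ d →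
      d ≡ 2 × ℓ ℕ.^ μ ℕ.∣ N × ℓ ℕ.^ suc μ ℕ.∤ N
    factorisation-unique ℓ∤1 {N} {f} {μ} {d} Q F = go ℓ^μ∣N
      where
      W W⁻¹ C : Series
      W = V Q S.* U⁻¹ F
      W⁻¹ = V⁻¹ Q S.* U F
      C = X S.* (X S.* W)
      w w⁻¹ : Carrier
      w = W 0
      w⁻¹ = W⁻¹ 0
      ww⁻¹≈1 : w * w⁻¹ ≈ 1#
      ww⁻¹≈1 = R.trans (R.sym (+-identityʳ _)) (SI.unit-* {V Q} {V⁻¹ Q} {U F} {U⁻¹ F} (V-inverse Q) (inverse F) 0)
      coefficients : ∀ n → fromℕ (ℓ ℕ.^ μ) * g F n ≈ fromℕ N * C n
      coefficients n = begin
        fromℕ (ℓ ℕ.^ μ) * g F n              ≈⟨ fromℕ-scale (ℓ ℕ.^ μ) (g F) n ⟨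
        (SN.fromℕ (ℓ ℕ.^ μ) S.* g F) n       ≈⟨ S.*-congʳ {x = g F} (power ℓ̂≈ μ) n ⟨
        (constant ℓ̂ ^ μ S.* g F) n           ≈⟨ SI.divide {constant ℓ̂ ^ μ} {g F} {U F} {U⁻¹ F} {SN.fromℕ N} {X} {V Q}
                                                  (inverse F) (S.trans (S.sym (IsProduct.product (factorisation F))) (factor Q)) n ⟩
        (SN.fromℕ N S.* C) n                 ≈⟨ fromℕ-scale N C n ⟩
        fromℕ N * C n                        ∎
      ℓ^μ∣N : ℓ ℕ.^ μ ℕ.∣ N
      ℓ^μ∣N = divides-back μ N (g F 2 * w⁻¹) (begin
        fromℕ (ℓ ℕ.^ μ) * (g F 2 * w⁻¹)   ≈⟨ *-assoc _ _ _ ⟨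
        fromℕ (ℓ ℕ.^ μ) * g F 2 * w⁻¹     ≈⟨ *-congʳ (coefficients 2) ⟩
        fromℕ N * C 2 * w⁻¹               ≈⟨ *-congʳ (*-congˡ (X*X* W 0)) ⟩
        fromℕ N * w * w⁻¹                 ≈⟨ *-assoc _ _ _ ⟩
        fromℕ N * (w * w⁻¹)               ≈⟨ *-congˡ ww⁻¹≈1 ⟩
        fromℕ N * 1#                      ≈⟨ *-identityʳ _ ⟩
        fromℕ N                           ∎)
      go : ℓ ℕ.^ μ ℕ.∣ N → d ≡ 2 × ℓ ℕ.^ μ ℕ.∣ N × ℓ ℕ.^ suc μ ℕ.∤ N
      go (ℕ.divides q N≡) = d≡2 , ℓ^μ∣N , λ p → ℓ∤q (ℕ.*-cancelʳ-∣ (ℓ ℕ.^ μ) {{ℓ^μ≢0}}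
          (subst (ℓ ℕ.^ suc μ ℕ.∣_) N≡ p))
        where
        ℓ^μ≢0 : NonZero (ℓ ℕ.^ μ)
        ℓ^μ≢0 = ℕ.m^n≢0 ℓ μ
        g≈ : ∀ n → g F n ≈ fromℕ q * C n
        g≈ n = fromℕ-cancel torsionFree (ℓ ℕ.^ μ) {{ℓ^μ≢0}} (begin
          fromℕ (ℓ ℕ.^ μ) * g F n                ≈⟨ coefficients n ⟩
          fromℕ N * C n                          ≡⟨ cong (λ N → fromℕ N * C n) N≡ ⟩
          fromℕ (q ℕ.* ℓ ℕ.^ μ) * C n            ≈⟨ *-congʳ (×1-homo-* q (ℓ ℕ.^ μ)) ⟩
          fromℕ q * fromℕ (ℓ ℕ.^ μ) * C n        ≈⟨ solve 3 (λ x y z → x :* y :* z := y :* (x :* z)) R.refl _ _ (C n) ⟩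
          fromℕ (ℓ ℕ.^ μ) * (fromℕ q * C n)      ∎)
        fromℕ-1 : 1# ≈ fromℕ 1
        fromℕ-1 = R.sym (+-identityʳ 1#)
        ℓ∤q : ℓ ℕ.∤ q
        ℓ∤q (ℕ.divides r refl) = ℓ∤1 (divisible {x = fromℕ r * C d} (begin
          fromℕ ℓ * (fromℕ r * C d)   ≈⟨ solve 3 (λ x y z → x :* (y :* z) := y :* x :* z) R.refl _ _ (C d) ⟩
          fromℕ r * fromℕ ℓ * C d     ≈⟨ *-congʳ (×1-homo-* r ℓ) ⟨
          fromℕ (r ℕ.* ℓ) * C d       ≈⟨ g≈ d ⟨
          g F d                       ≈⟨ monic F ⟩
          1#                          ≈⟨ fromℕ-1 ⟩
          fromℕ 1                     ∎))
        d≡2 : d ≡ 2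
        d≡2 with ℕ.<-cmp d 2
        ... | tri≈ _ d≡2 _ = d≡2
        -- Monicity would give 1 = 0 in the ring; then 1 is ℓ times 0, and `divisible` yields the
        -- absurd ℓ ∣ 1.
        ... | tri< d<2 _ _ = contradiction (divisible {x = 0#} (begin
          fromℕ ℓ * 0#      ≈⟨ zeroʳ _ ⟩
          0#                ≈⟨ zeroʳ _ ⟨
          fromℕ q * 0#      ≈⟨ *-congˡ (X*X*-low W d d<2) ⟨
          fromℕ q * C d     ≈⟨ g≈ d ⟨
          g F d             ≈⟨ monic F ⟩
          1#                ≈⟨ fromℕ-1 ⟩
          fromℕ 1           ∎)) ℓ∤1
        ... | tri> _ _ 2<d with ℓ∣coeffs F 2 2<d
        ... | y , yℓ≈g₂ = contradiction (divisible {x = y * w⁻¹} (begin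
          fromℕ ℓ * (y * w⁻¹)         ≈⟨ solve 3 (λ x y z → x :* (y :* z) := y :* x :* z) R.refl _ y w⁻¹ ⟩
          y * fromℕ ℓ * w⁻¹           ≈⟨ *-congʳ (*-congˡ ℓ̂≈) ⟨
          y * ℓ̂ * w⁻¹                 ≈⟨ *-congʳ (R.trans yℓ≈g₂ (g≈ 2)) ⟩
          fromℕ q * C 2 * w⁻¹         ≈⟨ *-congʳ (*-congˡ (X*X* W 0)) ⟩
          fromℕ q * w * w⁻¹           ≈⟨ *-assoc _ _ _ ⟩
          fromℕ q * (w * w⁻¹)         ≈⟨ *-congˡ ww⁻¹≈1 ⟩
          fromℕ q * 1#                ≈⟨ *-identityʳ _ ⟩
          fromℕ q                     ∎)) ℓ∤q

    -- The distinguished polynomial is T² itself. The cofactor q of ℓ^μ in N is prime to ℓ, hence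
    -- invertible, and is absorbed into the unit series.
    factorisation-exists : ∀ {N f μ} → IsSquareMultiple N f →
      ℓ ℕ.^ μ ℕ.∣ N → ℓ ℕ.^ suc μ ℕ.∤ N → Factorisation ℓ̂ f μ 2
    factorisation-exists {N} {f} {μ} Q (ℕ.divides q N≡) ℓ^∤N with invertible q ℓ∤q
      where
      ℓ∤q : ℓ ℕ.∤ q
      ℓ∤q p = ℓ^∤N (subst (ℓ ℕ.^ suc μ ℕ.∣_) (sym N≡) (ℕ.*-monoˡ-∣ (ℓ ℕ.^ μ) p))
    ... | y , qy≈1 = record
      { g = X S.* (X S.* S.1#)
      ; U = SN.fromℕ q S.* V Q
      ; U⁻¹ = constant y S.* V⁻¹ Q
      ; monic = X*X* S.1# 0
      ; degree = λ { (suc (suc (suc n))) _ → X*X* S.1# (suc n)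
                   ; (suc (suc zero)) (s≤s (s≤s ())) ; (suc zero) (s≤s ()) }
      ; ℓ∣coeffs = λ n n<2 → 0# , R.trans (zeroˡ ℓ̂) (R.sym (X*X*-low S.1# n n<2))
      ; inverse = S.trans (S.*-comm (constant y S.* V⁻¹ Q) (SN.fromℕ q S.* V Q))
          (SI.unit-* {SN.fromℕ q} {constant y} {V⁻¹ Q} {V Q} scalar (V-inverse Q))
      ; factorisation = record { product = S.trans (factor Q) (SI.regroup {SN.fromℕ N} {SN.fromℕ q} {SN.fromℕ (ℓ ℕ.^ μ)}
          {constant ℓ̂ ^ μ} {X} {V Q}
          (S.trans (S.reflexive (cong SN.fromℕ N≡)) (SI.×1-homo-* q (ℓ ℕ.^ μ))) (power ℓ̂≈ μ)) }
      }
      where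
      scalar : SN.fromℕ q S.* constant y S.≈ S.1#
      scalar zero    = R.trans (fromℕ-scale q (constant y) 0) qy≈1
      scalar (suc n) = R.trans (fromℕ-scale q (constant y) (suc n)) (zeroʳ _)

-- The ring of ℓ-adic integers

^-∣ : ∀ {d z} → + d ∣ z → ∀ k → + (d ℕ.^ k) ∣ z ℤ.^ k
^-∣     (divides q eq) zero    = divides 1ℤ refl
^-∣ {d} (divides q eq) (suc k) with divides q′ eq′ ← ^-∣ (divides q eq) k = divides (q ℤ.* q′)
  (trans (cong₂ ℤ._*_ eq eq′) (trans (lem q (+ d) q′ (+ (d ℕ.^ k)))
    (cong (q ℤ.* q′ ℤ.*_) (sym (ℤ.pos-* d (d ℕ.^ k))))))
  where lem : ∀ a b c d → a ℤ.* b ℤ.* (c ℤ.* d) ≡ a ℤ.* c ℤ.* (b ℤ.* d)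
        lem = solve-∀

module AdicProperties (ℓ : ℕ) (ℓ-prime : Prime ℓ) where

  open Adic ℓ
  open Binomial ℓ ℓ-prime
  module Z = CommutativeRing ℤₗ-commutativeRing
  open CompleteGraphDeterminant ℤₗ-commutativeRing using (fromℕ; IsTorsionFree)
  module B = BinomialSeries ℤₗ-commutativeRing

  residue-fromℕ : ∀ n k → residue (fromℕ n) k ≡ + n
  residue-fromℕ zero    k = refl
  residue-fromℕ (suc n) k = cong ℤ.suc (residue-fromℕ n k)

  -- Cancelling n loses at most n ℓ-adic digits: the relation is read at level n + k, and coherence
  -- brings the conclusion down to level k.
  ι-cancel-0 : ∀ n .{{_ : NonZero n}} {x} → ι (+ n) * x ≈ ι 0ℤ → x ≈ ι 0ℤ
  ι-cancel-0 n {x} eq = residuewise λ k →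
    mod-trans k (mod-sym k (coherent-+ x k n)) (mod (subst (+ (ℓ ℕ.^ k) ∣_) (sym (ℤ.+-identityʳ _)) (div k)))
    where
    div : ∀ k → + (ℓ ℕ.^ k) ∣ residue x (n ℕ.+ k)
    div k = ∣ᵤ⇒∣ (cancel n k ℤ.∣ residue x (n ℕ.+ k) ∣
      (subst (ℓ ℕ.^ (n ℕ.+ k) ℕ.∣_)
        (trans (cong ℤ.∣_∣ (ℤ.+-identityʳ (+ n ℤ.* residue x (n ℕ.+ k)))) (ℤ.abs-* (+ n) (residue x (n ℕ.+ k))))
        (∣⇒∣ᵤ (difference (congruent eq (n ℕ.+ k))))))

  ℤₗ-torsionFree : IsTorsionFree
  ℤₗ-torsionFree = B.isTorsionFree λ n {x} eq → ι-cancel-0 (suc n) (fromℕ-*-≈0 (suc n) x eq)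
    where
    fromℕ-*-≈0 : ∀ n x → fromℕ n * x ≈ ι 0ℤ → ι (+ n) * x ≈ ι 0ℤ
    fromℕ-*-≈0 n x eq = residuewise λ k →
      subst (λ r → r ℤ.* residue x k ≡ 0ℤ [mod-ℓ^ k ]) (residue-fromℕ n k) (congruent eq k)

  private
    bezout : ∀ {m} → ℓ ℕ.∤ m → ∃[ r ] + ℓ ∣ 1ℤ ℤ.- + m ℤ.* r
    bezout {m} ℓ∤m with coprime-Bézout {m} {ℓ} coprime
      where
      coprime : Coprime m ℓ
      coprime (d∣m , d∣ℓ) with prime⇒irreducible ℓ-prime d∣ℓ
      ... | inj₁ d≡1  = d≡1
      ... | inj₂ refl = contradiction d∣m ℓ∤m
    ... | Bézout.+- x y eq = + x , divides (ℤ.- (+ y)) (trans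
            (cong (λ z → 1ℤ ℤ.- z) (trans (sym (ℤ.pos-* m x)) (trans (cong +_ (trans (ℕ.*-comm m x) (sym eq)))
              (cong ℤ.suc (ℤ.pos-* y ℓ)))))
            (lem (+ y) (+ ℓ)))
      where lem : ∀ y l → 1ℤ ℤ.- (1ℤ ℤ.+ y ℤ.* l) ≡ ℤ.- y ℤ.* l
            lem = solve-∀
    ... | Bézout.-+ x y eq = ℤ.- (+ x) , divides (+ y) (trans
            (trans (lem (+ m) (+ x)) (cong ℤ.suc (sym (ℤ.pos-* x m))))
            (trans (cong +_ eq) (ℤ.pos-* y ℓ)))
      where lem : ∀ m x → 1ℤ ℤ.- m ℤ.* (ℤ.- x) ≡ 1ℤ ℤ.+ x ℤ.* m
            lem = solve-∀

  -- If m r = 1 - e with ℓ ∣ e, the inverse of m is the geometric series r (1 + e + e² + ⋯).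
  invertible : ∀ m → ℓ ℕ.∤ m → ∃[ y ] fromℕ m Z.* y Z.≈ Z.1#
  invertible m ℓ∤m with bezout ℓ∤m
  ... | r , ℓ∣e = y , residuewise λ k →
          subst (λ z → z ℤ.* partialSum k ≡ 1ℤ [mod-ℓ^ k ]) (sym (residue-fromℕ m k))
            (mod (subst (+ (ℓ ℕ.^ k) ∣_) (sym (m*partialSum k)) (∣m⇒∣-m (^-∣ ℓ∣e k))))
    where
    e : ℤ
    e = 1ℤ ℤ.- + m ℤ.* r
    partialSum : ℕ → ℤ
    partialSum zero    = 0ℤ
    partialSum (suc k) = partialSum k ℤ.+ r ℤ.* e ℤ.^ k
    m*partialSum : ∀ k → + m ℤ.* partialSum k ℤ.- 1ℤ ≡ ℤ.- (e ℤ.^ k)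
    m*partialSum zero    = cong (ℤ._- 1ℤ) (ℤ.*-zeroʳ (+ m))
    m*partialSum (suc k) = trans (lem₁ (+ m) (partialSum k) r (e ℤ.^ k))
      (trans (cong (ℤ._+ + m ℤ.* r ℤ.* e ℤ.^ k) (m*partialSum k)) (lem₂ (+ m) r (e ℤ.^ k)))
      where lem₁ : ∀ m s r p → m ℤ.* (s ℤ.+ r ℤ.* p) ℤ.- 1ℤ ≡ m ℤ.* s ℤ.- 1ℤ ℤ.+ m ℤ.* r ℤ.* p
            lem₁ = solve-∀
            lem₂ : ∀ m r p → ℤ.- p ℤ.+ m ℤ.* r ℤ.* p ≡ ℤ.- ((1ℤ ℤ.- m ℤ.* r) ℤ.* p)
            lem₂ = solve-∀
    y : ℤₗ
    y = record
      { residue  = partialSum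
      ; coherent = λ k → mod (subst (+ (ℓ ℕ.^ k) ∣_) (sym (lem (partialSum k) (r ℤ.* e ℤ.^ k)))
                     (∣n⇒∣m*n r (^-∣ ℓ∣e k)))
      }
      where lem : ∀ s x → s ℤ.+ x ℤ.- s ≡ x
            lem = solve-∀

  -- Read modulo ℓ^k, the left-hand side vanishes, and therefore so does N.
  divides-back : ∀ k N x → fromℕ (ℓ ℕ.^ k) Z.* x Z.≈ fromℕ N → ℓ ℕ.^ k ℕ.∣ N
  divides-back k N x eq = ∣⇒∣ᵤ (subst (+ (ℓ ℕ.^ k) ∣_) (lem (+ (ℓ ℕ.^ k) ℤ.* residue x k) (+ N))
    (∣m∣n⇒∣m+n (∣m⇒∣m*n (residue x k) (divides 1ℤ (sym (ℤ.*-identityˡ (+ (ℓ ℕ.^ k))))))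
      (∣m⇒∣-m (difference (subst₂ (λ y z → y ℤ.* residue x k ≡ z [mod-ℓ^ k ])
        (residue-fromℕ (ℓ ℕ.^ k) k) (residue-fromℕ N k) (congruent eq k))))))
    where lem : ∀ a n → a ℤ.+ ℤ.- (a ℤ.- n) ≡ n
          lem = solve-∀

  private instance
    _ = prime⇒nonZero ℓ-prime
  open Weierstrass ℤₗ-commutativeRing ℓ using (IsAdicLike)

  adicLike : IsAdicLike
  adicLike = record
    { torsionFree = ℤₗ-torsionFree ; divides-back = divides-back ; invertible = invertible }

  isBinomialFamily : B.IsBinomialFamily binom falling
  isBinomialFamily = record
    { falling-zero = λ b → residuewise λ k → ≡⇒mod k refl
    ; falling-suc  = λ b n → residuewise λ k → ≡⇒mod k
        (cong (λ z → residue (falling b n) k ℤ.* (residue b k ℤ.- z)) (sym (residue-fromℕ n k)))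
    ; binom-!      = λ b n → residuewise λ k → subst
        (λ z → residue (binom b n) k ℤ.* z ≡ residue (falling b n) k [mod-ℓ^ k ])
        (sym (residue-fromℕ (n !) k)) (congruent (binom-spec b n) k)
    }

-- Characteristic series of the two families

module CharacteristicSeries (ℓ : ℕ) (ℓ-prime : Prime ℓ) where

  open Adic ℓ using (_≡_[mod-ℓ^_]; residue; residuewise; ≡⇒mod; congruent; ℤₗ-commutativeRing)
  open Voltage ℓ ℓ-prime
  open AdicProperties ℓ ℓ-prime
  open CompleteGraphDeterminant ℤₗ-commutativeRing using (fromℕ)
  open TwistedCompleteGraph ℤₗ-commutativeRing

  laplacian-diagonal : ∀ {u} (v : VoltageAssignment u) i →
    voltageLaplacian v i i ≡ constant (ι (+ u ℤ.- 1ℤ))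
  laplacian-diagonal v i with Fin.<-cmp i i
  ... | tri≈ _ _ _   = refl
  ... | tri< _ i≢i _ = contradiction refl i≢i
  ... | tri> _ i≢i _ = contradiction refl i≢i

  constant-fromℕ : ∀ n k → constant (ι (+ n)) k Z.≈ constant (fromℕ n) k
  constant-fromℕ n zero    = residuewise λ k → ≡⇒mod k (sym (residue-fromℕ n k))
  constant-fromℕ n (suc k) = residuewise λ k → ≡⇒mod k refl

  laplacian-constant : ∀ {m} (v : VoltageAssignment (3 ℕ.+ m)) i →
    IsConstantEntry (2 ℕ.+ m) (voltageLaplacian v i i)
  laplacian-constant {m} v i = subst (IsConstantEntry (2 ℕ.+ m)) (sym (laplacian-diagonal v i))
    record { entry = constant-fromℕ (2 ℕ.+ m) }

  laplacian-forward : ∀ {u} (v : VoltageAssignment u) i j (i<j : i Fin.< j) {x} → v i j i<j ≡ x →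
    IsForwardEntry binom x (voltageLaplacian v i j)
  laplacian-forward v i j i<j refl with Fin.<-cmp i j
  ... | tri< _ _ _   = record { entry = λ n → residuewise λ k → ≡⇒mod k refl }
  ... | tri≈ i≮j _ _ = contradiction i<j i≮j
  ... | tri> i≮j _ _ = contradiction i<j i≮j

  laplacian-backward : ∀ {u} (v : VoltageAssignment u) i j (j<i : j Fin.< i) {x} → v j i j<i ≡ x →
    IsBackwardEntry binom x (voltageLaplacian v i j)
  laplacian-backward v i j j<i refl with Fin.<-cmp i j
  ... | tri> _ _ _   = record { entry = λ n → residuewise λ k → ≡⇒mod k refl }
  ... | tri≈ _ _ i≯j = contradiction j<i i≯j
  ... | tri< _ _ i≯j = contradiction j<i i≯j

  -- Neither vertex is the first, so both families assign voltage 0. The entry of a reversed edge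
  -- has exponent -0, which is why the witness `b` depends on the orientation.
  laplacian-offDiagonal : ∀ γ a m i j → i ≢ j →
    IsTrivialEntry binom (voltageLaplacian (voltage γ a (3 ℕ.+ m)) (Fin.suc i) (Fin.suc j))
  laplacian-offDiagonal γ a m i j i≢j with Fin.<-cmp i j
  ... | tri≈ _ i≡j _ = contradiction i≡j i≢j
  laplacian-offDiagonal α  a m i j i≢j | tri< _ _ _ = record
    { b = Z.0# ; b≈0 = residuewise λ k → ≡⇒mod k refl ; entry = λ n → residuewise λ k → ≡⇒mod k refl }
  laplacian-offDiagonal α′ a m i j i≢j | tri< _ _ _ = record
    { b = Z.0# ; b≈0 = residuewise λ k → ≡⇒mod k refl ; entry = λ n → residuewise λ k → ≡⇒mod k refl }
  laplacian-offDiagonal α  a m i j i≢j | tri> _ _ _ = record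
    { b = Z.- Z.0# ; b≈0 = residuewise λ k → ≡⇒mod k refl ; entry = λ n → residuewise λ k → ≡⇒mod k refl }
  laplacian-offDiagonal α′ a m i j i≢j | tri> _ _ _ = record
    { b = Z.- Z.0# ; b≈0 = residuewise λ k → ≡⇒mod k refl ; entry = λ n → residuewise λ k → ≡⇒mod k refl }

  isTwisted : ∀ {m} (v : VoltageAssignment (3 ℕ.+ m)) t {b c} →
    v Fin.zero (Fin.suc t) ℕ.z<s ≡ b → (∀ j → v Fin.zero (Fin.suc (punchIn t j)) ℕ.z<s ≡ c) →
    (∀ i j → i ≢ j → IsTrivialEntry binom (voltageLaplacian v (Fin.suc i) (Fin.suc j))) →
    IsTwistedLaplacian binom {m} t b c (voltageLaplacian v)
  isTwisted v t eq eq′ offDiagonal = record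
    { diagonal    = laplacian-constant v
    ; row-t       = laplacian-forward v Fin.zero (Fin.suc t) ℕ.z<s eq
    ; column-t    = laplacian-backward v (Fin.suc t) Fin.zero ℕ.z<s eq
    ; row         = λ j → laplacian-forward v Fin.zero (Fin.suc (punchIn t j)) ℕ.z<s (eq′ j)
    ; column      = λ j → laplacian-backward v (Fin.suc (punchIn t j)) Fin.zero ℕ.z<s (eq′ j)
    ; offDiagonal = offDiagonal
    }

  isTwisted-α : ∀ a m →
    IsTwistedLaplacian binom {m} Fin.zero a Z.0# (voltageLaplacian (voltage α a (3 ℕ.+ m)))
  isTwisted-α a m = isTwisted (voltage α a (3 ℕ.+ m)) Fin.zero refl (λ _ → refl) (laplacian-offDiagonal α a m)

  -- Only the edge from v₁ to v_u has voltage 0, so this edge is the exceptional one and a is the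
  -- common voltage, the reverse of α. The vertex v_u has index u - 1 and is the only one to fail
  -- the test `suc (toℕ j) ≤ u ∸ 1`.
  isTwisted-α′ : ∀ a m →
    IsTwistedLaplacian binom {m} (Fin.fromℕ (suc m)) Z.0# a (voltageLaplacian (voltage α′ a (3 ℕ.+ m)))
  isTwisted-α′ a m = isTwisted (voltage α′ a (3 ℕ.+ m)) (Fin.fromℕ (suc m))
    (cong (if_then a else Z.0#) (dec-false (2 ℕ.+ toℕ (Fin.fromℕ (suc m)) ℕ.≤? 2 ℕ.+ m) λ p →
      ℕ.1+n≰n (subst (λ n → 2 ℕ.+ n ℕ.≤ 2 ℕ.+ m) (Fin.toℕ-fromℕ (suc m)) p)))
    (λ j → cong (if_then a else Z.0#)
      (dec-true (2 ℕ.+ toℕ (punchIn (Fin.fromℕ (suc m)) j) ℕ.≤? 2 ℕ.+ m) (s≤s (punchIn-last-< j))))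
    (laplacian-offDiagonal α′ a m)
    where
    punchIn-last-< : ∀ {n} (j : Fin n) → toℕ (punchIn (Fin.fromℕ n) j) ℕ.< n
    punchIn-last-< Fin.zero    = s≤s z≤n
    punchIn-last-< (Fin.suc j) = s≤s (punchIn-last-< j)

  -- The number of vertices is a variable here, which keeps the determinants from unfolding.
  fromDet : ∀ γ a u N → DetIsSquareMultiple N (voltageLaplacian (voltage γ a u)) →
    IsSquareMultiple N (characteristicSeries (voltage γ a u))
  fromDet γ a u N = DetIsSquareMultiple.isSquareMultiple

  characteristicSeries-isSquareMultiple : ∀ γ {a} → IsUnit a → ∀ u → 3 ℕ.≤ u →
    IsSquareMultiple (u ℕ.^ (u ∸ 3) ℕ.* (u ∸ 2)) (characteristicSeries (voltage γ a u))
  characteristicSeries-isSquareMultiple γ {a} (a⁻¹ RawMagma., a⁻¹a≈1) u 3≤u =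
    fromDet γ a u (u ℕ.^ (u ∸ 3) ℕ.* (u ∸ 2))
      (subst (λ u → DetIsSquareMultiple (u ℕ.^ (u ∸ 3) ℕ.* (u ∸ 2)) (voltageLaplacian (voltage γ a u)))
        (ℕ.m+[n∸m]≡n 3≤u) (twisted γ (u ∸ 3)))
    where
    aa⁻¹≈1 : a Z.* a⁻¹ Z.≈ Z.1#
    aa⁻¹≈1 = residuewise λ k → subst (λ z → z ≡ 1ℤ [mod-ℓ^ k ])
      (ℤ.*-comm (residue a⁻¹ k) (residue a k)) (congruent a⁻¹a≈1 k)
    twisted : ∀ γ m → DetIsSquareMultiple ((3 ℕ.+ m) ℕ.^ m ℕ.* suc m) (voltageLaplacian (voltage γ a (3 ℕ.+ m)))
    twisted α m = det-isSquareMultiple ℤₗ-torsionFree isBinomialFamily {m} {Fin.zero} {a} {a⁻¹}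
      {voltageLaplacian (voltage α a (3 ℕ.+ m))} aa⁻¹≈1 (inj₁ (isTwisted-α a m))
    twisted α′ m = det-isSquareMultiple ℤₗ-torsionFree isBinomialFamily {m} {Fin.fromℕ (suc m)} {a} {a⁻¹}
      {voltageLaplacian (voltage α′ a (3 ℕ.+ m))} aa⁻¹≈1 (inj₂ (isTwisted-α′ a m))

-- Invariants read off from the exact power of ℓ

module Invariants (ℓ : ℕ) (ℓ-prime : Prime ℓ) where

  open Adic ℓ using (_≡_[mod-ℓ^_]; residue; residuewise; ≡⇒mod; congruent; ℤₗ-commutativeRing; ℤₗ-rawRing)
  open Voltage ℓ ℓ-prime
  open AdicProperties ℓ ℓ-prime
  open CompleteGraphDeterminant ℤₗ-commutativeRing using (fromℕ)
  open TwistedCompleteGraph ℤₗ-commutativeRing using (IsSquareMultiple)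
  private
    instance
      _ = prime⇒nonZero ℓ-prime
    module S = CommutativeRing (PowerSeriesRing.powerSeries-commutativeRing ℤₗ-commutativeRing)
    module S^ = RawSemiringDefs (Semiring.rawSemiring S.semiring)
  open Weierstrass ℤₗ-commutativeRing ℓ

  module ℤ⟦T⟧ = RawRing (PowerSeries.powerSeries ℤ.+-*-rawRing)
  open import Algebra.Definitions.RawMonoid ℤ.+-0-rawMonoid using () renaming (sum to sumℤ)

  residues : ℤₗ⟦T⟧ → ℕ → ℕ → ℤ
  residues f k n = residue (f n) k

  residue-sum : ∀ {n} k (w : Fin n → ℤₗ) {v : Fin n → ℤ} → (∀ i → residue (w i) k ≡ v i) →
    residue (foldr Z._+_ Z.0# w) k ≡ sumℤ v
  residue-sum {zero}  k w eq = refl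
  residue-sum {suc n} k w eq = cong₂ ℤ._+_ (eq Fin.zero) (residue-sum k (w ∘ Fin.suc) (eq ∘ Fin.suc))

  -- Voltage multiplies series in a private copy of the raw ring.  Unifying w and w′ with the
  -- summands of that product leaves only integers to compare, whereas comparing products of
  -- elements of ℤₗ would compare their coherence proofs.
  residue-product : ∀ (A g U : ℤₗ⟦T⟧) n k {x} {w : Fin n → ℤₗ} {w′ : ∀ i → Fin (toℕ i) → ℤₗ} →
    x ≡ (residue (A 0) k ℤ.* residue (g 0) k ℤ.+ 0ℤ) ℤ.* residue (U n) k
        ℤ.+ residue (foldr Z._+_ Z.0# w) k →
    (∀ i → residue (w i) k ≡
      (residue (A 0) k ℤ.* residue (g (suc (toℕ i))) k ℤ.+
        (residue (A 1) k ℤ.* residue (g (toℕ i)) k ℤ.+ residue (foldr Z._+_ Z.0# (w′ i)) k))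
      ℤ.* residue (U (n ∸ suc (toℕ i))) k) →
    (∀ i j → residue (w′ i j) k ≡
      residue (A (suc (suc (toℕ j)))) k ℤ.* residue (g (toℕ i ∸ suc (toℕ j))) k) →
    x ≡ (residues A k ℤ⟦T⟧.* residues g k ℤ⟦T⟧.* residues U k) n
  residue-product A g U n k {w = w} {w′} x≡ w≡ w′≡ = trans x≡
    (cong (λ z → (residue (A 0) k ℤ.* residue (g 0) k ℤ.+ 0ℤ) ℤ.* residue (U n) k ℤ.+ z)
      (residue-sum k w λ i → trans (w≡ i) (cong (λ z →
        (residue (A 0) k ℤ.* residue (g (suc (toℕ i))) k ℤ.+
          (residue (A 1) k ℤ.* residue (g (toℕ i)) k ℤ.+ z)) ℤ.* residue (U (n ∸ suc (toℕ i))) k)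
        (residue-sum k (w′ i) (w′≡ i)))))

  mod-subst : ∀ {k x y z} → x ≡ y [mod-ℓ^ k ] → y ≡ z → x ≡ z [mod-ℓ^ k ]
  mod-subst p refl = p

  ι≈fromℕ : ∀ n → ι (+ n) Z.≈ fromℕ n
  ι≈fromℕ n = residuewise λ k → ≡⇒mod k (sym (residue-fromℕ n k))

  module _ {f : ℤₗ⟦T⟧} {μ : ℕ} where

    private
      L : ℤₗ⟦T⟧
      L = constant (ι (+ ℓ)) S^.^ μ

    fromHasInvariants : ∀ {λ′} (H : HasInvariants f μ λ′) →
      Factorisation (ι (+ ℓ)) f μ (HasInvariants.deg-g H)
    fromHasInvariants H = record
      { g             = g
      ; U             = U
      ; U⁻¹           = U⁻¹
      ; monic         = residuewise λ k → congruent monic k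
      ; degree        = λ n d<n → residuewise λ k → congruent (degree n d<n) k
      ; ℓ∣coeffs      = λ n n<d → quotient (ℓ∣coeffs n n<d) , residuewise λ k → congruent (equality (ℓ∣coeffs n n<d)) k
      ; inverse       = λ n → residuewise λ k → congruent (equality unit n) k
      ; factorisation = record { product = λ n → residuewise λ k →
          mod-subst (congruent (factorisation n) k)
            (trans {j = (residues L k ℤ⟦T⟧.* residues g k ℤ⟦T⟧.* residues U k) n}
              (residue-product L g U n k refl (λ _ → refl) (λ _ _ → refl))
              (sym (residue-product L g U n k refl (λ _ → refl) (λ _ _ → refl)))) }
      }
      where
      open HasInvariants H
      open IsDistinguished distinguished
      open RawMagma._∣ʳ_
      U⁻¹ : ℤₗ⟦T⟧
      U⁻¹ = quotient unit

    toHasInvariants : Factorisation (ι (+ ℓ)) f μ 2 → HasInvariants f μ (+ 1)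
    toHasInvariants F = record
      { g             = g
      ; U             = U
      ; deg-g         = 2
      ; distinguished = record
        { monic    = residuewise λ k → congruent monic k
        ; degree   = λ n d<n → residuewise λ k → congruent (degree n d<n) k
        ; ℓ∣coeffs = λ n n<d → proj₁ (ℓ∣coeffs n n<d) , residuewise λ k → congruent (proj₂ (ℓ∣coeffs n n<d)) k
        }
      ; unit          = U⁻¹ , λ n → residuewise λ k → congruent (inverse n) k
      ; factorisation = λ n → residuewise λ k →
          mod-subst (congruent (IsProduct.product factorisation n) k)
            (trans {j = (residues L k ℤ⟦T⟧.* residues g k ℤ⟦T⟧.* residues U k) n}
              (residue-product L g U n k refl (λ _ → refl) (λ _ _ → refl))
              (sym (residue-product L g U n k refl (λ _ → refl) (λ _ _ → refl))))
      ; λ≡deg-1       = refl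
      }
      where
      open Factorisation F
      open RawMagma using (_,_)

  invariants-unique : ∀ {N f μ λ′} → IsSquareMultiple N f → HasInvariants f μ λ′ →
    λ′ ≡ + 1 × ℓ ℕ.^ μ ℕ.∣ N × ℓ ℕ.^ suc μ ℕ.∤ N
  invariants-unique {N} {f} {μ} Q H =
    let d≡2 , p , q = factorisation-unique adicLike {ι (+ ℓ)} (ι≈fromℕ ℓ) ℓ∤1 {N} {f} {μ} Q (fromHasInvariants H)
    in trans (HasInvariants.λ≡deg-1 H) (cong (λ d → + d ℤ.- 1ℤ) d≡2) , p , q
    where
    ℓ∤1 : ℓ ℕ.∤ 1
    ℓ∤1 p = ℕ.<⇒≱ (ℕ.nonTrivial⇒n>1 ℓ {{prime⇒nonTrivial ℓ-prime}}) (ℕ.∣⇒≤ p)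

  invariants-exist : ∀ {N f μ} → IsSquareMultiple N f →
    ℓ ℕ.^ μ ℕ.∣ N → ℓ ℕ.^ suc μ ℕ.∤ N → HasInvariants f μ (+ 1)
  invariants-exist {N} {f} {μ} Q p q =
    toHasInvariants (factorisation-exists adicLike {ι (+ ℓ)} (ι≈fromℕ ℓ) {N} {f} {μ} Q p q)

-- Counting

lookup-injective : ∀ {xs : List ℕ} → Unique xs → ∀ {i j} → lookup xs i ≡ lookup xs j → i ≡ j
lookup-injective (x∉ ∷ u) {Fin.zero}  {Fin.zero}  eq = refl
lookup-injective (x∉ ∷ u) {Fin.zero}  {Fin.suc j} eq = contradiction eq (All.lookup x∉ (∈-lookup j))
lookup-injective (x∉ ∷ u) {Fin.suc i} {Fin.zero}  eq = contradiction (sym eq) (All.lookup x∉ (∈-lookup i))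
lookup-injective (x∉ ∷ u) {Fin.suc i} {Fin.suc j} eq = cong Fin.suc (lookup-injective u eq)

-- Two pigeonhole arguments. If u satisfies P, the numbers 0, ..., u inject into the listing. If u
-- is not listed, all listed values lie below u, so the listing has at most u entries. Only
-- membership in the list is decided, never P itself.
card-downwardClosed : ∀ {P : Pred ℕ 0ℓ} → (∀ {u v} → v ℕ.≤ u → P u → P v) →
  ∀ {m} → HasCard P m → ∀ u → P u ⇔ u ℕ.< m
card-downwardClosed {P} closed (us , unique , ∈⇔ , refl) u = mk⇔ bounded member
  where
  bounded : P u → u ℕ.< length us
  bounded Pu = Fin.injective⇒≤ {f = position} λ {i} {j} eq → Fin.toℕ-injective
    (trans (lookup-index (found i)) (trans (cong (lookup us) eq) (sym (lookup-index (found j)))))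
    where
    found : ∀ (i : Fin (suc u)) → toℕ i ∈ us
    found i = Equivalence.from (∈⇔ (toℕ i)) (closed (ℕ.≤-pred (Fin.toℕ<n i)) Pu)
    position : Fin (suc u) → Fin (length us)
    position i = index (found i)
  member : u ℕ.< length us → P u
  member u<m with u ∈? us
  ... | yes u∈us = Equivalence.to (∈⇔ u) u∈us
  ... | no  u∉us = contradiction (Fin.injective⇒≤ {f = value} λ {i} {j} eq →
      lookup-injective unique (trans (sym (Fin.toℕ-fromℕ< (small i)))
        (trans (cong toℕ eq) (Fin.toℕ-fromℕ< (small j)))))
      (ℕ.<⇒≱ u<m)
    where
    small : ∀ i → lookup us i ℕ.< u
    small i = ℕ.≰⇒> λ u≤ → u∉us (Equivalence.from (∈⇔ u)
      (closed u≤ (Equivalence.to (∈⇔ (lookup us i)) (∈-lookup i))))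
    value : Fin (length us) → Fin u
    value i = fromℕ< (small i)

𝒜≤-downwardClosed : ∀ x {u v} → v ℕ.≤ u → 𝒜≤ x u → 𝒜≤ x v
𝒜≤-downwardClosed x {u} {v} v≤u u≤x n = ℚ.≤-trans (ℚ.toℚᵘ-cancel-≤
  (ℚᵘ.≤-respˡ-≃ (ℚᵘ.≃-sym (ℚ.toℚᵘ-fromℚᵘ (mkℚᵘ (+ v) 0)))
    (ℚᵘ.≤-respʳ-≃ (ℚᵘ.≃-sym (ℚ.toℚᵘ-fromℚᵘ (mkℚᵘ (+ u) 0)))
      (ℚᵘ.*≤* (ℤ.*-monoʳ-≤-nonNeg 1ℤ (ℤ.+≤+ v≤u)))))) (u≤x n)

χ : ∀ {A : Set} → Dec A → ℕ
χ (yes _) = 1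
χ (no  _) = 0

χ-yes : ∀ {A : Set} (A? : Dec A) → A → χ A? ≡ 1
χ-yes (yes _)  a = refl
χ-yes (no  ¬a) a = contradiction a ¬a

χ-no : ∀ {A : Set} (A? : Dec A) → ¬ A → χ A? ≡ 0
χ-no (yes a) ¬a = contradiction a ¬a
χ-no (no  _) ¬a = refl

χ-cong : ∀ {A B : Set} (A? : Dec A) (B? : Dec B) → (A → B) → (B → A) → χ A? ≡ χ B?
χ-cong A? (yes b) f g = χ-yes A? (g b)
χ-cong A? (no ¬b) f g = χ-no A? (¬b ∘ f)

count : ∀ {P : Pred ℕ 0ℓ} → Decidable P → ℕ → ℕ
count P? m = length (filter P? (downFrom m))

count-suc : ∀ {P : Pred ℕ 0ℓ} (P? : Decidable P) m → count P? (suc m) ≡ χ (P? m) ℕ.+ count P? m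
count-suc P? m with P? m
... | yes _ = refl
... | no  _ = refl

count≤ : ∀ {P : Pred ℕ 0ℓ} (P? : Decidable P) m → count P? m ℕ.≤ m
count≤ P? zero    = z≤n
count≤ P? (suc m) rewrite count-suc P? m with P? m
... | yes _ = s≤s (count≤ P? m)
... | no  _ = ℕ.m≤n⇒m≤1+n (count≤ P? m)

hasCard-count : ∀ {P Q : Pred ℕ 0ℓ} (P? : Decidable P) m → (∀ u → Q u ⇔ (u ℕ.< m × P u)) →
  HasCard Q (count P? m)
hasCard-count P? m Q⇔ = filter P? (downFrom m) , filter⁺ P? (downFrom⁺ m) , (λ u → mk⇔
    (λ u∈ → let u∈′ , Pu = ∈-filter⁻ P? u∈ in Equivalence.from (Q⇔ u) (∈-downFrom⁻ u∈′ , Pu))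
    (λ Qu → let u<m , Pu = Equivalence.to (Q⇔ u) Qu in ∈-filter⁺ P? (∈-downFrom⁺ u<m) Pu))
  , refl

windowSum : (ℕ → ℕ) → ℕ → ℕ → ℕ
windowSum f s zero    = 0
windowSum f s (suc n) = f (s ℕ.+ n) ℕ.+ windowSum f s n

count-window : ∀ {P : Pred ℕ 0ℓ} (P? : Decidable P) s n →
  count P? (s ℕ.+ n) ≡ windowSum (χ ∘ P?) s n ℕ.+ count P? s
count-window P? s zero    = cong (count P?) (ℕ.+-identityʳ s)
count-window P? s (suc n) = begin
  count P? (s ℕ.+ suc n)                                     ≡⟨ cong (count P?) (ℕ.+-suc s n) ⟩
  count P? (suc (s ℕ.+ n))                                   ≡⟨ count-suc P? (s ℕ.+ n) ⟩
  χ (P? (s ℕ.+ n)) ℕ.+ count P? (s ℕ.+ n)                    ≡⟨ cong (χ (P? (s ℕ.+ n)) ℕ.+_) (count-window P? s n) ⟩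
  χ (P? (s ℕ.+ n)) ℕ.+ (windowSum (χ ∘ P?) s n ℕ.+ count P? s) ≡⟨ ℕ.+-assoc (χ (P? (s ℕ.+ n))) _ _ ⟨
  windowSum (χ ∘ P?) s (suc n) ℕ.+ count P? s                ∎
  where open ≡-Reasoning

windowSum-cong : ∀ {f g} s n → (∀ i → f (s ℕ.+ i) ≡ g (s ℕ.+ i)) → windowSum f s n ≡ windowSum g s n
windowSum-cong s zero    eq = refl
windowSum-cong s (suc n) eq = cong₂ ℕ._+_ (eq n) (windowSum-cong s n eq)

windowSum-+ : ∀ f g s n → windowSum (λ u → f u ℕ.+ g u) s n ≡ windowSum f s n ℕ.+ windowSum g s n
windowSum-+ f g s zero    = refl
windowSum-+ f g s (suc n) = trans (cong (f (s ℕ.+ n) ℕ.+ g (s ℕ.+ n) ℕ.+_) (windowSum-+ f g s n))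
  (lem (f (s ℕ.+ n)) (g (s ℕ.+ n)) _ _)
  where
  lem : ∀ a b c d → a ℕ.+ b ℕ.+ (c ℕ.+ d) ≡ a ℕ.+ c ℕ.+ (b ℕ.+ d)
  lem = ℕ-Solver.solve-∀

windowSum-split : ∀ f s m n → windowSum f s (m ℕ.+ n) ≡ windowSum f s m ℕ.+ windowSum f (s ℕ.+ m) n
windowSum-split f s m zero    = trans (cong (windowSum f s) (ℕ.+-identityʳ m)) (sym (ℕ.+-identityʳ _))
windowSum-split f s m (suc n) = begin
  windowSum f s (m ℕ.+ suc n)                                          ≡⟨ cong (windowSum f s) (ℕ.+-suc m n) ⟩
  f (s ℕ.+ (m ℕ.+ n)) ℕ.+ windowSum f s (m ℕ.+ n)                      ≡⟨ cong₂ (λ u z → f u ℕ.+ z) (sym (ℕ.+-assoc s m n)) (windowSum-split f s m n) ⟩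
  f (s ℕ.+ m ℕ.+ n) ℕ.+ (windowSum f s m ℕ.+ windowSum f (s ℕ.+ m) n)  ≡⟨ lem (f (s ℕ.+ m ℕ.+ n)) (windowSum f s m) (windowSum f (s ℕ.+ m) n) ⟩
  windowSum f s m ℕ.+ windowSum f (s ℕ.+ m) (suc n)                    ∎
  where
  open ≡-Reasoning
  lem : ∀ a b c → a ℕ.+ (b ℕ.+ c) ≡ b ℕ.+ (a ℕ.+ c)
  lem = ℕ-Solver.solve-∀

windowSum-shift : ∀ f t s n → windowSum (λ u → f (t ℕ.+ u)) s n ≡ windowSum f (t ℕ.+ s) n
windowSum-shift f t s zero    = refl
windowSum-shift f t s (suc n) = cong₂ ℕ._+_ (cong f (sym (ℕ.+-assoc t s n))) (windowSum-shift f t s n)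

-- Sliding the window by one step trades f s for f (s + p): both come from splitting the window of
-- length p + 1, at its start and at its end.
windowSum-periodic : ∀ f p → (∀ u → f (u ℕ.+ p) ≡ f u) → ∀ s → windowSum f s p ≡ windowSum f 0 p
windowSum-periodic f p periodic zero    = refl
windowSum-periodic f p periodic (suc s) = trans (ℕ.+-cancelˡ-≡ (f s) _ _ (begin
  f s ℕ.+ windowSum f (suc s) p
    ≡⟨ cong₂ ℕ._+_ (trans (sym (ℕ.+-identityʳ _)) (cong (λ u → f u ℕ.+ 0) (sym (ℕ.+-identityʳ s)))) (cong (λ u → windowSum f u p) (ℕ.+-comm 1 s)) ⟩
  windowSum f s 1 ℕ.+ windowSum f (s ℕ.+ 1) p
    ≡⟨ windowSum-split f s 1 p ⟨
  f (s ℕ.+ p) ℕ.+ windowSum f s p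
    ≡⟨ cong (ℕ._+ windowSum f s p) (periodic s) ⟩
  f s ℕ.+ windowSum f s p ∎)) (windowSum-periodic f p periodic s)
  where open ≡-Reasoning

-- By periodicity the window may start at 0, and 0 is the only multiple of d below d.
multiples : ∀ d s → .{{NonZero d}} → windowSum (λ u → χ (d ℕ.∣? u)) s d ≡ 1
multiples d s = trans (windowSum-periodic f d periodic s) (base d ℕ.≤-refl)
  where
  f : ℕ → ℕ
  f u = χ (d ℕ.∣? u)
  periodic : ∀ u → f (u ℕ.+ d) ≡ f u
  periodic u = χ-cong (d ℕ.∣? (u ℕ.+ d)) (d ℕ.∣? u)
    (λ p → ℕ.∣m+n∣m⇒∣n (subst (d ℕ.∣_) (ℕ.+-comm u d) p) ℕ.∣-refl) (λ p → ℕ.∣m∣n⇒∣m+n p ℕ.∣-refl)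
  base : ∀ n → n ℕ.≤ d → .{{NonZero n}} → windowSum f 0 n ≡ 1
  base (suc zero)    n≤d = trans (ℕ.+-identityʳ _) (χ-yes (d ℕ.∣? 0) (d ℕ.∣0))
  base (suc (suc n)) n≤d = cong₂ ℕ._+_
    (χ-no (d ℕ.∣? suc n) (λ p → ℕ.<⇒≱ n≤d (ℕ.∣⇒≤ p)))
    (base (suc n) (ℕ.≤-trans (ℕ.n≤1+n (suc n)) n≤d))

multiples-* : ∀ d c s → .{{NonZero d}} → windowSum (λ u → χ (d ℕ.∣? u)) s (c ℕ.* d) ≡ c
multiples-* d zero    s = refl
multiples-* d (suc c) s = trans (windowSum-split _ s d (c ℕ.* d))
  (cong₂ ℕ._+_ (multiples d s) (multiples-* d c (s ℕ.+ d)))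

-- If F gains k over every period p beyond b, then F(m) p - m k is eventually periodic.
density-bound : ∀ (F : ℕ → ℕ) b p k → .{{NonZero p}} → k ℕ.≤ p → (∀ m → F m ℕ.≤ m) →
  (∀ m → b ℕ.≤ m → F (m ℕ.+ p) ≡ k ℕ.+ F m) →
  ∀ m → ℤ.∣ F m ℕ.* p ⊖ m ℕ.* k ∣ ℕ.≤ (b ℕ.+ p) ℕ.* p
density-bound F b p k k≤p F≤ step = <-rec _ go
  where
  go : ∀ m → (∀ {i} → i ℕ.< m → ℤ.∣ F i ℕ.* p ⊖ i ℕ.* k ∣ ℕ.≤ (b ℕ.+ p) ℕ.* p) →
       ℤ.∣ F m ℕ.* p ⊖ m ℕ.* k ∣ ℕ.≤ (b ℕ.+ p) ℕ.* p
  go m rec with m ℕ.<? b ℕ.+ p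
  -- Both F m · p and m · k are at most m · p here, which is the origin of the bound; beyond b + p,
  -- descending by one period leaves the difference unchanged.
  ... | yes m<b+p = ℕ.≤-trans (ℤ.∣m⊝n∣≤m⊔n (F m ℕ.* p) (m ℕ.* k)) (ℕ.⊔-lub
    (ℕ.*-monoˡ-≤ p (ℕ.≤-trans (F≤ m) (ℕ.<⇒≤ m<b+p))) (ℕ.*-mono-≤ (ℕ.<⇒≤ m<b+p) k≤p))
  ... | no  m≮b+p = subst (λ m → ℤ.∣ F m ℕ.* p ⊖ m ℕ.* k ∣ ℕ.≤ (b ℕ.+ p) ℕ.* p) m′+p≡m
    (subst (ℕ._≤ (b ℕ.+ p) ℕ.* p) (cong ℤ.∣_∣ eq) (rec m′<m))
    where
    b+p≤m : b ℕ.+ p ℕ.≤ m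
    b+p≤m = ℕ.≮⇒≥ m≮b+p
    m′ : ℕ
    m′ = m ∸ p
    m′+p≡m : m′ ℕ.+ p ≡ m
    m′+p≡m = ℕ.m∸n+n≡m (ℕ.≤-trans (ℕ.m≤n+m p b) b+p≤m)
    b≤m′ : b ℕ.≤ m′
    b≤m′ = subst (ℕ._≤ m′) (ℕ.m+n∸n≡m b p) (ℕ.∸-monoˡ-≤ p b+p≤m)
    m′<m : m′ ℕ.< m
    m′<m = subst (m′ ℕ.<_) m′+p≡m (ℕ.m<m+n m′ (ℕ.>-nonZero⁻¹ p))
    eq : F m′ ℕ.* p ⊖ m′ ℕ.* k ≡ F (m′ ℕ.+ p) ℕ.* p ⊖ (m′ ℕ.+ p) ℕ.* k
    eq = trans (sym (ℤ.+-cancelˡ-⊖ (k ℕ.* p) (F m′ ℕ.* p) (m′ ℕ.* k)))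
      (cong₂ _⊖_ (trans (sym (ℕ.*-distribʳ-+ p k (F m′))) (cong (ℕ._* p) (sym (step m′ b≤m′))))
                 (trans (cong (ℕ._+ m′ ℕ.* k) (ℕ.*-comm k p)) (trans (ℕ.+-comm (p ℕ.* k) (m′ ℕ.* k)) (sym (ℕ.*-distribʳ-+ k m′ p)))))

-- The distance is |n p - m k| / (m p), at most K / m. A positive ε is at least the reciprocal of
-- its denominator, so m > K · `↧ₙ ε` suffices.
ratio-close : ∀ n m k p K ε .{{_ : NonZero m}} .{{_ : NonZero p}} → 0ℚ ℚ.< ε →
  ℤ.∣ n ℕ.* p ⊖ m ℕ.* k ∣ ℕ.≤ K → K ℕ.* ℚ.↧ₙ ε ℕ.< m →
  ℚ.∣ (+ n ℚ./ m) ℚ.- (+ k ℚ./ p) ∣ ℚ.< ε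
ratio-close n (suc m) k (suc p) K ε 0<ε close K<m = ℚ.toℚᵘ-cancel-<
  (ℚᵘ.<-respˡ-≃ (ℚᵘ.≃-sym lhs) (small ε 0<ε K<m))
  where
  d : ℚᵘ
  d = mkℚᵘ (+ n) m ℚᵘ.- mkℚᵘ (+ k) p
  lhs : ℚ.toℚᵘ ℚ.∣ (+ n ℚ./ suc m) ℚ.- (+ k ℚ./ suc p) ∣ ℚᵘ.≃ ℚᵘ.∣ d ∣
  lhs = ℚᵘ.≃-trans (ℚ.toℚᵘ-homo-∣-∣ ((+ n ℚ./ suc m) ℚ.- (+ k ℚ./ suc p)))
    (ℚᵘ.∣-∣-cong (ℚᵘ.≃-trans (ℚ.toℚᵘ-homo-+ (+ n ℚ./ suc m) (ℚ.- (+ k ℚ./ suc p)))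
      (ℚᵘ.+-cong (ℚ.toℚᵘ-fromℚᵘ (mkℚᵘ (+ n) m))
        (ℚᵘ.≃-trans (ℚ.toℚᵘ-homo‿- (+ k ℚ./ suc p)) (ℚᵘ.-‿cong (ℚ.toℚᵘ-fromℚᵘ (mkℚᵘ (+ k) p)))))))
  ↥d : ℚᵘ.↥ d ≡ n ℕ.* suc p ⊖ suc m ℕ.* k
  ↥d = trans (cong₂ ℤ._+_ (sym (ℤ.pos-* n (suc p)))
         (trans (sym (ℤ.neg-distribˡ-* (+ k) (+ suc m))) (cong ℤ.-_ (trans (sym (ℤ.pos-* k (suc m))) (cong +_ (ℕ.*-comm k (suc m)))))))
         (ℤ.[+m]-[+n]≡m⊖n (n ℕ.* suc p) (suc m ℕ.* k))
  small : ∀ ε → 0ℚ ℚ.< ε → K ℕ.* ℚ.↧ₙ ε ℕ.< suc m → ℚᵘ.∣ d ∣ ℚᵘ.< ℚ.toℚᵘ ε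
  small (mkℚ (+ zero)  q c) (ℚ.*<* (ℤ.+<+ ())) _
  small (mkℚ (+ suc e) q c) _ K<m = ℚᵘ.*<* (subst₂ ℤ._<_ (ℤ.pos-* ℤ.∣ ℚᵘ.↥ d ∣ (suc q)) (ℤ.pos-* (suc e) (suc m ℕ.* suc p))
    (ℤ.+<+ (begin-strict
      ℤ.∣ ℚᵘ.↥ d ∣ ℕ.* suc q                       ≡⟨ cong (λ z → ℤ.∣ z ∣ ℕ.* suc q) ↥d ⟩
      ℤ.∣ n ℕ.* suc p ⊖ suc m ℕ.* k ∣ ℕ.* suc q    ≤⟨ ℕ.*-monoˡ-≤ (suc q) close ⟩
      K ℕ.* suc q                                  <⟨ K<m ⟩
      suc m                                        ≤⟨ ℕ.m≤m*n (suc m) (suc p) ⟩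
      suc m ℕ.* suc p                              ≤⟨ ℕ.m≤n*m (suc m ℕ.* suc p) (suc e) ⟩
      suc e ℕ.* (suc m ℕ.* suc p)                  ∎)))
    where open ℕ.≤-Reasoning

-- Exact divisibility by powers of ℓ

module ExactPower (ℓ : ℕ) (ℓ-prime : Prime ℓ) (ℓ≢2 : ℓ ≢ 2) where

  open Binomial ℓ ℓ-prime using (^-mono-∣; cancel-unit)

  private instance
    _ = prime⇒nonZero ℓ-prime
    _ = prime⇒nonTrivial ℓ-prime

  2<ℓ : 2 ℕ.< ℓ
  2<ℓ = ℕ.≤∧≢⇒< (ℕ.nonTrivial⇒n>1 ℓ) (ℓ≢2 ∘ sym)

  magnitude : ℕ → ℕ
  magnitude u = u ℕ.^ (u ∸ 3) ℕ.* (u ∸ 2)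

  Exact : ℕ → Pred ℕ 0ℓ
  Exact μ u = 3 ℕ.≤ u × ℓ ℕ.^ μ ℕ.∣ magnitude u × ℓ ℕ.^ suc μ ℕ.∤ magnitude u

  exact? : ∀ μ → Decidable (Exact μ)
  exact? μ u = (3 ℕ.≤? u) ×-dec (ℓ ℕ.^ μ ℕ.∣? magnitude u) ×-dec ¬? (ℓ ℕ.^ suc μ ℕ.∣? magnitude u)

  ∤-^ : ∀ {u} → ℓ ℕ.∤ u → ∀ n → ℓ ℕ.∤ u ℕ.^ n
  ∤-^ ℓ∤u zero    p = ℕ.<⇒≱ (ℕ.nonTrivial⇒n>1 ℓ) (ℕ.∣⇒≤ p)
  ∤-^ {u} ℓ∤u (suc n) p with euclidsLemma u (u ℕ.^ n) ℓ-prime p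
  ... | inj₁ q = ℓ∤u q
  ... | inj₂ q = ∤-^ ℓ∤u n q

  ^-monoˡ-∣ : ∀ {u} → ℓ ℕ.∣ u → ∀ n → ℓ ℕ.^ n ℕ.∣ u ℕ.^ n
  ^-monoˡ-∣ p zero    = ℕ.∣-refl
  ^-monoˡ-∣ p (suc n) = ℕ.*-pres-∣ p (^-monoˡ-∣ p n)

  -- Correction term, with w = u - 2. If ℓ divides u then w has valuation 0 although u does not
  -- count for μ = 0. For μ > 0 divisibility of w by ℓ already rules out ℓ ∣ u.
  excluded : ℕ → ℕ → ℕ
  excluded zero    w = χ (ℓ ℕ.∣? (2 ℕ.+ w))
  excluded (suc _) w = 0

  ∣2+w⇒∤w : ∀ {w} → ℓ ℕ.∣ 2 ℕ.+ w → ℓ ℕ.∤ w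
  ∣2+w⇒∤w {w} p q = ℕ.<⇒≱ 2<ℓ (ℕ.∣⇒≤ (ℕ.∣m+n∣m⇒∣n (subst (ℓ ℕ.∣_) (ℕ.+-comm 2 w) p) q))

  ℓ∣ℓ^suc : ∀ μ → ℓ ℕ.∣ ℓ ℕ.^ suc μ
  ℓ∣ℓ^suc μ = ℕ.m∣m*n (ℓ ℕ.^ μ)

  -- For large u, u^(u-3) (u-2) is exactly divisible by ℓ^μ iff ℓ ∤ u and u - 2 is.
  exact-indicator : ∀ μ w → 2 ℕ.+ μ ℕ.≤ w →
    χ (exact? μ (2 ℕ.+ w)) ℕ.+ (χ (ℓ ℕ.^ suc μ ℕ.∣? w) ℕ.+ excluded μ w) ≡ χ (ℓ ℕ.^ μ ℕ.∣? w)
  exact-indicator μ (suc w) (s≤s 1+μ≤w) with ℓ ℕ.∣? (3 ℕ.+ w)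
  ... | yes ℓ∣u = trans (cong₂ ℕ._+_ (χ-no (exact? μ (3 ℕ.+ w)) λ (_ , _ , q) → q too-divisible)
      (cong (ℕ._+ excluded μ (suc w)) (χ-no (ℓ ℕ.^ suc μ ℕ.∣? suc w) (ℓ∤w ∘ ℕ.∣-trans (ℓ∣ℓ^suc μ)))))
      (rest μ)
    where
    ℓ∤w : ℓ ℕ.∤ suc w
    ℓ∤w = ∣2+w⇒∤w ℓ∣u
    too-divisible : ℓ ℕ.^ suc μ ℕ.∣ magnitude (3 ℕ.+ w)
    -- The exponent u - 3 equals `w` here and is at least μ + 1; this is where the threshold u ≥ μ +
    -- 4 comes from.
    too-divisible = ℕ.∣m⇒∣m*n (suc w) (ℕ.∣-trans (^-mono-∣ 1+μ≤w) (^-monoˡ-∣ ℓ∣u w))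
    rest : ∀ μ → excluded μ (suc w) ≡ χ (ℓ ℕ.^ μ ℕ.∣? suc w)
    rest zero    = trans (χ-yes (ℓ ℕ.∣? (3 ℕ.+ w)) ℓ∣u) (sym (χ-yes (1 ℕ.∣? suc w) (ℕ.1∣ suc w)))
    rest (suc μ) = sym (χ-no (ℓ ℕ.^ suc μ ℕ.∣? suc w) (ℓ∤w ∘ ℕ.∣-trans (ℓ∣ℓ^suc μ)))
  ... | no  ℓ∤u = trans (cong (χ (exact? μ (3 ℕ.+ w)) ℕ.+_)
      (trans (cong (χ (ℓ ℕ.^ suc μ ℕ.∣? suc w) ℕ.+_) (rest μ)) (ℕ.+-identityʳ _))) main
    where
    rest : ∀ μ → excluded μ (suc w) ≡ 0
    rest zero    = χ-no (ℓ ℕ.∣? (3 ℕ.+ w)) ℓ∤u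
    rest (suc μ) = refl
    -- The power of u is prime to ℓ, so the valuation of the product is that of u - 2.
    strip : ∀ j → ℓ ℕ.^ j ℕ.∣ magnitude (3 ℕ.+ w) → ℓ ℕ.^ j ℕ.∣ suc w
    strip j = cancel-unit (∤-^ ℓ∤u w) j (suc w)
    main : χ (exact? μ (3 ℕ.+ w)) ℕ.+ χ (ℓ ℕ.^ suc μ ℕ.∣? suc w) ≡ χ (ℓ ℕ.^ μ ℕ.∣? suc w)
    main with ℓ ℕ.^ suc μ ℕ.∣? suc w
    ... | yes p = trans (cong (ℕ._+ 1) (χ-no (exact? μ (3 ℕ.+ w)) λ (_ , _ , q) →
            q (ℕ.∣n⇒∣m*n ((3 ℕ.+ w) ℕ.^ w) p)))
          (sym (χ-yes (ℓ ℕ.^ μ ℕ.∣? suc w) (ℕ.∣-trans (^-mono-∣ (ℕ.n≤1+n μ)) p)))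
    ... | no ¬p = trans (ℕ.+-identityʳ _) (χ-cong (exact? μ (3 ℕ.+ w)) (ℓ ℕ.^ μ ℕ.∣? suc w)
          (λ (_ , q , _) → strip μ q)
          (λ q → s≤s (s≤s (s≤s z≤n)) , ℕ.∣n⇒∣m*n ((3 ℕ.+ w) ℕ.^ w) q , ¬p ∘ strip (suc μ)))

  exactPerPeriod : ℕ → ℕ
  exactPerPeriod zero    = ℓ ∸ 2
  exactPerPeriod (suc _) = ℓ ∸ 1

  period : ℕ → ℕ
  period μ = ℓ ℕ.^ suc μ

  excludedPerPeriod : ℕ → ℕ
  excludedPerPeriod zero    = 1
  excludedPerPeriod (suc _) = 0

  excluded-window : ∀ μ s → windowSum (excluded μ) s (period μ) ≡ excludedPerPeriod μ
  excluded-window zero s = trans (windowSum-shift (λ u → χ (ℓ ℕ.∣? u)) 2 s (period 0))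
    (trans (cong (windowSum _ (2 ℕ.+ s)) (ℕ.*-identityʳ ℓ)) (multiples ℓ (2 ℕ.+ s)))
  excluded-window (suc μ) s = zeros (period (suc μ))
    where
    zeros : ∀ n → windowSum (excluded (suc μ)) s n ≡ 0
    zeros zero    = refl
    zeros (suc n) = zeros n

  exactPerPeriod-+ : ∀ μ → exactPerPeriod μ ℕ.+ (1 ℕ.+ excludedPerPeriod μ) ≡ ℓ
  exactPerPeriod-+ zero    = ℕ.m∸n+n≡m (ℕ.<⇒≤ 2<ℓ)
  exactPerPeriod-+ (suc _) = ℕ.m∸n+n≡m (ℕ.<⇒≤ (ℕ.nonTrivial⇒n>1 ℓ))

  -- Among ℓ^(μ+1) consecutive values of w = u - 2 there are ℓ multiples of ℓ^μ and one multiple of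
  -- ℓ^(μ+1), and for μ = 0 one further class is excluded. Both sides are compared after adding the
  -- discarded classes, so no truncated subtraction of sums occurs.
  exact-window : ∀ μ s → 4 ℕ.+ μ ℕ.≤ s → windowSum (χ ∘ exact? μ) s (period μ) ≡ exactPerPeriod μ
  exact-window μ (suc (suc s)) (s≤s (s≤s 2+μ≤s)) = ℕ.+-cancelʳ-≡ (1 ℕ.+ excludedPerPeriod μ) _ _ (begin
    windowSum (χ ∘ exact? μ) (2 ℕ.+ s) p ℕ.+ (1 ℕ.+ excludedPerPeriod μ)
      ≡⟨ cong₂ ℕ._+_ (windowSum-shift (χ ∘ exact? μ) 2 s p)
           (cong₂ ℕ._+_ (multiples (ℓ ℕ.^ suc μ) s {{ℕ.m^n≢0 ℓ (suc μ)}}) (excluded-window μ s)) ⟨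
    windowSum f s p ℕ.+ (windowSum g s p ℕ.+ windowSum (excluded μ) s p)
      ≡⟨ cong (windowSum f s p ℕ.+_) (windowSum-+ g (excluded μ) s p) ⟨
    windowSum f s p ℕ.+ windowSum (λ w → g w ℕ.+ excluded μ w) s p
      ≡⟨ windowSum-+ f (λ w → g w ℕ.+ excluded μ w) s p ⟨
    windowSum (λ w → f w ℕ.+ (g w ℕ.+ excluded μ w)) s p
      ≡⟨ windowSum-cong s p (λ i → exact-indicator μ (s ℕ.+ i) (ℕ.≤-trans 2+μ≤s (ℕ.m≤m+n s i))) ⟩
    windowSum (λ w → χ (ℓ ℕ.^ μ ℕ.∣? w)) s p
      ≡⟨ multiples-* (ℓ ℕ.^ μ) ℓ s {{ℕ.m^n≢0 ℓ μ}} ⟩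
    ℓ
      ≡⟨ exactPerPeriod-+ μ ⟨
    exactPerPeriod μ ℕ.+ (1 ℕ.+ excludedPerPeriod μ) ∎)
    where
    open ≡-Reasoning
    p : ℕ
    p = period μ
    f g : ℕ → ℕ
    f w = χ (exact? μ (2 ℕ.+ w))
    g w = χ (ℓ ℕ.^ suc μ ℕ.∣? w)

  exactPerPeriod≤period : ∀ μ → exactPerPeriod μ ℕ.≤ period μ
  exactPerPeriod≤period μ = ℕ.≤-trans (subst (exactPerPeriod μ ℕ.≤_) (exactPerPeriod-+ μ) (ℕ.m≤m+n _ _))
    (ℕ.m≤m*n ℓ (ℓ ℕ.^ μ) {{ℕ.m^n≢0 ℓ μ}})

  discrepancy : ℕ → ℕ
  discrepancy μ = (4 ℕ.+ μ ℕ.+ period μ) ℕ.* period μ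

  exact-discrepancy : ∀ μ m →
    ℤ.∣ count (exact? μ) m ℕ.* period μ ⊖ m ℕ.* exactPerPeriod μ ∣ ℕ.≤ discrepancy μ
  exact-discrepancy μ = density-bound (count (exact? μ)) (4 ℕ.+ μ) (period μ) (exactPerPeriod μ)
    {{ℕ.m^n≢0 ℓ (suc μ)}} (exactPerPeriod≤period μ) (count≤ (exact? μ))
    (λ m b≤m → trans (count-window (exact? μ) m (period μ)) (cong (ℕ._+ count (exact? μ) m) (exact-window μ m b≤m)))

-- Limits of the proportions

module Proportions (ℓ : ℕ) (ℓ-prime : Prime ℓ) (ℓ≢2 : ℓ ≢ 2) where

  open Counting ℓ ℓ-prime
  open CharacteristicSeries ℓ ℓ-prime using (characteristicSeries-isSquareMultiple)
  open Invariants ℓ ℓ-prime using (invariants-unique; invariants-exist)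
  open ExactPower ℓ ℓ-prime ℓ≢2

  private instance
    _ = prime⇒nonZero ℓ-prime

  module _ (γ : Family) {a : ℤₗ} (a-unit : IsUnit a) where

    invariants⇒exact : ∀ {u μ λ′} → 3 ℕ.≤ u →
      HasInvariants (characteristicSeries (voltage γ a u)) μ λ′ → λ′ ≡ + 1 × Exact μ u
    invariants⇒exact {u} {μ} {λ′} 3≤u H =
      let λ′≡1 , p , q = invariants-unique {magnitude u} {characteristicSeries (voltage γ a u)} {μ} {λ′}
            (characteristicSeries-isSquareMultiple γ a-unit u 3≤u) H
      in λ′≡1 , 3≤u , p , q

    exact⇒invariants : ∀ {u μ} → Exact μ u →
      HasInvariants (characteristicSeries (voltage γ a u)) μ (+ 1)
    exact⇒invariants {u} {μ} (3≤u , p , q) =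
      invariants-exist {magnitude u} {characteristicSeries (voltage γ a u)} {μ}
        (characteristicSeries-isSquareMultiple γ a-unit u 3≤u) p q

    -- Neither u ≤ x nor having given invariants is directly decidable. The first becomes u < m
    -- through the cardinality of A(x), the second the decidable `Exact μ u`.
    𝒯≤-card : ∀ μ x {m} → HasCard (𝒜≤ x) m → HasCard (𝒯≤ μ (+ 1) γ a x) (count (exact? μ) m)
    𝒯≤-card μ x {m} card = hasCard-count (exact? μ) m λ u → mk⇔ to from
      where
      below : ∀ u → 𝒜≤ x u ⇔ u ℕ.< m
      below = card-downwardClosed (𝒜≤-downwardClosed x) card
      to : ∀ {u} → 𝒯≤ μ (+ 1) γ a x u → u ℕ.< m × Exact μ u
      to {u} (3≤u , u≤x , H) = Equivalence.to (below u) u≤x , proj₂ (invariants⇒exact 3≤u H)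
      from : ∀ {u} → u ℕ.< m × Exact μ u → 𝒯≤ μ (+ 1) γ a x u
      from {u} (u<m , exact) = proj₁ exact , Equivalence.from (below u) u<m , exact⇒invariants exact

    𝒯≤-empty : ∀ μ {λ′} x → λ′ ≢ + 1 → HasCard (𝒯≤ μ λ′ γ a x) 0
    𝒯≤-empty μ {λ′} x λ′≢1 = [] , [] , (λ u → mk⇔ (λ ()) (λ t → contradiction t (absurd u))) , refl
      where
      absurd : ∀ u → ¬ 𝒯≤ μ λ′ γ a x u
      absurd u (3≤u , _ , H) = λ′≢1 (proj₁ (invariants⇒exact 3≤u H))

  density-exact : ∀ μ → density μ (+ 1) ≡ (+ exactPerPeriod μ ℚ./ period μ) {{ℕ.m^n≢0 ℓ (suc μ)}}
  density-exact zero = ℚ./-cong {{prime⇒nonZero ℓ-prime}} {{ℕ.m^n≢0 ℓ 1}} (ℓ-≡ (ℕ.<⇒≤ 2<ℓ)) (sym (ℕ.*-identityʳ ℓ))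
    where
    ℓ-≡ : ∀ {k} → k ℕ.≤ ℓ → + ℓ ℤ.- + k ≡ + (ℓ ∸ k)
    ℓ-≡ {k} k≤ℓ = trans (ℤ.[+m]-[+n]≡m⊖n ℓ k) (ℤ.⊖-≥ k≤ℓ)
  density-exact (suc μ) = cong (λ z → (z ℚ./ period (suc μ)) {{ℕ.m^n≢0 ℓ (suc (suc μ))}})
    (trans (ℤ.[+m]-[+n]≡m⊖n ℓ 1) (ℤ.⊖-≥ (ℕ.>-nonZero⁻¹ ℓ)))

  density-else : ∀ μ λ′ → λ′ ≢ + 1 → density μ λ′ ≡ + 0 ℚ./ 1
  density-else zero    (+ 0)           _    = refl
  density-else zero    (+ 1)           λ′≢1 = contradiction refl λ′≢1
  density-else zero    (+ suc (suc _)) _    = refl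
  density-else zero    ℤ.-[1+ _ ]      _    = refl
  density-else (suc _) (+ 0)           _    = refl
  density-else (suc _) (+ 1)           λ′≢1 = contradiction refl λ′≢1
  density-else (suc _) (+ suc (suc _)) _    = refl
  density-else (suc _) ℤ.-[1+ _ ]      _    = refl

  relativeDensity : ∀ a → IsUnit a → ∀ γ μ λ′ → HasRelativeDensity (𝒯≤ μ λ′ γ a) 𝒜≤ (density μ λ′)
  relativeDensity a a-unit γ μ λ′ ε 0<ε = byCases (λ′ ℤ.≟ + 1)
    where
    byCases : Dec (λ′ ≡ + 1) → ∃[ N ] ∀ x → N ≤ʳ x → ∀ m .{{_ : NonZero m}} → HasCard (𝒜≤ x) m →
      ∃[ n ] HasCard (𝒯≤ μ λ′ γ a x) n × ℚ.∣ (+ n ℚ./ m) ℚ.- density μ λ′ ∣ ℚ.< ε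
    byCases (no λ′≢1) = 0 , λ x 0≤x m card → 0 , 𝒯≤-empty γ a-unit μ x λ′≢1 ,
      subst (λ L → ℚ.∣ (+ 0 ℚ./ m) ℚ.- L ∣ ℚ.< ε) (sym (density-else μ λ′ λ′≢1))
        (ratio-close 0 m 0 1 0 ε 0<ε
          (ℕ.≤-reflexive (cong (λ z → ℤ.∣ 0 ⊖ z ∣) (ℕ.*-zeroʳ m))) (ℕ.>-nonZero⁻¹ m))
    -- The threshold N is K · `↧ₙ ε` with K the uniform discrepancy. Since N ≤ x, N itself belongs
    -- to A(x), whose elements are the numbers below m; hence N < m, the strict inequality asked for
    -- by `ratio-close`.
    byCases (yes refl) = discrepancy μ ℕ.* ℚ.↧ₙ ε , λ x N≤x m {{m≢0}} card →
      count (exact? μ) m , 𝒯≤-card γ a-unit μ x card ,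
      subst (λ L → ℚ.∣ (+ count (exact? μ) m ℚ./ m) ℚ.- L ∣ ℚ.< ε) (sym (density-exact μ))
        (ratio-close (count (exact? μ) m) m (exactPerPeriod μ) (period μ) (discrepancy μ) ε
          {{m≢0}} {{ℕ.m^n≢0 ℓ (suc μ)}} 0<ε (exact-discrepancy μ m)
          (Equivalence.to (card-downwardClosed (𝒜≤-downwardClosed x) card (discrepancy μ ℕ.* ℚ.↧ₙ ε)) N≤x))

theorem6p4 : (ℓ : ℕ) (ℓ-prime : Prime ℓ) → ℓ ≢ 2 →
    let open Counting ℓ ℓ-prime in
    (a : ℤₗ) → IsUnit a → (γ : Family) (μ : ℕ) (λ′ : ℤ) →
    HasRelativeDensity (𝒯≤ μ λ′ γ a) 𝒜≤ (density μ λ′)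
theorem6p4 ℓ ℓ-prime ℓ≢2 = Proportions.relativeDensity ℓ ℓ-prime ℓ≢2
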